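{- The problem Uniform Cluster Exclusive Vertex Splitting (UCEVS), parameterized by the solution size $k$, admits a kernel with at most $4k$ vertices.
   Context: All graphs are finite, simple and undirected. A uniform cluster graph is a graph that is a disjoint union of cliques, all of the same size. An exclusive vertex split of a graph $G$ at a vertex $v$ replaces $v$ by two new vertices $v_1,v_2$ such that $N(v_1)\cup N(v_2)=N(v)$ and $N(v_1)\cap N(v_2)=\emptyset$, where $N(v)$ is the neighborhood of $v$ in $G$ and $N(v_1),N(v_2)$ are the neighborhoods in the new graph (so $v_1,v_2$ are non-adjacent); all adjacencies not involving $v$ are unchanged. UCEVS: Input: a graph $G=(V,E)$ and a positive integer $k$. Question: is there a sequence of at most $k$ exclusive vertex splits (each applied to the graph resulting from the previous one) that transforms $G$ into a uniform cluster graph? A kernel with at most $f(k)$ vertices for a parameterized graph problem is a polynomial-time algorithm that maps every instance $(G,k)$ to an instance $(G',k')$ of the same problem such that $(G,k)$ is a yes-instance if and only if $(G',k')$ is a yes-instance, $|V(G')|\le f(k)$, and $k'$ is bounded by a computable function of $k$. -}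

module Defs where

open import Data.Bool using (Bool; true; false; T)
open import Data.Fin using (Fin; zero; suc)
open import Data.List using (List; []; _∷_; tabulate)
open import Data.Nat using (ℕ; zero; suc; _+_; _*_; _^_; _≤_; _<_)
open import Data.Product using (Σ-syntax; ∃-syntax; _×_; _,_; proj₁)
open import Data.Sum using (_⊎_)
open import Data.Vec using (Vec; []; _∷_; lookup)
open import Function.Bundles using (_⇔_; _↔_; Inverse)
open import Relation.Binary.PropositionalEquality using (_≡_; _≢_)
open import Relation.Nullary using (¬_)

------------------------------------------------------------------------
-- Graphs

record Graph (n : ℕ) : Set where
  field
    adj    : Fin n → Fin n → Bool
    sym    : ∀ u w → adj u w ≡ adj w u
    irrefl : ∀ u → adj u u ≡ false

  Adj : Fin n → Fin n → Set
  Adj u w = T (adj u w)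

open Graph public using (Adj)

-- H is isomorphic to the disjoint union of c copies of the clique on s
-- vertices; (i , x) is the x-th vertex of the i-th clique.
record UniformCluster {m} (H : Graph m) : Set where
  field
    c s : ℕ
    iso : Fin m ↔ (Fin c × Fin s)
    adj⇔sameClique : ∀ u w →
      Adj H u w ⇔ (u ≢ w × proj₁ (Inverse.to iso u) ≡ proj₁ (Inverse.to iso w))

-- H arises from G by splitting v. The new vertices v₁, v₂ are labelled
-- zero and suc v; every other vertex u of G is labelled suc u in H.
module _ {n} (G : Graph n) (v : Fin n) (H : Graph (suc n)) where

  private
    v₁ v₂ : Fin (suc n)
    v₁ = zero
    v₂ = suc v

  record ExclusiveSplit : Set where
    field
      union       : ∀ u → u ≢ v → (Adj H v₁ (suc u) ⊎ Adj H v₂ (suc u)) ⇔ Adj G v u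
      disjoint    : ∀ u → ¬ (Adj H v₁ u × Adj H v₂ u)
      nonadjacent : ¬ Adj H v₁ v₂
      unchanged   : ∀ u w → u ≢ v → w ≢ v → Adj H (suc u) (suc w) ⇔ Adj G u w

data Splits : ∀ {n m} → ℕ → Graph n → Graph m → Set where
  done : ∀ {n} {G : Graph n} → Splits 0 G G
  step : ∀ {n m j} {G : Graph n} {H : Graph (suc n)} {K : Graph m} (v : Fin n) →
         ExclusiveSplit G v H → Splits j H K → Splits (suc j) G K

------------------------------------------------------------------------
-- Parameterized graph problems

record Instance : Set where
  field
    order    : ℕ
    graph    : Graph order
    k        : ℕ
    positive : 0 < k

open Instance public using (order; graph; k)

UCEVS : Instance → Set
UCEVS I = ∃[ j ] ∃[ m ] Σ[ H ∈ Graph m ]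
  (j ≤ k I × Splits j (graph I) H × UniformCluster H)

------------------------------------------------------------------------
-- Model of computation: first-order call-by-value recursive programs over
-- binary trees (pure Lisp with the single atom nil, cf. N. D. Jones,
-- "Computability and Complexity from a Programming Perspective"), with
-- unit cost per evaluation step. With shared (pointer) representation of
-- trees it is Turing complete and polynomially equivalent to Turing
-- machines.

data Tree : Set where
  nil : Tree
  _∙_ : Tree → Tree → Tree

∥_∥ : Tree → ℕ
∥ nil   ∥ = 1
∥ s ∙ t ∥ = 1 + ∥ s ∥ + ∥ t ∥

-- Expressions over F unary function names and n variables in scope
-- (de Bruijn indices).
data Expr (F : ℕ) : ℕ → Set where
  var  : ∀ {n} → Fin n → Expr F n
  nil  : ∀ {n} → Expr F n
  cons : ∀ {n} → Expr F n → Expr F n → Expr F n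
  hd   : ∀ {n} → Expr F n → Expr F n
  tl   : ∀ {n} → Expr F n → Expr F n
  if   : ∀ {n} → Expr F n → Expr F n → Expr F n → Expr F n
  let′ : ∀ {n} → Expr F n → Expr F (suc n) → Expr F n
  call : ∀ {n} → Fin F → Expr F n → Expr F n

record Program : Set where
  field
    funs : ℕ
    body : Vec (Expr funs 1) funs
    main : Expr funs 1

head′ : Tree → Tree
head′ nil     = nil
head′ (s ∙ t) = s

tail′ : Tree → Tree
tail′ nil     = nil
tail′ (s ∙ t) = t

-- Eval body ρ e v t : in environment ρ, e evaluates to v in t steps.
-- In a conditional, nil is false and every other tree is true.
data Eval {F} (body : Vec (Expr F 1) F) : ∀ {n} → Vec Tree n → Expr F n → Tree → ℕ → Set where
  var   : ∀ {n} {ρ : Vec Tree n} (x : Fin n) →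
          Eval body ρ (var x) (lookup ρ x) 1
  nil   : ∀ {n} {ρ : Vec Tree n} →
          Eval body ρ nil nil 1
  cons  : ∀ {n} {ρ : Vec Tree n} {e₁ e₂ v₁ v₂ t₁ t₂} →
          Eval body ρ e₁ v₁ t₁ → Eval body ρ e₂ v₂ t₂ →
          Eval body ρ (cons e₁ e₂) (v₁ ∙ v₂) (1 + t₁ + t₂)
  hd    : ∀ {n} {ρ : Vec Tree n} {e v t} →
          Eval body ρ e v t →
          Eval body ρ (hd e) (head′ v) (1 + t)
  tl    : ∀ {n} {ρ : Vec Tree n} {e v t} →
          Eval body ρ e v t →
          Eval body ρ (tl e) (tail′ v) (1 + t)
  ifYes : ∀ {n} {ρ : Vec Tree n} {e e₁ e₂ a b v t t₁} →
          Eval body ρ e (a ∙ b) t → Eval body ρ e₁ v t₁ →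
          Eval body ρ (if e e₁ e₂) v (1 + t + t₁)
  ifNo  : ∀ {n} {ρ : Vec Tree n} {e e₁ e₂ v t t₂} →
          Eval body ρ e nil t → Eval body ρ e₂ v t₂ →
          Eval body ρ (if e e₁ e₂) v (1 + t + t₂)
  let′  : ∀ {n} {ρ : Vec Tree n} {e₁ e₂ v₁ v₂ t₁ t₂} →
          Eval body ρ e₁ v₁ t₁ → Eval body (v₁ ∷ ρ) e₂ v₂ t₂ →
          Eval body ρ (let′ e₁ e₂) v₂ (1 + t₁ + t₂)
  call  : ∀ {n} {ρ : Vec Tree n} {f e v w t₁ t₂} →
          Eval body ρ e v t₁ → Eval body (v ∷ []) (lookup body f) w t₂ →
          Eval body ρ (call f e) w (1 + t₁ + t₂)

Run : Program → Tree → Tree → ℕ → Set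
Run P x y t = Eval (Program.body P) (x ∷ []) (Program.main P) y t

Computable : {A B : Set} → (A → Tree) → (B → Tree) → (A → B) → Set
Computable ⌜_⌝ᴬ ⌜_⌝ᴮ f =
  Σ[ P ∈ Program ] (∀ x → ∃[ t ] Run P ⌜ x ⌝ᴬ ⌜ f x ⌝ᴮ t)

PolyTime : {A B : Set} → (A → Tree) → (B → Tree) → (A → B) → Set
PolyTime ⌜_⌝ᴬ ⌜_⌝ᴮ f =
  Σ[ P ∈ Program ] ∃[ c ] ∃[ d ]
    (∀ x → ∃[ t ] (Run P ⌜ x ⌝ᴬ ⌜ f x ⌝ᴮ t × t ≤ c * ∥ ⌜ x ⌝ᴬ ∥ ^ d))

codeBool : Bool → Tree
codeBool false = nil
codeBool true  = nil ∙ nil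

-- Unary, so that running times are measured in the input size plus k.
codeℕ : ℕ → Tree
codeℕ zero    = nil
codeℕ (suc n) = nil ∙ codeℕ n

codeList : {A : Set} → (A → Tree) → List A → Tree
codeList code []       = nil
codeList code (x ∷ xs) = code x ∙ codeList code xs

-- The adjacency matrix, as the list of its rows.
codeGraph : ∀ {n} → Graph n → Tree
codeGraph G =
  codeList (codeList codeBool) (tabulate (λ u → tabulate (Graph.adj G u)))

codeInstance : Instance → Tree
codeInstance I = codeGraph (graph I) ∙ codeℕ (k I)

------------------------------------------------------------------------
-- Kernels

record Kernel (Π : Instance → Set) (f : ℕ → ℕ) : Set where
  field
    reduce     : Instance → Instance
    polyTime   : PolyTime codeInstance codeInstance reduce
    equivalent : ∀ I → Π I ⇔ Π (reduce I)
    vertices   : ∀ I → order (reduce I) ≤ f (k I)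
    bound      : ℕ → ℕ
    computable : Computable codeℕ codeℕ bound
    parameter  : ∀ I → k (reduce I) ≤ bound (k I)

{-# OPTIONS --safe #-}

-- A sequence of splits is a map of the final graph onto the original one that
-- is bijective on edges, so a solution with cliques of order s is a partition
-- of the edges into copies of K_s covering every vertex, and its cost is the
-- number of pairs (clique, vertex in it) minus the number of vertices.
--
-- Let n > 4k. A solution has at most k split vertices, so it leaves a vertex
-- unsplit; its degree s − 1 is then the minimum degree d, and the closed
-- neighbourhood of every vertex of minimum degree is one of the cliques.
-- The edges outside these forced cliques live on at most k vertices, all of
-- them split, and form the rest graph, which must again be partitioned into
-- copies of K_s. The number of edges determines the cost of the whole
-- solution, so the cost can be checked without solving the rest graph. The
-- kernel is the rest graph together with t disjoint copies of K_s, where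
-- k < t s ≤ 2k (one may assume s ≤ k, as an empty rest graph needs no solving):
-- more than k of its vertices lie in these copies, so one of them is unsplit,
-- which excludes a solution with another clique order.
module Submission where

open import Defs
open import Data.Bool using (Bool; true; false; T; if_then_else_)
open import Data.Empty using (⊥; ⊥-elim)
open import Data.Fin using (Fin; zero; suc; toℕ; fromℕ; cast; remQuot; combine; _↑ˡ_; _↑ʳ_)
open import Data.Fin.Induction using (<-wellFounded)
open import Data.Fin.Permutation using (↔⇒≡)
open import Data.List
  using (List; []; _∷_; _++_; length; map; filter; concatMap; lookup; allFin; upTo; applyUpTo; tabulate)
open import Data.List.Membership.Propositional using (_∈_; find; lose)
open import Data.List.Membership.Propositional.Properties
open import Data.List.Properties
  using (length-map; length-++; length-tabulate; length-upTo; map-tabulate;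
         map-upTo; tabulate-lookup; tabulate-cong)
open import Data.List.Relation.Unary.All as All using (All; []; _∷_)
open import Data.List.Relation.Unary.AllPairs using ([]; _∷_)
open import Data.List.Relation.Unary.Any as Any using (Any; here; there; index)
open import Data.List.Relation.Unary.Any.Properties using (lookup-index)
open import Data.List.Relation.Unary.Unique.Propositional using (Unique)
open import Data.Nat
open import Data.Nat.DivMod
open import Data.Nat.Properties
open import Data.Nat.Tactic.RingSolver using (solve-∀)
open import Data.Product using (Σ-syntax; ∃-syntax; _×_; _,_; proj₁; proj₂)
open import Data.Sum using (_⊎_; inj₁; inj₂)
open import Data.Vec as Vec using (Vec; []; _∷_)
open import Data.Vec.Properties using (lookup-++ˡ; lookup-++ʳ; lookup-map)
open import Function using (_∘_; id; const)
open import Function.Bundles using (_⇔_; mk⇔; Equivalence; mk↔ₛ′; Inverse)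
open import Function.Construct.Composition using (_↔-∘_)
open import Function.Construct.Symmetry using (↔-sym)
open import Induction.WellFounded using (Acc; acc)
open import Relation.Binary using (DecidableEquality)
open import Relation.Binary.PropositionalEquality hiding (J)
open import Relation.Nullary
  using (Dec; yes; no; does; ¬_; ¬?; _×-dec_; _⊎-dec_; _→-dec_; Reflects; ofʸ; ofⁿ; _because_; from-yes)
open import Relation.Nullary.Decidable using (does-⇔; dec-false; decidable-stable; T?)
open import Relation.Unary using (Decidable)
import Data.Bool.Properties as Bool
import Data.Fin.Properties as Fin
import Data.List.Membership.DecPropositional as DecMembership
import Data.List.Relation.Unary.Unique.Propositional.Properties as Unique
import Data.Product.Properties as Product
import Data.Sum.Properties as Sum
open Equivalence using (to; from)

-- Lists without repetition

-- The forced cliques do not appear in the kernel, so their faults have to be found beforehand: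
-- `Good` tests that they are cliques, distinct ones sharing at most one vertex, that the edge count
-- fits the budget and that the rest is small. The padding makes the rest graph remember `d`;
-- without it, the rest could be partitioned into single edges, which says nothing about the given
-- graph. The parameter stays `k` because the cliques on the rest alone cost at most `k`: every
-- other vertex accounts for a pair of its own outside them. A clique of order `s` has `s (s - 1)`
-- ordered pairs, so the edge count gives the cost only after division by `s - 1`; the case `d = 0`
-- is therefore settled separately. The second obstacle is the running time, which demands an actual
-- program with a step count. For this reason `Good` and `kernel` are composed of comparisons,
-- quantifiers over vertices and filtered lists, which translate directly into a term language all
-- of whose terms run in polynomial time.

private variable
  A B : Set

lookup-injective : {xs : List A} → Unique xs → ∀ {i j} → lookup xs i ≡ lookup xs j → i ≡ j
lookup-injective (_ ∷ _)  {zero}  {zero}  eq = refl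
lookup-injective (x∉ ∷ _) {zero}  {suc j} eq = ⊥-elim (All.lookup x∉ (∈-lookup j) eq)
lookup-injective (x∉ ∷ _) {suc i} {zero}  eq = ⊥-elim (All.lookup x∉ (∈-lookup i) (sym eq))
lookup-injective (_ ∷ u)  {suc i} {suc j} eq = cong suc (lookup-injective u eq)

-- The image of `x` may depend on the proof of `x ∈ xs`, so the counting map lives on positions;
-- injectivity is a condition on `R` alone and thus independent of these proofs.
injective⇒length≤ : {xs : List A} {ys : List B} (R : A → B → Set) → Unique xs →
  (∀ {x} → x ∈ xs → ∃[ y ] y ∈ ys × R x y) →
  (∀ {x x′ y} → R x y → R x′ y → x ≡ x′) → length xs ≤ length ys
injective⇒length≤ {xs = xs} {ys} R u total inj = Fin.injective⇒≤ {f = g} λ {i} {j} eq →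
  lookup-injective u (inj (R-g i) (subst (R _) (cong (lookup ys) (sym eq)) (R-g j)))
  where
  g : Fin (length xs) → Fin (length ys)
  g i = index (proj₁ (proj₂ (total (∈-lookup i))))
  R-g : ∀ i → R (lookup xs i) (lookup ys (g i))
  R-g i with y , y∈ , r ← total (∈-lookup {xs = xs} i) = subst (R _) (lookup-index y∈) r

⊆⇒length≤ : {xs ys : List A} → Unique xs → (∀ {x} → x ∈ xs → x ∈ ys) → length xs ≤ length ys
⊆⇒length≤ u sub = injective⇒length≤ _≡_ u (λ x∈ → _ , sub x∈ , refl) (λ p q → trans p (sym q))

pairs : List B → (B → List A) → List (B × A)
pairs J K = concatMap (λ b → map (b ,_) (K b)) J

∈-pairs⁺ : {J : List B} (K : B → List A) {b : B} {u : A} → b ∈ J → u ∈ K b → (b , u) ∈ pairs J K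
∈-pairs⁺ K (here refl) u∈ = ∈-++⁺ˡ (∈-map⁺ _ u∈)
∈-pairs⁺ {J = c ∷ _} K (there b∈) u∈ = ∈-++⁺ʳ (map (c ,_) (K c)) (∈-pairs⁺ K b∈ u∈)

∈-pairs⁻ : (J : List B) (K : B → List A) {b : B} {u : A} →
           (b , u) ∈ pairs J K → b ∈ J × u ∈ K b
∈-pairs⁻ (c ∷ J) K p with ∈-++⁻ (map (c ,_) (K c)) p
... | inj₁ q with _ , u∈ , refl ← ∈-map⁻ (c ,_) q = here refl , u∈
... | inj₂ q with b∈ , u∈ ← ∈-pairs⁻ J K q = there b∈ , u∈

pairs-unique : {J : List B} (K : B → List A) → Unique J → (∀ {b} → b ∈ J → Unique (K b)) →
               Unique (pairs J K)
pairs-unique K []                      uK = []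
pairs-unique {J = c ∷ J} K (c∉ ∷ uJ) uK =
  Unique.++⁺ (Unique.map⁺ (λ { refl → refl }) (uK (here refl)))
             (pairs-unique K uJ (uK ∘ there)) disjoint
  where
  disjoint : ∀ {p} → ¬ (p ∈ map (c ,_) (K c) × p ∈ pairs J K)
  disjoint (p , q) with _ , _ , refl ← ∈-map⁻ (c ,_) p =
    All.lookup c∉ (proj₁ (∈-pairs⁻ J K q)) refl

length-pairs : (J : List B) (K : B → List A) (s : ℕ) → (∀ {b} → b ∈ J → length (K b) ≡ s) →
               length (pairs J K) ≡ length J * s
length-pairs []      K s len = refl
length-pairs (c ∷ J) K s len = trans (length-++ (map (c ,_) (K c)))
  (cong₂ _+_ (trans (length-map (c ,_) (K c)) (len (here refl))) (length-pairs J K s (len ∘ there)))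

module _ (_≟_ : DecidableEquality A) where
  open DecMembership _≟_ using (_∈?_)

  -- An element of `ys` missing from `xs` could be put in front of `xs`, giving a repetition-free
  -- list inside `ys` that is too long.
  ⊆-antisym-length : {xs ys : List A} → Unique xs → (∀ {x} → x ∈ xs → x ∈ ys) →
                     length ys ≤ length xs → ∀ {y} → y ∈ ys → y ∈ xs
  ⊆-antisym-length {xs} {ys} u sub le {y} y∈ with y ∈? xs
  ... | yes y∈xs = y∈xs
  ... | no  y∉xs = ⊥-elim (1+n≰n (≤-trans
    (⊆⇒length≤ (All.tabulate (λ x∈ eq → y∉xs (subst (_∈ xs) (sym eq) x∈)) ∷ u)
               (λ { (here refl) → y∈ ; (there x∈) → sub x∈ })) le))

  others : A → List A → List A
  others u = filter (λ w → ¬? (u ≟ w))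

  length-others : ∀ {u xs} → Unique xs → u ∈ xs → suc (length (others u xs)) ≡ length xs
  length-others {u} {xs} uxs u∈ = ≤-antisym
    (⊆⇒length≤ (All.tabulate (λ w∈ → proj₂ (∈-filter⁻ ¬u? {xs = xs} w∈)) ∷ Unique.filter⁺ ¬u? uxs)
               (λ { (here refl) → u∈ ; (there w∈) → proj₁ (∈-filter⁻ ¬u? w∈) }))
    (⊆⇒length≤ uxs λ {x} x∈ → sub x x∈)
    where
    ¬u? = λ w → ¬? (u ≟ w)
    sub : ∀ x → x ∈ xs → x ∈ u ∷ others u xs
    sub x x∈ with u ≟ x
    ... | yes eq = here (sym eq)
    ... | no neq = there (∈-filter⁺ ¬u? x∈ neq)

  preimage : (B → A) → List B → List A → List B
  preimage f xs ys = filter (λ x → f x ∈? ys) xs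

  length-preimage : (f : B → A) {xs : List B} {ys : List A} → (∀ {x x′} → f x ≡ f x′ → x ≡ x′) →
    Unique xs → Unique ys → (∀ {y} → y ∈ ys → ∃[ x ] x ∈ xs × y ≡ f x) →
    length (preimage f xs ys) ≡ length ys
  length-preimage f {xs} {ys} inj uxs uys image = ≤-antisym
    (injective⇒length≤ (λ x y → f x ≡ y) (Unique.filter⁺ P? uxs)
      (λ x∈ → _ , proj₂ (∈-filter⁻ P? {xs = xs} x∈) , refl) (λ p q → inj (trans p (sym q))))
    (≤-trans (⊆⇒length≤ uys sub) (≤-reflexive (length-map f (preimage f xs ys))))
    where
    P? = λ x → f x ∈? ys
    sub : ∀ {y} → y ∈ ys → y ∈ map f (preimage f xs ys)
    sub y∈ with x , x∈ , refl ← image y∈ = ∈-map⁺ f (∈-filter⁺ P? x∈ y∈)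

length-filter-split : {P : A → Set} (P? : Decidable P) (xs : List A) →
  length (filter P? xs) + length (filter (¬? ∘ P?) xs) ≡ length xs
length-filter-split P? []       = refl
length-filter-split P? (x ∷ xs) with P? x
... | yes _ = cong suc (length-filter-split P? xs)
... | no _  = trans (+-suc _ _) (cong suc (length-filter-split P? xs))

-- Splitting sequences and clique decompositions

adj-sym : ∀ {n} (G : Graph n) {u w} → Adj G u w → Adj G w u
adj-sym G {u} {w} = subst T (Graph.sym G u w)

adj-irrefl : ∀ {n} (G : Graph n) {u w} → Adj G u w → u ≢ w
adj-irrefl G {u} a refl = subst T (Graph.irrefl G u) a

T-does : {P : Set} (d : Dec P) → T (does d) ⇔ P
T-does (yes p) = mk⇔ (λ _ → p) (λ _ → _)
T-does (no ¬p) = mk⇔ (λ ()) ¬p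

module _ {n} {E : Fin n → Fin n → Set} (E? : ∀ u w → Dec (E u w))
         (E-sym : ∀ {u w} → E u w → E w u) (E-irrefl : ∀ {u} → ¬ E u u) where

  graphOf : Graph n
  graphOf = record
    { adj    = λ u w → does (E? u w)
    ; sym    = λ u w → does-⇔ (mk⇔ E-sym E-sym) (E? u w) (E? w u)
    ; irrefl = λ u → dec-false (E? u u) E-irrefl
    }

-- A partition of the edges of the graph (L , E) into cliques K b of order s,
-- indexed by the b in J, every vertex being in some K b.
record Decomp {A B : Set} (L : List A) (E : A → A → Set) (J : List B) (K : B → List A) (s : ℕ) :
              Set where
  field
    J-unique : Unique J
    K-unique : ∀ {b} → b ∈ J → Unique (K b)
    K-length : ∀ {b} → b ∈ J → length (K b) ≡ s
    K⊆L      : ∀ {b u} → b ∈ J → u ∈ K b → u ∈ L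
    onto     : ∀ {u} → u ∈ L → ∃[ b ] b ∈ J × u ∈ K b
    clique   : ∀ {b u w} → b ∈ J → u ∈ K b → w ∈ K b → u ≢ w → E u w
    cover    : ∀ {u w} → u ∈ L → w ∈ L → E u w → ∃[ b ] b ∈ J × u ∈ K b × w ∈ K b
    same     : ∀ {b b′ u w} → b ∈ J → b′ ∈ J → u ∈ K b → w ∈ K b → u ∈ K b′ → w ∈ K b′ →
               u ≢ w → b ≡ b′

-- Numbers the cliques, so that their disjoint union can be built on `Fin (c * s)`.
reindex : ∀ {A B : Set} {L : List A} {E} {J : List B} {K s} → Decomp L E J K s →
          Decomp L E (allFin (length J)) (K ∘ lookup J) s
reindex {J = J} {K} D = record
  { J-unique = Unique.allFin⁺ _
  ; K-unique = λ {i} _ → K-unique (∈-lookup i)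
  ; K-length = λ {i} _ → K-length (∈-lookup i)
  ; K⊆L      = λ {i} _ → K⊆L (∈-lookup i)
  ; onto     = λ u∈L → let b , b∈ , u∈ = onto u∈L in
               index b∈ , ∈-allFin _ , subst (λ b → _ ∈ K b) (lookup-index b∈) u∈
  ; clique   = λ {i} _ → clique (∈-lookup i)
  ; cover    = λ u∈L w∈L e → let b , b∈ , u∈ , w∈ = cover u∈L w∈L e in
               index b∈ , ∈-allFin _ , subst (λ b → _ ∈ K b) (lookup-index b∈) u∈ ,
               subst (λ b → _ ∈ K b) (lookup-index b∈) w∈
  ; same     = λ {i} {i′} _ _ p q p′ q′ u≢w →
               lookup-injective J-unique (same (∈-lookup i) (∈-lookup i′) p q p′ q′ u≢w)
  }
  where open Decomp D

-- `lift` and `unique` together make `π` bijective on edges. `unique` speaks of one end only, as the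
-- other follows by exchanging the ends.
record Cover {n m} (G : Graph n) (H : Graph m) : Set where
  field
    π      : Fin m → Fin n
    onto   : ∀ v → ∃[ x ] π x ≡ v
    pres   : ∀ {x y} → Adj H x y → Adj G (π x) (π y)
    lift   : ∀ {u w} → Adj G u w → ∃[ x ] ∃[ y ] π x ≡ u × π y ≡ w × Adj H x y
    unique : ∀ {x x′ y y′} → π x ≡ π x′ → π y ≡ π y′ → Adj H x y → Adj H x′ y′ → x ≡ x′

cover-refl : ∀ {n} {G : Graph n} → Cover G G
cover-refl = record
  { π = id ; onto = λ v → v , refl ; pres = id
  ; lift = λ a → _ , _ , refl , refl , a ; unique = λ p _ _ _ → p }

cover-trans : ∀ {n m l} {G : Graph n} {H : Graph m} {K : Graph l} →
              Cover G H → Cover H K → Cover G K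
cover-trans {H = H} {K} C D = record
  { π      = C.π ∘ D.π
  ; onto   = λ v → let x , p = C.onto v ; y , q = D.onto x in y , trans (cong C.π q) p
  ; pres   = C.pres ∘ D.pres
  ; lift   = λ a → let _ , _ , p , q , b = C.lift a ; x , y , p′ , q′ , d = D.lift b in
             x , y , trans (cong C.π p′) p , trans (cong C.π q′) q , d
  ; unique = λ p q a a′ → D.unique (C.unique p q (D.pres a) (D.pres a′))
      (C.unique q p (adj-sym H (D.pres a)) (adj-sym H (D.pres a′))) a a′
  }
  where
  module C = Cover C
  module D = Cover D

split⇒cover : ∀ {n} {G : Graph n} {v} {H} → ExclusiveSplit G v H → Cover G H
split⇒cover {n} {G} {v} {H} S = record
  { π = π ; onto = λ u → suc u , refl ; pres = λ {x} {y} → pres x y ; lift = lift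
  ; unique = unique }
  where
  open ExclusiveSplit S
  open Equivalence

  π : Fin (suc n) → Fin n
  π zero    = v
  π (suc u) = u

  pres : ∀ x y → Adj H x y → Adj G (π x) (π y)
  pres zero    zero    a = ⊥-elim (adj-irrefl H a refl)
  pres zero    (suc w) a with w Fin.≟ v
  ... | yes refl = ⊥-elim (nonadjacent a)
  ... | no w≢v   = to (union w w≢v) (inj₁ a)
  pres (suc u) zero    a = adj-sym G (pres zero (suc u) (adj-sym H a))
  pres (suc u) (suc w) a with u Fin.≟ v | w Fin.≟ v
  ... | yes refl | yes refl = ⊥-elim (adj-irrefl H a refl)
  ... | yes refl | no w≢v   = to (union w w≢v) (inj₂ a)
  ... | no u≢v   | yes refl = adj-sym G (to (union u u≢v) (inj₂ (adj-sym H a)))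
  ... | no u≢v   | no w≢v   = to (unchanged u w u≢v w≢v) a

  lift-v : ∀ {w} → Adj G v w → ∃[ x ] π x ≡ v × Adj H x (suc w)
  lift-v {w} a with from (union w (adj-irrefl G a ∘ sym)) a
  ... | inj₁ b = zero , refl , b
  ... | inj₂ b = suc v , refl , b

  lift : ∀ {u w} → Adj G u w → ∃[ x ] ∃[ y ] π x ≡ u × π y ≡ w × Adj H x y
  lift {u} {w} a with u Fin.≟ v | w Fin.≟ v
  ... | yes refl | _        = let x , p , b = lift-v a in x , suc w , p , refl , b
  ... | no _     | yes refl = let x , p , b = lift-v (adj-sym G a) in
                              suc u , x , refl , p , adj-sym H b
  ... | no u≢v   | no w≢v   = suc u , suc w , refl , refl , from (unchanged u w u≢v w≢v) a

  fibre : ∀ x x′ → π x ≡ π x′ →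
          x ≡ x′ ⊎ π x ≡ v × (x ≡ zero × x′ ≡ suc v ⊎ x′ ≡ zero × x ≡ suc v)
  fibre zero    zero     p    = inj₁ refl
  fibre zero    (suc u)  refl = inj₂ (refl , inj₁ (refl , refl))
  fibre (suc u) zero     refl = inj₂ (refl , inj₂ (refl , refl))
  fibre (suc u) (suc u′) p    = inj₁ (cong suc p)

  unique : ∀ {x x′ y y′} → π x ≡ π x′ → π y ≡ π y′ → Adj H x y → Adj H x′ y′ → x ≡ x′
  unique {x} {x′} {y} {y′} p q a a′ with fibre x x′ p | fibre y y′ q
  ... | inj₁ x≡x′      | _              = x≡x′
  -- If both ends lie in the only fibre with two elements, their edge is mapped to a loop at `v`.
  ... | inj₂ (x↦v , _) | inj₂ (y↦v , _) =
    ⊥-elim (adj-irrefl G (pres x y a) (trans x↦v (sym y↦v)))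
  ... | inj₂ (_ , inj₁ (refl , refl)) | inj₁ refl = ⊥-elim (disjoint y (a , a′))
  ... | inj₂ (_ , inj₂ (refl , refl)) | inj₁ refl = ⊥-elim (disjoint y (a′ , a))

splits⇒cover : ∀ {j n m} {G : Graph n} {H : Graph m} → Splits j G H → Cover G H × m ≡ j + n
splits⇒cover done = cover-refl , refl
splits⇒cover {suc j} {n} (step v S Ss) with C , eq ← splits⇒cover Ss =
  cover-trans (split⇒cover S) C , trans eq (+-suc j n)

-- If x and y lie over the same vertex v, then v can be split so that one of the
-- new vertices has exactly x over it.
module SplitOff {n m} {G : Graph n} {H : Graph m} (C : Cover G H)
                {x y} (x≢y : x ≢ y) (πx≡πy : Cover.π C x ≡ Cover.π C y) where
  open Cover C

  π′ : Fin m → Fin (suc n)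
  π′ z with z Fin.≟ x
  ... | yes _ = zero
  ... | no _  = suc (π z)

  merge : Fin (suc n) → Fin n
  merge zero    = π x
  merge (suc u) = u

  merge-π′ : ∀ z → merge (π′ z) ≡ π z
  merge-π′ z with z Fin.≟ x
  ... | yes refl = refl
  ... | no _     = refl

  π′-≢ : ∀ {z} → z ≢ x → π′ z ≡ suc (π z)
  π′-≢ {z} z≢x with z Fin.≟ x
  ... | yes z≡x = ⊥-elim (z≢x z≡x)
  ... | no _    = refl

  π′-x : π′ x ≡ zero
  π′-x with x Fin.≟ x
  ... | yes _  = refl
  ... | no x≢x = ⊥-elim (x≢x refl)

  π′⇒π : ∀ {z a} → π′ z ≡ a → π z ≡ merge a
  π′⇒π {z} p = trans (sym (merge-π′ z)) (cong merge p)

  onto′ : ∀ a → ∃[ z ] π′ z ≡ a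
  onto′ zero    = x , π′-x
  onto′ (suc u) with onto u
  ... | z , p with z Fin.≟ x
  ...   | no z≢x   = z , trans (π′-≢ z≢x) (cong suc p)
  ...   | yes refl = y , trans (π′-≢ (x≢y ∘ sym)) (cong suc (trans (sym πx≡πy) p))

  E : Fin (suc n) → Fin (suc n) → Set
  E a b = ∃[ z ] ∃[ w ] π′ z ≡ a × π′ w ≡ b × Adj H z w

  E? : ∀ a b → Dec (E a b)
  E? a b = Fin.any? λ z → Fin.any? λ w → (π′ z Fin.≟ a) ×-dec (π′ w Fin.≟ b) ×-dec T? _

  E⇒Adj : ∀ {a b} → E a b → Adj G (merge a) (merge b)
  E⇒Adj (z , w , p , q , d) = subst₂ (Adj G) (π′⇒π p) (π′⇒π q) (pres d)

  G′ : Graph (suc n)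
  G′ = graphOf E? (λ (z , w , p , q , d) → w , z , q , p , adj-sym H d)
                  (λ e → adj-irrefl G (E⇒Adj e) refl)

  Adj⇔E : ∀ {a b} → Adj G′ a b ⇔ E a b
  Adj⇔E {a} {b} = T-does (E? a b)

  cover′ : Cover G′ H
  cover′ = record
    { π      = π′
    ; onto   = onto′
    ; pres   = λ {z} {w} d → Equivalence.from Adj⇔E (z , w , refl , refl , d)
    ; lift   = Equivalence.to Adj⇔E
    ; unique = λ p q → unique (trans (π′⇒π p) (merge-π′ _)) (trans (π′⇒π q) (merge-π′ _))
    }

  lift-away : ∀ {z u} → π z ≡ u → u ≢ π x → π′ z ≡ suc u
  lift-away p u≢ = trans (π′-≢ (λ { refl → u≢ (sym p) })) (cong suc p)

  split : ExclusiveSplit G (π x) G′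
  split = record
    { union       = λ u u≢ → mk⇔
        (λ { (inj₁ a) → E⇒Adj (to Adj⇔E a) ; (inj₂ a) → E⇒Adj (to Adj⇔E a) })
        (λ a → union-from u≢ (lift a))
    ; disjoint    = λ u (a , b) → disjoint (to Adj⇔E a) (to Adj⇔E b)
    ; nonadjacent = λ a → adj-irrefl G (E⇒Adj (to Adj⇔E a)) refl
    ; unchanged   = λ u w u≢ w≢ → mk⇔ (E⇒Adj ∘ to Adj⇔E) (λ a →
        let z , z′ , p , q , d = lift a in
        from Adj⇔E (z , z′ , lift-away p u≢ , lift-away q w≢ , d))
    }
    where
    open Equivalence
    union-from : ∀ {u} → u ≢ π x → (∃[ z ] ∃[ w ] π z ≡ π x × π w ≡ u × Adj H z w) →
                 Adj G′ zero (suc u) ⊎ Adj G′ (suc (π x)) (suc u)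
    union-from u≢ (z , w , p , q , d) with z Fin.≟ x
    ... | yes refl = inj₁ (from Adj⇔E (z , w , π′-x , lift-away q u≢ , d))
    ... | no z≢x   = inj₂ (from Adj⇔E (z , w , trans (π′-≢ z≢x) (cong suc p) , lift-away q u≢ , d))
    disjoint : ∀ {u} → E zero u → E (suc (π x)) u → _
    disjoint (z , w , p , q , d) (z′ , w′ , p′ , q′ , d′)
      with refl ← unique (trans (π′⇒π p) (sym (π′⇒π p′))) (trans (π′⇒π q) (sym (π′⇒π q′))) d d′
      with () ← trans (sym p) p′

  n<m : suc n ≤ m
  n<m = Fin.injective⇒≤ {f = proj₁ ∘ onto′} λ {a} {b} eq →
    trans (sym (proj₂ (onto′ a))) (trans (cong π′ eq) (proj₂ (onto′ b)))

-- Two vertices with the same image could be split apart, and the `n` vertices of `H` would then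
-- cover a graph with `n + 1` vertices.
cover-injective : ∀ {n} {G H : Graph n} (C : Cover G H) → ∀ {x y} → Cover.π C x ≡ Cover.π C y → x ≡ y
cover-injective C {x} {y} eq with x Fin.≟ y
... | yes x≡y = x≡y
... | no  x≢y = ⊥-elim (1+n≰n (SplitOff.n<m C x≢y eq))

cover⇒uniformCluster : ∀ {n} {G H : Graph n} → Cover G H → UniformCluster H → UniformCluster G
cover⇒uniformCluster {G = G} {H} C U = record
  { c = c ; s = s
  ; iso = mk↔ₛ′ (λ u → Inverse.to iso (σ u)) (λ p → π (Inverse.from iso p))
      (λ p → trans (cong (Inverse.to iso) (π-inj (πσ _))) (Inverse.strictlyInverseˡ iso p))
      (λ u → trans (cong π (Inverse.strictlyInverseʳ iso _)) (πσ u))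
  ; adj⇔sameClique = λ u w → mk⇔
      (λ a → let x , y , p , q , d = lift a
                 x≢y , eq = to (adj⇔sameClique x y) d
             in adj-irrefl G a ,
                subst₂ (λ x y → proj₁ (Inverse.to iso x) ≡ proj₁ (Inverse.to iso y))
                       (π-inj (trans p (sym (πσ u)))) (π-inj (trans q (sym (πσ w)))) eq)
      (λ (u≢w , eq) → subst₂ (Adj G) (πσ u) (πσ w) (pres (from (adj⇔sameClique (σ u) (σ w))
        ((λ σu≡σw → u≢w (trans (sym (πσ u)) (trans (cong π σu≡σw) (πσ w)))) , eq))))
  }
  where
  open UniformCluster U
  open Cover C
  open Equivalence
  π-inj : ∀ {x y} → π x ≡ π y → x ≡ y
  π-inj = cover-injective C
  σ = proj₁ ∘ onto
  πσ : ∀ u → π (σ u) ≡ u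
  πσ = proj₂ ∘ onto

-- While `H` has more vertices than `G`, the pigeonhole principle yields two vertices over the same
-- one, and splitting them apart lowers the surplus by one. The labels of the last graph are
-- dictated by the splits, so it is only an isomorphic copy of `H`.
cover⇒splits : ∀ j {n m} {G : Graph n} {H : Graph m} → m ≡ j + n → Cover G H → UniformCluster H →
               Σ[ H′ ∈ Graph m ] Splits j G H′ × UniformCluster H′
cover⇒splits zero    {G = G} refl C U = G , done , cover⇒uniformCluster C U
cover⇒splits (suc j) {n} {m} {G} {H} eq C U
  with x , y , x<y , πx≡πy ← Fin.pigeonhole (≤-trans (s≤s (m≤n+m n j)) (≤-reflexive (sym eq))) (Cover.π C) =
  let open SplitOff {n} {m} {G} {H} C {x} {y} (Fin.<⇒≢ x<y) πx≡πy
      H′ , Ss , U′ = cover⇒splits j (trans eq (sym (+-suc j n))) cover′ U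
  in H′ , step _ split Ss , U′

-- Solutions correspond to clique decompositions

UCEVS⇒Decomp : ∀ I → UCEVS I → ∃[ c ] ∃[ s ] Σ[ K ∈ (Fin c → List (Fin (order I))) ]
  Decomp (allFin (order I)) (Adj (graph I)) (allFin c) K s × length (allFin c) * s ≤ order I + k I
UCEVS⇒Decomp I (j , m , H , j≤k , Ss , U) with C , eq ← splits⇒cover Ss = c , s , K , D , cost
  where
  open UniformCluster U
  open Cover C
  open Equivalence
  G = graph I
  vertex : Fin c → Fin s → Fin m
  vertex i x = Inverse.from iso (i , x)
  vertex-to : ∀ z → vertex (proj₁ (Inverse.to iso z)) (proj₂ (Inverse.to iso z)) ≡ z
  vertex-to = Inverse.strictlyInverseʳ iso
  to-vertex : ∀ {i x} → Inverse.to iso (vertex i x) ≡ (i , x)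
  to-vertex = Inverse.strictlyInverseˡ iso _
  K : Fin c → List (Fin (order I))
  K i = map (π ∘ vertex i) (allFin s)
  ∈K : ∀ i x → π (vertex i x) ∈ K i
  ∈K i x = ∈-map⁺ (π ∘ vertex i) (∈-allFin x)
  ∈K-to : ∀ z {i} → proj₁ (Inverse.to iso z) ≡ i → π z ∈ K i
  ∈K-to z refl = subst (λ z′ → π z′ ∈ K _) (vertex-to z) (∈K _ _)
  adjacent : ∀ {i x y} → x ≢ y → Adj H (vertex i x) (vertex i y)
  adjacent x≢y = from (adj⇔sameClique _ _)
    ( (λ eq → x≢y (cong proj₂ (trans (sym to-vertex) (trans (cong (Inverse.to iso) eq) to-vertex))))
    , trans (cong proj₁ to-vertex) (sym (cong proj₁ to-vertex)))
  -- Distinct vertices of one clique are adjacent, and `π` keeps them adjacent, hence distinct.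
  φ-inj : ∀ {i x y} → π (vertex i x) ≡ π (vertex i y) → x ≡ y
  φ-inj {i} {x} {y} eq with x Fin.≟ y
  ... | yes x≡y = x≡y
  ... | no x≢y  = ⊥-elim (adj-irrefl G (pres (adjacent x≢y)) eq)
  D : Decomp (allFin (order I)) (Adj G) (allFin c) K s
  D = record
    { J-unique = Unique.allFin⁺ c
    ; K-unique = λ _ → Unique.map⁺ φ-inj (Unique.allFin⁺ s)
    ; K-length = λ {i} _ → trans (length-map (π ∘ vertex i) (allFin s)) (length-tabulate {n = s} id)
    ; K⊆L      = λ _ _ → ∈-allFin _
    ; onto     = λ {u} _ → let z , p = onto u in
                 _ , ∈-allFin _ , subst (_∈ K _) p (∈K-to z refl)
    ; clique   = λ {i} _ u∈ w∈ u≢w → clique i (∈-map⁻ (π ∘ vertex i) u∈) (∈-map⁻ (π ∘ vertex i) w∈) u≢w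
    ; cover    = λ _ _ e → let x , y , p , q , d = lift e in
                 _ , ∈-allFin _ , subst (_∈ K _) p (∈K-to x refl) ,
                 subst (_∈ K _) q (∈K-to y (sym (proj₂ (to (adj⇔sameClique x y) d))))
    ; same     = λ {i} {i′} _ _ u∈ w∈ u∈′ w∈′ u≢w →
                 same (∈-map⁻ (π ∘ vertex i) u∈) (∈-map⁻ (π ∘ vertex i) w∈)
                      (∈-map⁻ (π ∘ vertex i′) u∈′) (∈-map⁻ (π ∘ vertex i′) w∈′) u≢w
    }
    where
    Over : Fin c → Fin (order I) → Set
    Over i u = ∃[ x ] x ∈ allFin s × u ≡ π (vertex i x)
    clique : ∀ i {u w} → Over i u → Over i w → u ≢ w → Adj G u w
    clique i (x , _ , refl) (y , _ , refl) u≢w = pres (adjacent (λ { refl → u≢w refl }))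
    same : ∀ {i i′ u w} → Over i u → Over i w → Over i′ u → Over i′ w → u ≢ w → i ≡ i′
    same {i} {i′} (x , _ , refl) (y , _ , refl) (x′ , _ , p) (y′ , _ , q) u≢w = cong proj₁
      (trans (sym to-vertex) (trans (cong (Inverse.to iso)
        (unique p q (adjacent (λ { refl → u≢w refl }))
                    (adjacent (λ { refl → u≢w (trans p (sym q)) })))) to-vertex))
  cost : length (allFin c) * s ≤ order I + k I
  cost = begin
    length (allFin c) * s  ≡⟨ cong (_* s) (length-tabulate {n = c} id) ⟩
    c * s          ≡⟨ ↔⇒≡ (↔-sym (Fin.*↔× {c} {s}) ↔-∘ iso) ⟨
    m              ≡⟨ eq ⟩
    j + order I    ≤⟨ +-monoˡ-≤ (order I) j≤k ⟩
    k I + order I  ≡⟨ +-comm (k I) (order I) ⟩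
    order I + k I  ∎
    where open ≤-Reasoning

module _ (I : Instance) {c s} {K : Fin c → List (Fin (order I))}
         (D : Decomp (allFin (order I)) (Adj (graph I)) (allFin c) K s) where
  private
    open Decomp D
    G = graph I
    n = order I

    φ : Fin c → Fin s → Fin n
    φ i x = lookup (K i) (cast (sym (K-length (∈-allFin i))) x)

    φ∈K : ∀ i x → φ i x ∈ K i
    φ∈K i x = ∈-lookup (cast (sym (K-length (∈-allFin i))) x)

    φ-surj : ∀ {i u} → u ∈ K i → ∃[ x ] φ i x ≡ u
    φ-surj {i} u∈ = cast (K-length (∈-allFin i)) (index u∈) ,
      trans (cong (lookup (K i))
                  (Fin.cast-involutive (sym (K-length (∈-allFin i))) (K-length (∈-allFin i)) (index u∈)))
            (sym (lookup-index u∈))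

    φ-inj : ∀ {i x y} → φ i x ≡ φ i y → x ≡ y
    φ-inj {i} eq = trans (sym (Fin.cast-involutive (K-length (∈-allFin i)) (sym (K-length (∈-allFin i))) _))
      (trans (cong (cast (K-length (∈-allFin i))) (lookup-injective (K-unique (∈-allFin i)) eq))
             (Fin.cast-involutive (K-length (∈-allFin i)) (sym (K-length (∈-allFin i))) _))

    quot : Fin (c * s) → Fin c
    quot z = proj₁ (remQuot s z)

    π : Fin (c * s) → Fin n
    π z = φ (quot z) (proj₂ (remQuot {c} s z))

    π∈K : ∀ z → π z ∈ K (quot z)
    π∈K z = φ∈K _ _

    π-inj : ∀ {z z′} → quot z ≡ quot z′ → π z ≡ π z′ → z ≡ z′
    π-inj {z} {z′} p q = trans (sym (Fin.combine-remQuot {c} s z)) (trans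
      (helper (remQuot {c} s z) (remQuot {c} s z′) p q) (Fin.combine-remQuot {c} s z′))
      where
      helper : ∀ (p q : Fin c × Fin s) → proj₁ p ≡ proj₁ q →
               φ (proj₁ p) (proj₂ p) ≡ φ (proj₁ q) (proj₂ q) →
               combine (proj₁ p) (proj₂ p) ≡ combine (proj₁ q) (proj₂ q)
      helper (i , x) (_ , y) refl eq = cong (combine i) (φ-inj eq)

    E : Fin (c * s) → Fin (c * s) → Set
    E z w = z ≢ w × quot z ≡ quot w

    E? : ∀ z w → Dec (E z w)
    E? z w = ¬? (z Fin.≟ w) ×-dec (quot z Fin.≟ quot w)

    H : Graph (c * s)
    H = graphOf E? (λ (p , q) → p ∘ sym , sym q) (λ (p , _) → p refl)

    at : ∀ {i u} → u ∈ K i → ∃[ z ] π z ≡ u × quot z ≡ i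
    at {i} u∈ with x , refl ← φ-surj u∈ =
      combine i x , cong (λ p → φ (proj₁ p) (proj₂ p)) (Fin.remQuot-combine i x) ,
      cong proj₁ (Fin.remQuot-combine i x)

    -- Each axiom of a decomposition supplies one property: `onto` the surjectivity, `clique` the
    -- preservation of edges, `cover` their lifting, `same` its uniqueness.
    C : Cover G H
    C = record
      { π      = π
      ; onto   = λ v → let _ , _ , v∈ = onto (∈-allFin v) ; z , p , _ = at v∈ in z , p
      ; pres   = λ {z} {w} a → let z≢w , eq = to (T-does (E? z w)) a in
                 clique (∈-allFin _) (π∈K z) (subst (λ i → π w ∈ K i) (sym eq) (π∈K w))
                        (z≢w ∘ π-inj eq)
      ; lift   = λ {u} {w} a →
                 let _ , _ , u∈ , w∈ = cover (∈-allFin u) (∈-allFin w) a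
                     x , p , qx = at u∈
                     y , q , qy = at w∈
                 in x , y , p , q , from (T-does (E? x y))
                      ((λ x≡y → adj-irrefl G a (trans (sym p) (trans (cong π x≡y) q))) , trans qx (sym qy))
      ; unique = unique
      }
      where
      open Equivalence
      unique : ∀ {x x′ y y′} → π x ≡ π x′ → π y ≡ π y′ → Adj H x y → Adj H x′ y′ → x ≡ x′
      unique {x} {x′} {y} {y′} p q a a′ =
        let x≢y , e   = to (T-does (E? x y)) a
            _   , e′  = to (T-does (E? x′ y′)) a′
        in π-inj (same (∈-allFin _) (∈-allFin _) (π∈K x)
                       (subst (λ i → π y ∈ K i) (sym e) (π∈K y))
                       (subst (_∈ K (quot x′)) (sym p) (π∈K x′))
                       (subst₂ (λ u i → u ∈ K i) (sym q) (sym e′) (π∈K y′))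
                       (x≢y ∘ π-inj e)) p

    uniform : UniformCluster H
    uniform = record
      { c = c ; s = s ; iso = Fin.*↔× ; adj⇔sameClique = λ u w → T-does (E? u w) }

  Decomp⇒UCEVS′ : c * s ≤ n + k I → UCEVS I
  Decomp⇒UCEVS′ cost =
    -- `n≤cs` makes the truncated subtraction exact.
    let H′ , Ss , U = cover⇒splits (c * s ∸ n) (sym (m∸n+n≡m n≤cs)) C uniform in
    c * s ∸ n , c * s , H′ ,
    ≤-trans (∸-monoˡ-≤ n cost) (≤-reflexive (m+n∸m≡n n (k I))) , Ss , U
    where
    n≤cs : n ≤ c * s
    n≤cs = Fin.injective⇒≤ {f = proj₁ ∘ Cover.onto C} λ {u} {w} eq →
      trans (sym (proj₂ (Cover.onto C u))) (trans (cong π eq) (proj₂ (Cover.onto C w)))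

Decomp⇒UCEVS : ∀ I {B : Set} {J : List B} {K s} →
  Decomp (allFin (order I)) (Adj (graph I)) J K s → length J * s ≤ order I + k I → UCEVS I
Decomp⇒UCEVS I D = Decomp⇒UCEVS′ I (reindex D)

-- The reduced graph

module Clones {A B : Set} (_≟_ : DecidableEquality A) {L : List A} {E : A → A → Set}
              {J : List B} {K : B → List A} {s : ℕ} (D : Decomp L E J K s) where
  open Decomp D
  open DecMembership _≟_ using (_∈?_)

  -- The members of `pairs J K` play the vertices of the final graph, and a vertex with one home is
  -- one that is never split.
  Single : A → Set
  Single u = ∀ {b b′} → b ∈ J → b′ ∈ J → u ∈ K b → u ∈ K b′ → b ≡ b′

  clones-unique : Unique (pairs J K)
  clones-unique = pairs-unique K J-unique K-unique

  length-clones : length (pairs J K) ≡ length J * s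
  length-clones = length-pairs J K s K-length

  private
    homes : A → List B
    homes u = filter (λ b → u ∈? K b) J

    homes-unique : ∀ u → Unique (homes u)
    homes-unique u = Unique.filter⁺ (λ b → u ∈? K b) J-unique

    ∈-homes⁻ : ∀ {u b} → b ∈ homes u → b ∈ J × u ∈ K b
    ∈-homes⁻ {u} = ∈-filter⁻ (λ b → u ∈? K b)

    single : ∀ u → length (homes u) ≤ 1 → Single u
    single u le b∈ b′∈ u∈ u∈′ = collapse (homes u) le (∈-filter⁺ _ b∈ u∈) (∈-filter⁺ _ b′∈ u∈′)
      where
      collapse : ∀ hs → length hs ≤ 1 → ∀ {b b′} → b ∈ hs → b′ ∈ hs → b ≡ b′
      collapse (_ ∷ [])     le       (here refl) (here refl) = refl
      collapse (_ ∷ _ ∷ _) (s≤s ()) _           _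

    -- The clones assigned to inj₁ u and inj₂ u are the first and the second
    -- clone of u.
    Home : A ⊎ A → B × A → Set
    Home (inj₁ u) (b , w) = u ≡ w × (∃[ hs ] homes u ≡ b ∷ hs)
    Home (inj₂ u) (b , w) = u ≡ w × (∃[ b′ ] ∃[ hs ] homes u ≡ b′ ∷ b ∷ hs)

    first≢second : ∀ {u b b′ hs hs′} → homes u ≡ b ∷ hs → homes u ≡ b′ ∷ b ∷ hs′ → ⊥
    first≢second {u} p q with refl ← trans (sym p) q with (b≢b ∷ _) ∷ _ ← subst Unique p (homes-unique u) =
      b≢b refl

    Home-injective : ∀ {x x′ y} → Home x y → Home x′ y → x ≡ x′
    Home-injective {inj₁ _} {inj₁ _} (refl , _) (refl , _) = refl
    Home-injective {inj₂ _} {inj₂ _} (refl , _) (refl , _) = refl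
    Home-injective {inj₁ _} {inj₂ _} (refl , _ , p) (refl , _ , _ , q) = ⊥-elim (first≢second p q)
    Home-injective {inj₂ _} {inj₁ _} (refl , _ , _ , q) (refl , _ , p) = ⊥-elim (first≢second p q)

  -- If every vertex of `S` had a second clone, these together with one clone for each vertex of `L`
  -- would be more than `length L + k` clones.
  single-exists : ∀ {S k} → Unique L → Unique S → length J * s ≤ length L + k → k < length S →
                  ∃[ u ] u ∈ S × Single u
  single-exists {S} {k} uL uS cost k<S with Any.any? (λ u → length (homes u) ≤? 1) S
  ... | yes p = let u , u∈ , le = find p in u , u∈ , single u le
  ... | no ¬p = ⊥-elim (<⇒≱ k<S (+-cancelˡ-≤ (length L) _ _ (begin
    length L + length S                      ≡⟨ cong₂ _+_ (length-map inj₁ L) (length-map inj₂ S) ⟨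
    length (map inj₁ L) + length (map inj₂ S)  ≡⟨ length-++ (map inj₁ L) ⟨
    length both                              ≤⟨ injective⇒length≤ Home both-unique home Home-injective ⟩
    length (pairs J K)                       ≡⟨ length-clones ⟩
    length J * s                             ≤⟨ cost ⟩
    length L + k                             ∎)))
    where
    open ≤-Reasoning
    both : List (A ⊎ A)
    both = map inj₁ L ++ map inj₂ S
    both-unique : Unique both
    both-unique = Unique.++⁺ (Unique.map⁺ Sum.inj₁-injective uL) (Unique.map⁺ Sum.inj₂-injective uS)
      λ (p , q) → case (∈-map⁻ inj₁ p) (∈-map⁻ inj₂ q)
      where
      case : ∀ {x} → (∃[ y ] y ∈ L × x ≡ inj₁ y) → (∃[ y ] y ∈ S × x ≡ inj₂ y) → ⊥
      case (_ , _ , refl) (_ , _ , ())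
    first : ∀ {u} hs → homes u ≡ hs → ∃[ b ] b ∈ hs → ∃[ y ] y ∈ pairs J K × Home (inj₁ u) y
    first {u} (b ∷ hs) eq _ = let b∈ , u∈ = ∈-homes⁻ (subst (b ∈_) (sym eq) (here refl)) in
      (b , u) , ∈-pairs⁺ K b∈ u∈ , refl , hs , eq
    second : ∀ {u} hs → homes u ≡ hs → ¬ (length hs ≤ 1) → ∃[ y ] y ∈ pairs J K × Home (inj₂ u) y
    second []            eq ¬le = ⊥-elim (¬le z≤n)
    second (_ ∷ [])      eq ¬le = ⊥-elim (¬le ≤-refl)
    second {u} (b′ ∷ b ∷ hs) eq _ =
      let b∈ , u∈ = ∈-homes⁻ (subst (b ∈_) (sym eq) (there (here refl))) in
      (b , u) , ∈-pairs⁺ K b∈ u∈ , refl , b′ , hs , eq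
    home : ∀ {x} → x ∈ both → ∃[ y ] y ∈ pairs J K × Home x y
    home x∈ with ∈-++⁻ (map inj₁ L) x∈
    ... | inj₁ p with u , u∈ , refl ← ∈-map⁻ inj₁ p =
      let b , b∈ , u∈K = onto u∈ in first (homes u) refl (b , ∈-filter⁺ (λ b → u ∈? K b) b∈ u∈K)
    ... | inj₂ p with u , u∈ , refl ← ∈-map⁻ inj₂ p =
      second (homes u) refl (λ le → ¬p (lose u∈ le))

  -- `Q` lists the closed neighbourhood of `u`. It becomes `star u` in the given graph and `block i`
  -- in the kernel.
  module _ {u b} (b∈ : b ∈ J) (u∈ : u ∈ K b)
           {Q : List A} (Q⇔ : ∀ {w} → w ∈ Q ⇔ (u ≡ w ⊎ (w ∈ L × E u w))) where
    K⊆Q : ∀ {w} → w ∈ K b → w ∈ Q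
    K⊆Q {w} w∈ with u ≟ w
    ... | yes eq = from Q⇔ (inj₁ eq)
    ... | no u≢w = from Q⇔ (inj₂ (K⊆L b∈ w∈ , clique b∈ u∈ w∈ u≢w))

    s≤length : s ≤ length Q
    s≤length = subst (_≤ length Q) (K-length b∈) (⊆⇒length≤ (K-unique b∈) K⊆Q)

    -- Every edge at an unsplit vertex lies in its one clique, which therefore fills the closed
    -- neighbourhood.
    single⇒length : Unique Q → Single u → s ≡ length Q
    single⇒length uQ one = ≤-antisym s≤length
      (subst (length Q ≤_) (K-length b∈) (⊆⇒length≤ uQ Q⊆K))
      where
      Q⊆K : ∀ {w} → w ∈ Q → w ∈ K b
      Q⊆K w∈ with to Q⇔ w∈
      ... | inj₁ refl = u∈
      ... | inj₂ (w∈L , e) with b′ , b′∈ , u∈′ , w∈′ ← cover (K⊆L b∈ u∈) w∈L e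
                           with refl ← one b∈ b′∈ u∈ u∈′ = w∈′

-- Transport of decompositions along isomorphisms

module _ {A A′ B : Set} {L : List A} {E : A → A → Set} {L′ : List A′} {E′ : A′ → A′ → Set}
         {J : List B} {s : ℕ} (f : A → A′) (f-inj : ∀ {x y} → f x ≡ f y → x ≡ y)
         (L→L′ : ∀ {x} → x ∈ L → f x ∈ L′) (L′→L : ∀ {y} → y ∈ L′ → ∃[ x ] x ∈ L × y ≡ f x)
         (E⇔E′ : ∀ {x y} → E x y ⇔ E′ (f x) (f y)) where

  pushforward : ∀ {K} → Decomp L E J K s → Decomp L′ E′ J (map f ∘ K) s
  pushforward {K} D = record
    { J-unique = J-unique
    ; K-unique = λ b∈ → Unique.map⁺ f-inj (K-unique b∈)
    ; K-length = λ {b} b∈ → trans (length-map f (K b)) (K-length b∈)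
    ; K⊆L      = λ b∈ u∈ → let _ , x∈ , eq = ∈-map⁻ f u∈ in
                 subst (_∈ L′) (sym eq) (L→L′ (K⊆L b∈ x∈))
    ; onto     = λ u∈ → let _ , x∈ , eq = L′→L u∈ ; b , b∈ , x∈K = onto x∈ in
                 b , b∈ , subst (_∈ map f (K b)) (sym eq) (∈-map⁺ f x∈K)
    ; clique   = λ b∈ u∈ w∈ u≢w →
                 let _ , x∈ , p = ∈-map⁻ f u∈
                     _ , y∈ , q = ∈-map⁻ f w∈
                 in subst₂ E′ (sym p) (sym q) (to E⇔E′ (clique b∈ x∈ y∈
                      (λ x≡y → u≢w (trans p (trans (cong f x≡y) (sym q))))))
    ; cover    = λ u∈ w∈ e →
                 let _ , x∈ , p = L′→L u∈
                     _ , y∈ , q = L′→L w∈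
                     b , b∈ , x∈K , y∈K = cover x∈ y∈ (from E⇔E′ (subst₂ E′ p q e))
                 in b , b∈ , subst (_∈ map f (K b)) (sym p) (∈-map⁺ f x∈K) ,
                    subst (_∈ map f (K b)) (sym q) (∈-map⁺ f y∈K)
    ; same     = λ b∈ b′∈ u∈ w∈ u∈′ w∈′ u≢w →
                 let x  , x∈  , p  = ∈-map⁻ f u∈
                     y  , y∈  , q  = ∈-map⁻ f w∈
                     x′ , x∈′ , p′ = ∈-map⁻ f u∈′
                     y′ , y∈′ , q′ = ∈-map⁻ f w∈′
                 in same b∈ b′∈ x∈ y∈ (subst (_∈ K _) (f-inj (trans (sym p′) p)) x∈′)
                         (subst (_∈ K _) (f-inj (trans (sym q′) q)) y∈′)
                         (λ x≡y → u≢w (trans p (trans (cong f x≡y) (sym q))))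
    }
    where open Decomp D

  module _ (_≟_ : DecidableEquality A′) (uL : Unique L) where
    open DecMembership _≟_ using (_∈?_)

    -- Preimages are filtered out of `L`, since `f` is inverted on `L′` only.
    pullback : ∀ {K} → Decomp L′ E′ J K s → Decomp L E J (λ b → preimage _≟_ f L (K b)) s
    pullback {K} D = record
      { J-unique = J-unique
      ; K-unique = λ {b} _ → Unique.filter⁺ (λ x → f x ∈? K b) uL
      ; K-length = λ b∈ → trans
          (length-preimage _≟_ f f-inj uL (K-unique b∈) (λ y∈ → L′→L (K⊆L b∈ y∈))) (K-length b∈)
      ; K⊆L      = λ {b} _ u∈ → proj₁ (∈-filter⁻ (λ x → f x ∈? K b) u∈)
      ; onto     = λ u∈ → let b , b∈ , fu∈ = onto (L→L′ u∈) in
                   b , b∈ , ∈-filter⁺ (λ x → f x ∈? K b) u∈ fu∈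
      ; clique   = λ b∈ u∈ w∈ u≢w → from E⇔E′ (clique b∈ (fst u∈) (fst w∈) (u≢w ∘ f-inj))
      ; cover    = λ u∈ w∈ e → let b , b∈ , p , q = cover (L→L′ u∈) (L→L′ w∈) (to E⇔E′ e) in
                   b , b∈ , ∈-filter⁺ (λ x → f x ∈? K b) u∈ p , ∈-filter⁺ (λ x → f x ∈? K b) w∈ q
      ; same     = λ b∈ b′∈ u∈ w∈ u∈′ w∈′ u≢w →
                   same b∈ b′∈ (fst u∈) (fst w∈) (fst u∈′) (fst w∈′) (u≢w ∘ f-inj)
      }
      where
      open Decomp D
      fst : ∀ {b x} → x ∈ preimage _≟_ f L (K b) → f x ∈ K b
      fst {b} x∈ = proj₂ (∈-filter⁻ (λ x → f x ∈? K b) {xs = L} x∈)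

-- inj₁ x is the vertex x of the rest graph, inj₂ (i , j) the j-th vertex of the
-- i-th added clique.
Label : ℕ → Set
Label n = Fin n ⊎ (ℕ × ℕ)

_≟ᴸ_ : ∀ {n} → DecidableEquality (Label n)
_≟ᴸ_ = Sum.≡-dec Fin._≟_ (Product.≡-dec _≟_ _≟_)

-- Construction of the kernel

module Reduction {n} (G : Graph n) (k : ℕ) where

  vs : List (Fin n)
  vs = allFin n

  adj? : ∀ u w → Dec (Adj G u w)
  adj? u w = T? (Graph.adj G u w)

  nbrs : Fin n → List (Fin n)
  nbrs u = filter (adj? u) vs

  deg : Fin n → ℕ
  deg u = length (nbrs u)

  N[_] : Fin n → Fin n → Set
  N[ u ] w = u ≡ w ⊎ Adj G u w

  N? : ∀ u w → Dec (N[ u ] w)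
  N? u w = (u Fin.≟ w) ⊎-dec adj? u w

  Min : Fin n → Set
  Min u = ∀ w → deg u ≤ deg w

  Min? : Decidable Min
  Min? u = Fin.all? λ w → deg u ≤? deg w

  -- The pairs lying in a clique of every solution, provided that some vertex stays
  -- unsplit.
  Forced : Fin n → Fin n → Set
  Forced x y = ∃[ u ] Min u × N[ u ] x × N[ u ] y

  Forced? : ∀ x y → Dec (Forced x y)
  Forced? x y = Fin.any? λ u → Min? u ×-dec N? u x ×-dec N? u y

  Rest : Fin n → Fin n → Set
  Rest x y = Adj G x y × ¬ Forced x y

  Rest? : ∀ x y → Dec (Rest x y)
  Rest? x y = adj? x y ×-dec ¬? (Forced? x y)

  RestVertex : Fin n → Set
  RestVertex x = ∃[ y ] Rest x y

  RestVertex? : Decidable RestVertex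
  RestVertex? x = Fin.any? (Rest? x)

  rest : List (Fin n)
  rest = filter RestVertex? vs

  -- The default 0 makes `d ≢ 0` imply that a vertex of minimum degree exists; it also agrees with
  -- `hd` of the empty list in the program.
  firstDeg : List (Fin n) → ℕ
  firstDeg []      = 0
  firstDeg (u ∷ _) = deg u

  d : ℕ
  d = firstDeg (filter Min? vs)

  -- Every edge occurs in both directions, matching the `suc d * d` ordered pairs of a clique.
  edges : List (Fin n × Fin n)
  edges = pairs vs nbrs

  -- The case `u = u′` says that the star of `u` is a clique. For `u ≠ u′` it is enough to ask for
  -- adjacent centres, because between two cliques this makes the stars coincide.
  Clash-free : Set
  Clash-free = ∀ u u′ x y → Min u × N[ u ] x × N[ u ] y → Min u′ × N[ u′ ] x × N[ u′ ] y →
               x ≡ y ⊎ Adj G x y × N[ u ] u′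

  -- This is the cost bound `c * suc d ≤ n + k` multiplied by `d`: a solution with `c` cliques has
  -- `c * suc d * d` ordered edges, however the cliques lie.
  Few-edges : Set
  Few-edges = length edges ≤ d * (n + k)

  -- A nonempty rest contains a whole clique of split vertices, whence `suc d ≤ k`. An empty rest
  -- allows cliques of any order, so it is a case of its own; `≤ 0` is emptiness in a form that the
  -- program can compare.
  Small-rest : Set
  Small-rest = length rest ≤ 0 ⊎ length rest ≤ k × suc d ≤ k

  Good : Set
  Good = Clash-free × Few-edges × Small-rest

  Good? : Dec Good
  Good? =
    (Fin.all? λ u → Fin.all? λ u′ → Fin.all? λ x → Fin.all? λ y →
      (Min? u ×-dec N? u x ×-dec N? u y) →-dec (Min? u′ ×-dec N? u′ x ×-dec N? u′ y) →-dec
      ((x Fin.≟ y) ⊎-dec (adj? x y ×-dec N? u u′)))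
    ×-dec (length edges ≤? d * (n + k))
    ×-dec ((length rest ≤? 0) ⊎-dec ((length rest ≤? k) ×-dec (suc d ≤? k)))

  fits? : ∀ i → Dec (suc i * suc d ≤ 2 * k)
  fits? i = suc i * suc d ≤? 2 * k

  -- These are the indices below `2 * k / suc d`, found by comparisons so that the program never
  -- divides. The range `2 * k` suffices as `suc i ≤ suc i * suc d`.
  blocks : List ℕ
  blocks = filter fits? (upTo (2 * k))

  padding : List (ℕ × ℕ)
  padding = pairs blocks (λ _ → upTo (suc d))

  labels : List (Label n)
  labels = map inj₁ rest ++ map inj₂ padding

  Edge : Label n → Label n → Set
  Edge (inj₁ x)       (inj₁ y)       = Rest x y
  Edge (inj₁ _)       (inj₂ _)       = ⊥
  Edge (inj₂ _)       (inj₁ _)       = ⊥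
  Edge (inj₂ (i , x)) (inj₂ (j , y)) = i ≡ j × x ≢ y

  Edge? : ∀ a b → Dec (Edge a b)
  Edge? (inj₁ x)       (inj₁ y)       = Rest? x y
  Edge? (inj₁ _)       (inj₂ _)       = no λ ()
  Edge? (inj₂ _)       (inj₁ _)       = no λ ()
  Edge? (inj₂ (i , x)) (inj₂ (j , y)) = (i ≟ j) ×-dec ¬? (x ≟ y)

  Rest-sym : ∀ {x y} → Rest x y → Rest y x
  Rest-sym (a , ¬f) = adj-sym G a , λ (u , m , p , q) → ¬f (u , m , q , p)

  Edge-sym : ∀ {a b} → Edge a b → Edge b a
  Edge-sym {inj₁ _} {inj₁ _} r       = Rest-sym r
  Edge-sym {inj₂ _} {inj₂ _} (p , q) = sym p , q ∘ sym

  Edge-irrefl : ∀ {a} → ¬ Edge a a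
  Edge-irrefl {inj₁ _} (a , _) = adj-irrefl G a refl
  Edge-irrefl {inj₂ _} (_ , q) = q refl

  kernel : Graph (length labels)
  kernel = graphOf (λ i j → Edge? (lookup labels i) (lookup labels j)) Edge-sym Edge-irrefl

  vs-unique : Unique vs
  vs-unique = Unique.allFin⁺ n

  length-vs : length vs ≡ n
  length-vs = length-tabulate {n = n} id

  ∈-nbrs : ∀ {u w} → w ∈ nbrs u ⇔ Adj G u w
  ∈-nbrs {u} = mk⇔ (λ w∈ → proj₂ (∈-filter⁻ (adj? u) {xs = vs} w∈)) (∈-filter⁺ (adj? u) (∈-allFin _))

  nbrs-unique : ∀ u → Unique (nbrs u)
  nbrs-unique u = Unique.filter⁺ (adj? u) vs-unique

  star : Fin n → List (Fin n)
  star u = u ∷ nbrs u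

  ∈-star : ∀ {u w} → w ∈ star u ⇔ N[ u ] w
  ∈-star = mk⇔ (λ { (here eq) → inj₁ (sym eq) ; (there w∈) → inj₂ (to ∈-nbrs w∈) })
               (λ { (inj₁ eq) → here (sym eq) ; (inj₂ a) → there (from ∈-nbrs a) })

  ∈-star′ : ∀ {u w} → w ∈ star u ⇔ (u ≡ w ⊎ (w ∈ vs × Adj G u w))
  ∈-star′ = mk⇔ (λ w∈ → case (to ∈-star w∈)) λ { (inj₁ p) → from ∈-star (inj₁ p)
                                               ; (inj₂ (_ , a)) → from ∈-star (inj₂ a) }
    where
    case : ∀ {u w} → N[ u ] w → u ≡ w ⊎ (w ∈ vs × Adj G u w)
    case (inj₁ p) = inj₁ p
    case (inj₂ a) = inj₂ (∈-allFin _ , a)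

  star-unique : ∀ u → Unique (star u)
  star-unique u = All.tabulate (λ w∈ → adj-irrefl G (to ∈-nbrs w∈)) ∷ nbrs-unique u

  N-sym : ∀ {u w} → N[ u ] w → N[ w ] u
  N-sym (inj₁ p) = inj₁ (sym p)
  N-sym (inj₂ a) = inj₂ (adj-sym G a)

  min⇒d : ∀ {u} → Min u → deg u ≡ d
  min⇒d {u} m = go (filter Min? vs) (λ w∈ → proj₂ (∈-filter⁻ Min? {xs = vs} w∈))
                   (∈-filter⁺ Min? (∈-allFin u) m)
    where
    go : ∀ ms → (∀ {w} → w ∈ ms → Min w) → u ∈ ms → deg u ≡ firstDeg ms
    go (w ∷ _) mins _ = ≤-antisym (m w) (mins (here refl) u)

  ∈-rest : ∀ {x} → x ∈ rest ⇔ RestVertex x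
  ∈-rest = mk⇔ (λ x∈ → proj₂ (∈-filter⁻ RestVertex? {xs = vs} x∈)) (∈-filter⁺ RestVertex? (∈-allFin _))

  rest-unique : Unique rest
  rest-unique = Unique.filter⁺ RestVertex? vs-unique

  blocks-unique : Unique blocks
  blocks-unique = Unique.filter⁺ fits? (Unique.upTo⁺ (2 * k))

  padding-unique : Unique padding
  padding-unique = pairs-unique _ blocks-unique (λ _ → Unique.upTo⁺ (suc d))

  length-padding : length padding ≡ length blocks * suc d
  length-padding = length-pairs blocks _ (suc d) (λ _ → length-upTo (suc d))

  inj₁∈labels⁻ : ∀ {x} → inj₁ x ∈ labels → x ∈ rest
  inj₁∈labels⁻ p with ∈-++⁻ (map inj₁ rest) p
  ... | inj₁ q with _ , x∈ , refl ← ∈-map⁻ inj₁ q = x∈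
  ... | inj₂ q with _ , _ , () ← ∈-map⁻ inj₂ q

  inj₂∈labels⁻ : ∀ {q} → inj₂ q ∈ labels → q ∈ padding
  inj₂∈labels⁻ p with ∈-++⁻ (map inj₁ rest) p
  ... | inj₁ q with _ , _ , () ← ∈-map⁻ inj₁ q
  ... | inj₂ q with _ , x∈ , refl ← ∈-map⁻ inj₂ q = x∈

  inj₁∈labels⁺ : ∀ {x} → x ∈ rest → inj₁ x ∈ labels
  inj₁∈labels⁺ x∈ = ∈-++⁺ˡ (∈-map⁺ inj₁ x∈)

  inj₂∈labels⁺ : ∀ {q} → q ∈ padding → inj₂ q ∈ labels
  inj₂∈labels⁺ q∈ = ∈-++⁺ʳ (map inj₁ rest) (∈-map⁺ inj₂ q∈)

  labels-unique : Unique labels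
  labels-unique = Unique.++⁺ (Unique.map⁺ Sum.inj₁-injective rest-unique)
                             (Unique.map⁺ Sum.inj₂-injective padding-unique)
    λ (p , q) → case (∈-map⁻ inj₁ p) (∈-map⁻ inj₂ q)
    where
    case : ∀ {x : Label n} → (∃[ y ] y ∈ rest × x ≡ inj₁ y) → (∃[ y ] y ∈ padding × x ≡ inj₂ y) → ⊥
    case (_ , _ , refl) (_ , _ , ())

  length-labels : length labels ≡ length rest + length blocks * suc d
  length-labels = trans (length-++ (map inj₁ rest))
    (cong₂ _+_ (length-map inj₁ rest) (trans (length-map inj₂ padding) length-padding))

  private
    q : ℕ
    q = 2 * k / suc d

    fits⁻ : ∀ {i} → i < q → suc i * suc d ≤ 2 * k
    fits⁻ i<q = ≤-trans (*-monoˡ-≤ (suc d) i<q) (m/n*n≤m (2 * k) (suc d))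

    fits⁺ : ∀ {i} → suc i * suc d ≤ 2 * k → i < q
    fits⁺ {i} le = subst (_≤ q) (m*n/n≡m (suc i) (suc d)) (/-monoˡ-≤ (suc d) le)

    ∈-blocks : ∀ {i} → i ∈ blocks ⇔ i < q
    ∈-blocks {i} = mk⇔ (λ i∈ → fits⁺ (proj₂ (∈-filter⁻ fits? {xs = upTo (2 * k)} i∈)))
      λ i<q → ∈-filter⁺ fits? (∈-upTo⁺ (≤-trans (m≤m*n (suc i) (suc d)) (fits⁻ i<q))) (fits⁻ i<q)

    length-blocks : length blocks ≡ q
    length-blocks = trans
      (≤-antisym (⊆⇒length≤ blocks-unique (λ i∈ → ∈-upTo⁺ (to ∈-blocks i∈)))
                 (⊆⇒length≤ (Unique.upTo⁺ q) (λ i∈ → from ∈-blocks (∈-upTo⁻ i∈))))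
      (length-upTo q)

  blocks≤ : length blocks * suc d ≤ 2 * k
  blocks≤ = subst (λ t → t * suc d ≤ 2 * k) (sym length-blocks) (m/n*n≤m (2 * k) (suc d))

  -- Rounding `2 * k` down to a multiple of `suc d` loses less than `suc d`, hence less than `k`.
  -- This is why the padding aims at `2 * k`.
  blocks> : suc d ≤ k → k < length blocks * suc d
  blocks> d<k = subst (λ t → k < t * suc d) (sym length-blocks) (+-cancelˡ-< k k _ (begin-strict
    k + k                                    ≡⟨ cong (k +_) (+-identityʳ k) ⟨
    2 * k                                    ≡⟨ m≡m%n+[m/n]*n (2 * k) (suc d) ⟩
    2 * k % suc d + q * suc d                <⟨ +-monoˡ-< (q * suc d) (m%n<n (2 * k) (suc d)) ⟩
    suc d + q * suc d                        ≤⟨ +-monoˡ-≤ (q * suc d) d<k ⟩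
    k + q * suc d                            ∎))
    where open ≤-Reasoning

  Good⇒labels≤ : Good → length labels ≤ 4 * k
  Good⇒labels≤ (_ , _ , small) = begin
    length labels                            ≡⟨ length-labels ⟩
    length rest + length blocks * suc d      ≤⟨ +-mono-≤ (rest≤ small) blocks≤ ⟩
    -- At most `k` vertices of the rest and `2 * k` of the padding.
    3 * k                                    ≤⟨ *-monoˡ-≤ k (n≤1+n 3) ⟩
    4 * k                                    ∎
    where
    open ≤-Reasoning
    rest≤ : Small-rest → length rest ≤ k
    rest≤ (inj₁ le)       = ≤-trans le z≤n
    rest≤ (inj₂ (le , _)) = le

  -- Double counting of the edges

  module Flags {B : Set} {J : List B} {K : B → List (Fin n)} {s} (D : Decomp vs (Adj G) J K (suc s)) where
    open Decomp D
    open Clones Fin._≟_ D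

    ends : B × Fin n → List (Fin n)
    ends (b , u) = others Fin._≟_ u (K b)

    -- A flag is a clique with an ordered pair of distinct members. Flags correspond to directed
    -- edges: `cover` gives `edges≤`, while `clique` and `same` give `≤edges`.
    flags : List ((B × Fin n) × Fin n)
    flags = pairs (pairs J K) ends

    length-flags : length flags ≡ length J * suc s * s
    length-flags = trans
      (length-pairs (pairs J K) ends s λ { {b , u} p → let b∈ , u∈ = ∈-pairs⁻ J K p in
        suc-injective (trans (length-others Fin._≟_ (K-unique b∈) u∈) (K-length b∈)) })
      (cong (_* s) length-clones)

    Ends : (B × Fin n) × Fin n → Fin n × Fin n → Set
    Ends ((b , u) , w) e = (u , w) ≡ e

    ∈-flags⁻ : ∀ {b u w} → ((b , u) , w) ∈ flags → b ∈ J × u ∈ K b × w ∈ K b × u ≢ w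
    ∈-flags⁻ {b} {u} p with q , w∈ ← ∈-pairs⁻ (pairs J K) ends p
                       with b∈ , u∈ ← ∈-pairs⁻ J K q
                       with w∈K , u≢w ← ∈-filter⁻ (λ w → ¬? (u Fin.≟ w)) {xs = K b} w∈ =
      b∈ , u∈ , w∈K , u≢w

    edges≤ : length edges ≤ length J * suc s * s
    edges≤ = ≤-trans
      (injective⇒length≤ {ys = flags} (λ e f → Ends f e) (pairs-unique nbrs vs-unique (λ {u} _ → nbrs-unique u))
         (λ { {u , w} e∈ →
            let a = to ∈-nbrs (proj₂ (∈-pairs⁻ vs nbrs e∈))
                b , b∈ , u∈ , w∈ = cover (∈-allFin u) (∈-allFin w) a
            in _ , ∈-pairs⁺ ends (∈-pairs⁺ K b∈ u∈)
                     (∈-filter⁺ (λ w → ¬? (u Fin.≟ w)) w∈ (adj-irrefl G a)) , refl })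
         (λ p q → trans (sym p) q))
      (≤-reflexive length-flags)

    ≤edges : length J * suc s * s ≤ length edges
    ≤edges = ≤-trans (≤-reflexive (sym length-flags))
      -- `same` needs the membership of both flags, so the relation carries it.
      (injective⇒length≤ (λ f e → f ∈ flags × Ends f e)
         (pairs-unique ends clones-unique
           (λ { {b , u} p → Unique.filter⁺ (λ w → ¬? (u Fin.≟ w)) (K-unique (proj₁ (∈-pairs⁻ J K p))) }))
         (λ { {(b , u) , w} f∈ → let b∈ , u∈ , w∈ , u≢w = ∈-flags⁻ f∈ in
            (u , w) , ∈-pairs⁺ nbrs (∈-allFin u) (from ∈-nbrs (clique b∈ u∈ w∈ u≢w)) , f∈ , refl })
         (λ { {(b , u) , w} {(b′ , _) , _} (f∈ , refl) (f∈′ , refl) →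
            let b∈ , u∈ , w∈ , u≢w = ∈-flags⁻ f∈ ; b′∈ , u∈′ , w∈′ , _ = ∈-flags⁻ f∈′ in
            cong (λ b → (b , u) , w) (same b∈ b′∈ u∈ w∈ u∈′ w∈′ u≢w) }))

  -- From a solution to a solution of the kernel

  module Forward {B : Set} {J : List B} {K : B → List (Fin n)} {s}
                 (D : Decomp vs (Adj G) J K s) (cost : length J * s ≤ n + k) (k<n : k < n) where
    open Decomp D
    open Clones Fin._≟_ D

    cost′ : length J * s ≤ length vs + k
    cost′ = subst (λ l → length J * s ≤ l + k) (sym length-vs) cost

    s≤star : ∀ w → s ≤ suc (deg w)
    s≤star w = let _ , b∈ , w∈ = onto (∈-allFin w) in s≤length b∈ w∈ {star w} ∈-star′

    single⇒s : ∀ {v} → Single v → s ≡ suc (deg v)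
    single⇒s {v} one = let _ , b∈ , v∈ = onto (∈-allFin v) in
      single⇒length b∈ v∈ {star v} ∈-star′ (star-unique v) one

    -- An unsplit vertex has degree `s - 1`, and by `s≤star` no vertex has a smaller one.
    single⇒min : ∀ {v} → Single v → Min v
    single⇒min one w = s≤s⁻¹ (subst (_≤ suc (deg w)) (single⇒s one) (s≤star w))

    private
      some-single : ∃[ v ] v ∈ vs × Single v
      some-single = single-exists vs-unique vs-unique cost′ (subst (k <_) (sym length-vs) k<n)

    s≡1+d : s ≡ suc d
    s≡1+d = let v , _ , one = some-single in
      trans (single⇒s one) (cong suc (min⇒d (single⇒min one)))

    -- The clique at `u` lies in the star of `u`, and both have `suc d` elements.
    min-star : ∀ {u b x} → Min u → b ∈ J → u ∈ K b → N[ u ] x → x ∈ K b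
    min-star {u} m b∈ u∈ p = ⊆-antisym-length Fin._≟_ (K-unique b∈) (K⊆Q b∈ u∈ {star u} ∈-star′)
      (≤-reflexive (trans (cong suc (min⇒d m)) (sym (trans (K-length b∈) s≡1+d)))) (from ∈-star p)

    K⇒N : ∀ {b u w} → b ∈ J → u ∈ K b → w ∈ K b → N[ u ] w
    K⇒N {_} {u} b∈ u∈ w∈ = to ∈-star (K⊆Q b∈ u∈ {star u} ∈-star′ w∈)

    -- By `min-star` both stars are cliques of the solution, and sharing two distinct vertices makes
    -- them the same clique.
    clash-free : Clash-free
    clash-free u u′ x y (m , ux , uy) (m′ , u′x , u′y) with x Fin.≟ y
    ... | yes eq = inj₁ eq
    ... | no x≢y =
      let b , b∈ , u∈ = onto (∈-allFin u)
          b′ , b′∈ , u′∈ = onto (∈-allFin u′)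
          x∈ = min-star m b∈ u∈ ux
          y∈ = min-star m b∈ u∈ uy
          b≡b′ = same b∈ b′∈ x∈ y∈ (min-star m′ b′∈ u′∈ u′x) (min-star m′ b′∈ u′∈ u′y) x≢y
      in inj₂ (clique b∈ x∈ y∈ x≢y , K⇒N b∈ u∈ (subst (λ b → u′ ∈ K b) (sym b≡b′) u′∈))

    few-edges : Few-edges
    few-edges = begin
      length edges          ≤⟨ Flags.edges≤ D′ ⟩
      length J * suc d * d  ≤⟨ *-monoˡ-≤ d (subst (λ s → length J * s ≤ n + k) s≡1+d cost) ⟩
      (n + k) * d           ≡⟨ *-comm (n + k) d ⟩
      d * (n + k)           ∎
      where
      open ≤-Reasoning
      D′ : Decomp vs (Adj G) J K (suc d)
      D′ = subst (Decomp vs (Adj G) J K) s≡1+d D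

    -- An unsplit vertex has minimum degree, so it forces all its edges. Hence every vertex of the
    -- rest is split.
    rest≤k : length rest ≤ k
    rest≤k = ≮⇒≥ λ k<rest →
      let v , v∈ , one = single-exists vs-unique rest-unique cost′ k<rest
          y , a , ¬f = to ∈-rest v∈
      in ¬f (v , single⇒min one , inj₁ refl , inj₂ a)

    RestClique : B → Set
    RestClique b = Any (λ x → Any (Rest x) (K b)) (K b)

    RestClique? : Decidable RestClique
    RestClique? b = Any.any? (λ x → Any.any? (Rest? x) (K b)) (K b)

    restClique : ∀ {b x y} → x ∈ K b → y ∈ K b → Rest x y → RestClique b
    restClique x∈ y∈ r = lose x∈ (lose y∈ r)

    restClique⁻ : ∀ {b} → RestClique b → ∃[ x ] ∃[ y ] x ∈ K b × y ∈ K b × Rest x y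
    restClique⁻ r = let x , x∈ , r′ = find r ; y , y∈ , xy = find r′ in x , y , x∈ , y∈ , xy

    -- A clique is forced as a whole or not at all: a centre `z` forcing one of its pairs has this
    -- very clique as its star, and would force the rest edge in it too.
    restClique⇒Rest : ∀ {b u w} → b ∈ J → RestClique b → u ∈ K b → w ∈ K b → u ≢ w → Rest u w
    restClique⇒Rest {b} b∈ r u∈ w∈ u≢w = clique b∈ u∈ w∈ u≢w , λ (z , m , zu , zw) →
      let b′ , b′∈ , z∈ = onto (∈-allFin z)
          b≡b′ = same b∈ b′∈ u∈ w∈ (min-star m b′∈ z∈ zu) (min-star m b′∈ z∈ zw) u≢w
          z∈′ = subst (λ b → z ∈ K b) (sym b≡b′) z∈
          x , y , x∈ , y∈ , _ , ¬f = restClique⁻ r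
      in ¬f (z , m , K⇒N b∈ z∈′ x∈ , K⇒N b∈ z∈′ y∈)

    restClique⇒rest : ∀ {b u} → b ∈ J → RestClique b → u ∈ K b → u ∈ rest
    restClique⇒rest {b} {u} b∈ r u∈ with restClique⁻ r
    ... | x , y , x∈ , y∈ , xy with u Fin.≟ x
    ...   | yes refl = from ∈-rest (y , xy)
    ...   | no u≢x   = from ∈-rest (x , restClique⇒Rest b∈ r u∈ x∈ u≢x)

    -- The clique of a rest edge consists of `suc d` rest vertices, of which there are at most `k`.
    small-rest : Small-rest
    small-rest = go rest refl
      where
      go : ∀ xs → rest ≡ xs → Small-rest
      go []      eq = inj₁ (≤-reflexive (cong length eq))
      go (x ∷ _) eq =
        let y , xy = to ∈-rest (subst (x ∈_) (sym eq) (here refl))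
            b , b∈ , x∈ , y∈ = cover (∈-allFin x) (∈-allFin y) (proj₁ xy)
        in inj₂ (rest≤k , ≤-trans (≤-reflexive (trans (sym s≡1+d) (sym (K-length b∈))))
             (≤-trans (⊆⇒length≤ (K-unique b∈) (restClique⇒rest b∈ (restClique x∈ y∈ xy))) rest≤k))

    good : Good
    good = clash-free , few-edges , small-rest

    restIndices : List B
    restIndices = filter RestClique? J

    J′ : List (B ⊎ ℕ)
    J′ = map inj₁ restIndices ++ map inj₂ blocks

    K′ : B ⊎ ℕ → List (Label n)
    K′ (inj₁ b) = map inj₁ (K b)
    K′ (inj₂ i) = map (λ x → inj₂ (i , x)) (upTo (suc d))

    -- Matching on these views reveals whether a clique and its vertices come from the rest or from
    -- the padding, and rules out mixtures.
    data ∈J′ : B ⊎ ℕ → Set where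
      rest-index : ∀ {b} → b ∈ J → RestClique b → ∈J′ (inj₁ b)
      block      : ∀ {i} → i ∈ blocks → ∈J′ (inj₂ i)

    ∈J′⁻ : ∀ {c} → c ∈ J′ → ∈J′ c
    ∈J′⁻ c∈ with ∈-++⁻ (map inj₁ restIndices) c∈
    ... | inj₁ p with b , b∈ , refl ← ∈-map⁻ inj₁ p =
      let b∈J , r = ∈-filter⁻ RestClique? {xs = J} b∈ in rest-index b∈J r
    ... | inj₂ p with i , i∈ , refl ← ∈-map⁻ inj₂ p = block i∈

    ∈J′⁺ : ∀ {c} → ∈J′ c → c ∈ J′
    ∈J′⁺ (rest-index b∈ r) = ∈-++⁺ˡ (∈-map⁺ inj₁ (∈-filter⁺ RestClique? b∈ r))
    ∈J′⁺ (block i∈)        = ∈-++⁺ʳ (map inj₁ restIndices) (∈-map⁺ inj₂ i∈)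

    data ∈K′ : B ⊎ ℕ → Label n → Set where
      rest-vertex  : ∀ {b x} → x ∈ K b → ∈K′ (inj₁ b) (inj₁ x)
      block-vertex : ∀ {i x} → x ∈ upTo (suc d) → ∈K′ (inj₂ i) (inj₂ (i , x))

    ∈K′⁻ : ∀ c {a} → a ∈ K′ c → ∈K′ c a
    ∈K′⁻ (inj₁ b) a∈ with _ , x∈ , refl ← ∈-map⁻ inj₁ a∈ = rest-vertex x∈
    ∈K′⁻ (inj₂ i) a∈ with _ , x∈ , refl ← ∈-map⁻ (λ x → inj₂ (i , x)) a∈ = block-vertex x∈

    ∈K′⁺ : ∀ {c a} → ∈K′ c a → a ∈ K′ c
    ∈K′⁺ (rest-vertex x∈)      = ∈-map⁺ inj₁ x∈
    ∈K′⁺ (block-vertex {i} x∈) = ∈-map⁺ (λ x → inj₂ (i , x)) x∈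

    J′-unique : Unique J′
    J′-unique = Unique.++⁺ (Unique.map⁺ Sum.inj₁-injective (Unique.filter⁺ RestClique? J-unique))
                           (Unique.map⁺ Sum.inj₂-injective blocks-unique)
      λ (p , q) → case (∈-map⁻ inj₁ p) (∈-map⁻ inj₂ q)
      where
      case : ∀ {x : B ⊎ ℕ} → (∃[ y ] y ∈ restIndices × x ≡ inj₁ y) → (∃[ y ] y ∈ blocks × x ≡ inj₂ y) → ⊥
      case (_ , _ , refl) (_ , _ , ())

    kernel-decomp : Decomp labels Edge J′ K′ (suc d)
    kernel-decomp = record
      { J-unique = J′-unique
      ; K-unique = λ c∈ → unique (∈J′⁻ c∈)
      ; K-length = λ c∈ → len (∈J′⁻ c∈)
      ; K⊆L      = λ {c} c∈ a∈ → sub (∈J′⁻ c∈) (∈K′⁻ c a∈)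
      ; onto     = λ {a} a∈ → onto′ a a∈
      ; clique   = λ {c} c∈ a∈ b∈ → clique′ (∈J′⁻ c∈) (∈K′⁻ c a∈) (∈K′⁻ c b∈)
      ; cover    = λ {a} {b} a∈ b∈ → cover″ a b a∈ b∈
      ; same     = λ {c} {c′} c∈ c′∈ p q p′ q′ →
                   same′ (∈J′⁻ c∈) (∈J′⁻ c′∈) (∈K′⁻ c p) (∈K′⁻ c q) (∈K′⁻ c′ p′) (∈K′⁻ c′ q′)
      }
      where
      unique : ∀ {c} → ∈J′ c → Unique (K′ c)
      unique (rest-index b∈ _) = Unique.map⁺ Sum.inj₁-injective (K-unique b∈)
      unique (block _) = Unique.map⁺ (λ { refl → refl }) (Unique.upTo⁺ (suc d))
      len : ∀ {c} → ∈J′ c → length (K′ c) ≡ suc d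
      len {inj₁ b} (rest-index b∈ _) = trans (length-map inj₁ (K b)) (trans (K-length b∈) s≡1+d)
      len {inj₂ i} (block _) = trans (length-map (λ x → inj₂ {A = Fin n} (i , x)) (upTo (suc d)))
        (length-upTo (suc d))
      sub : ∀ {c a} → ∈J′ c → ∈K′ c a → a ∈ labels
      sub (rest-index b∈ r) (rest-vertex x∈)  = inj₁∈labels⁺ (restClique⇒rest b∈ r x∈)
      sub (block i∈)        (block-vertex x∈) = inj₂∈labels⁺ (∈-pairs⁺ _ i∈ x∈)
      cover′ : ∀ {x y} → Rest x y → ∃[ c ] c ∈ J′ × inj₁ x ∈ K′ c × inj₁ y ∈ K′ c
      cover′ {x} {y} r =
        let b , b∈ , x∈ , y∈ = cover (∈-allFin x) (∈-allFin y) (proj₁ r) in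
        inj₁ b , ∈J′⁺ (rest-index b∈ (restClique x∈ y∈ r)) , ∈K′⁺ (rest-vertex x∈) , ∈K′⁺ (rest-vertex y∈)
      onto′ : ∀ a → a ∈ labels → ∃[ c ] c ∈ J′ × a ∈ K′ c
      onto′ (inj₁ x) a∈ =
        let _ , r = to ∈-rest (inj₁∈labels⁻ a∈) ; c , c∈ , x∈ , _ = cover′ r in c , c∈ , x∈
      onto′ (inj₂ (i , x)) a∈ = let i∈ , x∈ = ∈-pairs⁻ blocks _ (inj₂∈labels⁻ a∈) in
        inj₂ i , ∈J′⁺ (block i∈) , ∈K′⁺ (block-vertex x∈)
      clique′ : ∀ {c a b} → ∈J′ c → ∈K′ c a → ∈K′ c b → a ≢ b → Edge a b
      clique′ (rest-index b∈ r) (rest-vertex x∈) (rest-vertex y∈) a≢b =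
        restClique⇒Rest b∈ r x∈ y∈ (a≢b ∘ cong inj₁)
      clique′ (block _) (block-vertex _) (block-vertex _) a≢b = refl , a≢b ∘ cong (λ x → inj₂ (_ , x))
      cover″ : ∀ a b → a ∈ labels → b ∈ labels → Edge a b → ∃[ c ] c ∈ J′ × a ∈ K′ c × b ∈ K′ c
      cover″ (inj₁ x) (inj₁ y) _ _ r = cover′ r
      cover″ (inj₂ (i , x)) (inj₂ (_ , y)) a∈ b∈ (refl , _) =
        let i∈ , x∈ = ∈-pairs⁻ blocks _ (inj₂∈labels⁻ a∈)
            _  , y∈ = ∈-pairs⁻ blocks _ (inj₂∈labels⁻ b∈)
        in inj₂ i , ∈J′⁺ (block i∈) , ∈K′⁺ (block-vertex x∈) , ∈K′⁺ (block-vertex y∈)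
      same′ : ∀ {c c′ a b} → ∈J′ c → ∈J′ c′ → ∈K′ c a → ∈K′ c b → ∈K′ c′ a → ∈K′ c′ b → a ≢ b → c ≡ c′
      same′ (rest-index b∈ _) (rest-index b′∈ _) (rest-vertex x∈) (rest-vertex y∈)
            (rest-vertex x∈′) (rest-vertex y∈′) a≢b =
        cong inj₁ (same b∈ b′∈ x∈ y∈ x∈′ y∈′ (a≢b ∘ cong inj₁))
      same′ _ _ (block-vertex _) _ (block-vertex _) _ _ = refl

    private
      unrest : List (Fin n)
      unrest = filter (¬? ∘ RestVertex?) vs

      -- Members of rest cliques are rest vertices, so each of the other vertices contributes a
      -- further clone outside these cliques. Cancelling those vertices shows that the rest alone
      -- costs at most `k`.
      rest-clones≤ : length restIndices * s + length unrest ≤ length rest + length unrest + k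
      rest-clones≤ = begin
        length restIndices * s + length unrest
          ≡⟨ cong₂ _+_ (trans (length-map inj₁ (pairs restIndices K))
               (length-pairs restIndices K s (λ b∈ → K-length (proj₁ (∈-filter⁻ RestClique? b∈)))))
               (length-map inj₂ unrest) ⟨
        length (map inj₁ (pairs restIndices K)) + length (map inj₂ unrest)
          ≡⟨ length-++ (map inj₁ (pairs restIndices K)) ⟨
        length both
          ≤⟨ injective⇒length≤ Clone both-unique clone Clone-injective ⟩
        length (pairs J K)
          ≡⟨ length-clones ⟩
        length J * s
          ≤⟨ cost′ ⟩
        length vs + k
          ≡⟨ cong (_+ k) (length-filter-split RestVertex? vs) ⟨
        length rest + length unrest + k ∎
        where
        open ≤-Reasoning
        both : List (B × Fin n ⊎ Fin n)
        both = map inj₁ (pairs restIndices K) ++ map inj₂ unrest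
        restIndices-K : ∀ {b} → b ∈ restIndices → Unique (K b)
        restIndices-K b∈ = K-unique (proj₁ (∈-filter⁻ RestClique? b∈))
        both-unique : Unique both
        both-unique = Unique.++⁺
          (Unique.map⁺ Sum.inj₁-injective (pairs-unique K (Unique.filter⁺ RestClique? J-unique) restIndices-K))
          (Unique.map⁺ Sum.inj₂-injective (Unique.filter⁺ (¬? ∘ RestVertex?) vs-unique))
          λ (p , q) → case (∈-map⁻ inj₁ p) (∈-map⁻ inj₂ q)
          where
          case : ∀ {x : B × Fin n ⊎ Fin n} → (∃[ y ] y ∈ pairs restIndices K × x ≡ inj₁ y) →
                 (∃[ y ] y ∈ unrest × x ≡ inj₂ y) → ⊥
          case (_ , _ , refl) (_ , _ , ())
        Clone : B × Fin n ⊎ Fin n → B × Fin n → Set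
        Clone (inj₁ p) p′      = p ≡ p′ × RestVertex (proj₂ p)
        Clone (inj₂ u) (b , w) = u ≡ w × ¬ RestVertex u
        Clone-injective : ∀ {x x′ y} → Clone x y → Clone x′ y → x ≡ x′
        Clone-injective {inj₁ _} {inj₁ _} (refl , _)  (refl , _)  = refl
        Clone-injective {inj₂ _} {inj₂ _} (refl , _)  (refl , _)  = refl
        Clone-injective {inj₁ _} {inj₂ _} (refl , r)  (refl , ¬r) = ⊥-elim (¬r r)
        Clone-injective {inj₂ _} {inj₁ _} (refl , ¬r) (refl , r)  = ⊥-elim (¬r r)
        clone : ∀ {x} → x ∈ both → ∃[ y ] y ∈ pairs J K × Clone x y
        clone x∈ with ∈-++⁻ (map inj₁ (pairs restIndices K)) x∈
        ... | inj₁ p with (b , u) , bu∈ , refl ← ∈-map⁻ inj₁ p =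
          let b∈ , u∈ = ∈-pairs⁻ restIndices K bu∈
              b∈J , r = ∈-filter⁻ RestClique? {xs = J} b∈
          in (b , u) , ∈-pairs⁺ K b∈J u∈ , refl , to ∈-rest (restClique⇒rest b∈J r u∈)
        ... | inj₂ p with u , u∈ , refl ← ∈-map⁻ inj₂ p =
          let b , b∈ , u∈K = onto (∈-allFin u) in
          (b , u) , ∈-pairs⁺ K b∈ u∈K , refl , proj₂ (∈-filter⁻ (¬? ∘ RestVertex?) {xs = vs} u∈)

    -- The added cliques are left unsplit and contribute `t * suc d` to both sides.
    kernel-cost : length J′ * suc d ≤ length labels + k
    kernel-cost = begin
      length J′ * suc d
        ≡⟨ cong (_* suc d) (trans (length-++ (map inj₁ restIndices))
             (cong₂ _+_ (length-map inj₁ restIndices) (length-map inj₂ blocks))) ⟩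
      (r + t) * suc d
        ≡⟨ *-distribʳ-+ (suc d) r t ⟩
      r * suc d + t * suc d
        ≤⟨ +-monoˡ-≤ (t * suc d) (subst (λ s → r * s ≤ length rest + k) s≡1+d r≤) ⟩
      (length rest + k) + t * suc d
        ≡⟨ swap (length rest) k (t * suc d) ⟩
      length rest + t * suc d + k
        ≡⟨ cong (_+ k) length-labels ⟨
      length labels + k ∎
      where
      open ≤-Reasoning
      r t : ℕ
      r = length restIndices
      t = length blocks
      swap : ∀ a b c → (a + b) + c ≡ a + c + b
      swap a b c = trans (+-assoc a b c) (trans (cong (a +_) (+-comm b c)) (sym (+-assoc a c b)))
      r≤ : r * s ≤ length rest + k
      r≤ = +-cancelʳ-≤ (length unrest) _ _ (≤-trans rest-clones≤
        (≤-reflexive (swap (length rest) (length unrest) k)))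

-- From a solution of the kernel to a solution

module Backward (I : Instance) where
  private
    n = order I
    G = graph I
  open Reduction G (k I)

  module _ (good : Good) where
    private
      clash-free : Clash-free
      clash-free = proj₁ good
      few-edges : Few-edges
      few-edges = proj₁ (proj₂ good)

    -- Several vertices of minimum degree can have the same star. The least of them is chosen, so
    -- that each forced clique is listed once.
    Rep : Fin n → Set
    Rep u = Min u × (∀ u′ → Min u′ → N[ u ] u′ → u Data.Fin.≤ u′)

    Rep? : Decidable Rep
    Rep? u = Min? u ×-dec Fin.all? λ u′ → Min? u′ →-dec N? u u′ →-dec (u Fin.≤? u′)

    Smaller : Fin n → Fin n → Set
    Smaller u u′ = Min u′ × N[ u ] u′ × u′ Data.Fin.< u

    star-clique : ∀ {u x y} → Min u → N[ u ] x → N[ u ] y → N[ x ] y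
    star-clique {u} {x} {y} m p q = case (clash-free u u x y (m , p , q) (m , p , q))
      where
      case : x ≡ y ⊎ Adj G x y × N[ u ] u → N[ x ] y
      case (inj₁ eq)      = inj₁ eq
      case (inj₂ (a , _)) = inj₂ a

    -- Moving to a smaller vertex of minimum degree inside the star loses no member of the star, as
    -- the star is a clique. The descent ends at a representative.
    rep : ∀ {u} → Acc Data.Fin._<_ u → Min u → ∃[ r ] Rep r × (∀ {x} → N[ u ] x → N[ r ] x)
    rep {u} (acc rec) m = case (Fin.any? λ u′ → Min? u′ ×-dec N? u u′ ×-dec (u′ Fin.<? u))
      where
      case : Dec (∃[ u′ ] Smaller u u′) → ∃[ r ] Rep r × (∀ {x} → N[ u ] x → N[ r ] x)
      case (no ¬s) = u , (m , λ u′ m′ p → ≮⇒≥ λ lt → ¬s (u′ , m′ , p , lt)) , id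
      case (yes (u′ , m′ , p , lt)) =
        let r , rep-r , sub = rep (rec lt) m′ in r , rep-r , sub ∘ star-clique m p

    forced⇒rep : ∀ {x y} → Forced x y → ∃[ r ] Rep r × N[ r ] x × N[ r ] y
    forced⇒rep (u , m , p , q) = let r , rep-r , sub = rep (<-wellFounded u) m in r , rep-r , sub p , sub q

    -- With `d = 0` no cost can be read off from the edges, but `Few-edges` then leaves no edge at
    -- all, and the singletons solve the instance without splits.
    module Edgeless (d≡0 : d ≡ 0) where
      no-edge : ∀ {u w} → ¬ Adj G u w
      no-edge {u} a = <⇒≱ (∈-length (∈-pairs⁺ nbrs (∈-allFin u) (from ∈-nbrs a)))
        (≤-trans few-edges (≤-reflexive (cong (_* (n + k I)) d≡0)))

      decomp : Decomp vs (Adj G) vs (_∷ []) 1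
      decomp = record
        { J-unique = vs-unique
        ; K-unique = λ _ → [] ∷ []
        ; K-length = λ _ → refl
        ; K⊆L      = λ _ _ → ∈-allFin _
        ; onto     = λ {u} u∈ → u , u∈ , here refl
        ; clique   = λ { _ (here refl) (here refl) u≢u → ⊥-elim (u≢u refl) }
        ; cover    = λ _ _ a → ⊥-elim (no-edge a)
        ; same     = λ { _ _ (here refl) _ (here refl) _ _ → refl }
        }

      solution : UCEVS I
      solution = Decomp⇒UCEVS I decomp
        (≤-trans (≤-reflexive (trans (*-identityʳ (length vs)) length-vs)) (m≤m+n n (k I)))

    module _ {B : Set} {J′ : List B} {K′ : B → List (Label n)} {s′}
             (D′ : Decomp labels Edge J′ K′ s′) (cost : length J′ * s′ ≤ length labels + k I)
             (d≢0 : d ≢ 0) where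
      private
        module D′ = Decomp D′
      open Clones _≟ᴸ_ D′ using (Single; single-exists; single⇒length)
      open DecMembership {A = Label n} _≟ᴸ_ using (_∈?_)

      block : ℕ → List (Label n)
      block i = map (λ x → inj₂ (i , x)) (upTo (suc d))

      length-block : ∀ i → length (block i) ≡ suc d
      length-block i = trans (length-map (λ x → inj₂ {A = Fin n} (i , x)) (upTo (suc d)))
        (length-upTo (suc d))

      block-unique : ∀ i → Unique (block i)
      block-unique i = Unique.map⁺ (λ { refl → refl }) (Unique.upTo⁺ (suc d))

      ∈-block : ∀ {i x} → i ∈ blocks → x ∈ upTo (suc d) →
                ∀ {w} → w ∈ block i ⇔ (inj₂ (i , x) ≡ w ⊎ (w ∈ labels × Edge (inj₂ (i , x)) w))
      ∈-block {i} {x} i∈ x∈ {w} = mk⇔ (λ w∈ → there′ (∈-map⁻ (λ x → inj₂ (i , x)) w∈)) back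
        where
        there′ : ∀ {w} → (∃[ y ] y ∈ upTo (suc d) × w ≡ inj₂ (i , y)) →
                 inj₂ (i , x) ≡ w ⊎ (w ∈ labels × Edge (inj₂ (i , x)) w)
        there′ (y , y∈ , refl) with x ≟ y
        ... | yes refl = inj₁ refl
        ... | no x≢y   = inj₂ (inj₂∈labels⁺ (∈-pairs⁺ _ i∈ y∈) , refl , x≢y)
        back : ∀ {w} → inj₂ (i , x) ≡ w ⊎ (w ∈ labels × Edge (inj₂ (i , x)) w) → w ∈ block i
        back (inj₁ refl) = ∈-map⁺ (λ x → inj₂ (i , x)) x∈
        back {inj₂ (_ , y)} (inj₂ (w∈ , refl , _)) =
          ∈-map⁺ (λ x → inj₂ (i , x)) (proj₂ (∈-pairs⁻ blocks _ (inj₂∈labels⁻ w∈)))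

      -- The vertex `x` excludes the first alternative of `Small-rest`, and `suc d ≤ k` in the other
      -- makes the padding exceed `k`. An unsplit padding vertex then has a whole block as its
      -- clique.
      rest⇒s′ : ∀ {x} → x ∈ rest → s′ ≡ suc d
      rest⇒s′ x∈ = case (proj₂ (proj₂ good))
        where
        from-single : ∃[ a ] a ∈ map inj₂ padding × Single a → s′ ≡ suc d
        from-single (a , a∈ , one) with ∈-map⁻ inj₂ a∈
        ... | (i , x) , p∈ , refl =
          let i∈ , x∈ = ∈-pairs⁻ blocks _ p∈
              b , b∈ , a∈K = D′.onto (inj₂∈labels⁺ p∈)
          in trans (single⇒length b∈ a∈K {block i} (∈-block i∈ x∈) (block-unique i) one) (length-block i)
        case : Small-rest → s′ ≡ suc d
        case (inj₁ le)        = ⊥-elim (<⇒≱ (∈-length x∈) le)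
        case (inj₂ (_ , d<k)) = from-single (single-exists labels-unique
          (Unique.map⁺ Sum.inj₂-injective padding-unique) cost
          (subst (k I <_) (sym (trans (length-map inj₂ padding) length-padding)) (blocks> d<k)))

      RestClique : B → Set
      RestClique b = ∃[ x ] inj₁ x ∈ K′ b

      RestClique? : Decidable RestClique
      RestClique? b = Fin.any? λ x → inj₁ x ∈? K′ b

      -- No edge joins the rest to the padding.
      restClique⇒inj₁ : ∀ {b a} → b ∈ J′ → RestClique b → a ∈ K′ b → ∃[ y ] y ∈ vs × a ≡ inj₁ y
      restClique⇒inj₁ {a = inj₁ y} b∈ (x , x∈) a∈ = y , ∈-allFin y , refl
      restClique⇒inj₁ {a = inj₂ _} b∈ (x , x∈) a∈ = ⊥-elim (D′.clique b∈ x∈ a∈ λ ())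

      J : List (B ⊎ Fin n)
      J = map inj₁ (filter RestClique? J′) ++ map inj₂ (filter Rep? vs)

      K : B ⊎ Fin n → List (Fin n)
      K (inj₁ b) = preimage _≟ᴸ_ inj₁ vs (K′ b)
      K (inj₂ u) = star u

      data ∈J : B ⊎ Fin n → Set where
        rest-index : ∀ {b} → b ∈ J′ → RestClique b → ∈J (inj₁ b)
        rep-index  : ∀ {u} → Rep u → ∈J (inj₂ u)

      ∈J⁻ : ∀ {c} → c ∈ J → ∈J c
      ∈J⁻ c∈ with ∈-++⁻ (map inj₁ (filter RestClique? J′)) c∈
      ... | inj₁ p with b , b∈ , refl ← ∈-map⁻ inj₁ p =
        let b∈J , r = ∈-filter⁻ RestClique? {xs = J′} b∈ in rest-index b∈J r
      ... | inj₂ p with u , u∈ , refl ← ∈-map⁻ inj₂ p = rep-index (proj₂ (∈-filter⁻ Rep? {xs = vs} u∈))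

      ∈J⁺ : ∀ {c} → ∈J c → c ∈ J
      ∈J⁺ (rest-index b∈ r) = ∈-++⁺ˡ (∈-map⁺ inj₁ (∈-filter⁺ RestClique? b∈ r))
      ∈J⁺ (rep-index r)     =
        ∈-++⁺ʳ (map inj₁ (filter RestClique? J′)) (∈-map⁺ inj₂ (∈-filter⁺ Rep? (∈-allFin _) r))

      data ∈K : B ⊎ Fin n → Fin n → Set where
        rest-vertex : ∀ {b x} → inj₁ x ∈ K′ b → ∈K (inj₁ b) x
        star-vertex : ∀ {u x} → N[ u ] x → ∈K (inj₂ u) x

      ∈K⁻ : ∀ c {x} → x ∈ K c → ∈K c x
      ∈K⁻ (inj₁ b) x∈ = rest-vertex (proj₂ (∈-filter⁻ (λ x → inj₁ x ∈? K′ b) {xs = vs} x∈))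
      ∈K⁻ (inj₂ u) x∈ = star-vertex (to ∈-star x∈)

      ∈K⁺ : ∀ {c x} → ∈K c x → x ∈ K c
      ∈K⁺ (rest-vertex {b} x∈) = ∈-filter⁺ (λ x → inj₁ x ∈? K′ b) (∈-allFin _) x∈
      ∈K⁺ (star-vertex p)      = from ∈-star p

      J-unique : Unique J
      J-unique = Unique.++⁺ (Unique.map⁺ Sum.inj₁-injective (Unique.filter⁺ RestClique? D′.J-unique))
                            (Unique.map⁺ Sum.inj₂-injective (Unique.filter⁺ Rep? vs-unique))
        λ (p , q) → case (∈-map⁻ inj₁ p) (∈-map⁻ inj₂ q)
        where
        case : ∀ {x : B ⊎ Fin n} → (∃[ y ] y ∈ filter RestClique? J′ × x ≡ inj₁ y) →
               (∃[ y ] y ∈ filter Rep? vs × x ≡ inj₂ y) → ⊥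
        case (_ , _ , refl) (_ , _ , ())

      -- A vertex outside the rest has to be found in a forced clique. Any edge at it leads there,
      -- and `d ≢ 0` provides one.
      some-neighbour : ∀ v → ∃[ w ] Adj G v w
      some-neighbour v = neighbour (nbrs v) refl
        where
        min : ∀ ms → filter Min? vs ≡ ms → ∃[ u ] Min u
        min []      eq = ⊥-elim (d≢0 (cong firstDeg eq))
        min (u ∷ _) eq = u , proj₂ (∈-filter⁻ Min? {xs = vs} (subst (u ∈_) (sym eq) (here refl)))
        neighbour : ∀ ws → nbrs v ≡ ws → ∃[ w ] Adj G v w
        neighbour []      eq = let u , m = min (filter Min? vs) refl in
          ⊥-elim (d≢0 (n≤0⇒n≡0 (subst₂ _≤_ (min⇒d m) (cong length eq) (m v))))
        neighbour (w ∷ _) eq = w , to ∈-nbrs (subst (w ∈_) (sym eq) (here refl))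

      ¬rest⇒forced : ∀ {x y} → Adj G x y → ¬ Rest x y → Forced x y
      ¬rest⇒forced {x} {y} a ¬r = case (Forced? x y)
        where
        case : Dec (Forced x y) → Forced x y
        case (yes f) = f
        case (no ¬f) = ⊥-elim (¬r (a , ¬f))

      decomp : Decomp vs (Adj G) J K (suc d)
      decomp = record
        { J-unique = J-unique
        ; K-unique = λ {c} _ → unique c
        ; K-length = λ c∈ → len (∈J⁻ c∈)
        ; K⊆L      = λ _ _ → ∈-allFin _
        ; onto     = λ {u} _ → onto u (RestVertex? u)
        ; clique   = λ {c} c∈ u∈ w∈ → clique (∈J⁻ c∈) (∈K⁻ c u∈) (∈K⁻ c w∈)
        ; cover    = λ {u} {w} _ _ a → cover a (Rest? u w)
        ; same     = λ {c} {c′} c∈ c′∈ p q p′ q′ →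
                     same (∈J⁻ c∈) (∈J⁻ c′∈) (∈K⁻ c p) (∈K⁻ c q) (∈K⁻ c′ p′) (∈K⁻ c′ q′)
        }
        where
        unique : ∀ c → Unique (K c)
        unique (inj₁ b) = Unique.filter⁺ (λ x → inj₁ x ∈? K′ b) vs-unique
        unique (inj₂ u) = star-unique u
        len : ∀ {c} → ∈J c → length (K c) ≡ suc d
        len {inj₁ b} (rest-index b∈ (x , x∈)) = trans
          (length-preimage _≟ᴸ_ inj₁ Sum.inj₁-injective vs-unique (D′.K-unique b∈) (restClique⇒inj₁ b∈ (x , x∈)))
          (trans (D′.K-length b∈) (rest⇒s′ (inj₁∈labels⁻ (D′.K⊆L b∈ x∈))))
        len (rep-index (m , _)) = cong suc (min⇒d m)
        cover : ∀ {u w} → Adj G u w → Dec (Rest u w) → ∃[ c ] c ∈ J × u ∈ K c × w ∈ K c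
        cover {u} {w} a (yes r) =
          let b , b∈ , u∈ , w∈ = D′.cover (inj₁∈labels⁺ (from ∈-rest (w , r)))
                                          (inj₁∈labels⁺ (from ∈-rest (u , Rest-sym r))) r
          in inj₁ b , ∈J⁺ (rest-index b∈ (u , u∈)) , ∈K⁺ (rest-vertex u∈) , ∈K⁺ (rest-vertex w∈)
        cover a (no ¬r) = let r , rep-r , p , q = forced⇒rep (¬rest⇒forced a ¬r) in
          inj₂ r , ∈J⁺ (rep-index rep-r) , ∈K⁺ (star-vertex p) , ∈K⁺ (star-vertex q)
        onto : ∀ u → Dec (RestVertex u) → ∃[ c ] c ∈ J × u ∈ K c
        onto u (yes r) = let b , b∈ , u∈ = D′.onto (inj₁∈labels⁺ (from ∈-rest r)) in
          inj₁ b , ∈J⁺ (rest-index b∈ (u , u∈)) , ∈K⁺ (rest-vertex u∈)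
        onto u (no ¬r) =
          let w , a = some-neighbour u
              r , rep-r , p , _ = forced⇒rep (¬rest⇒forced a (λ uw → ¬r (w , uw)))
          in inj₂ r , ∈J⁺ (rep-index rep-r) , ∈K⁺ (star-vertex p)
        clique : ∀ {c u w} → ∈J c → ∈K c u → ∈K c w → u ≢ w → Adj G u w
        clique (rest-index b∈ _) (rest-vertex u∈) (rest-vertex w∈) u≢w =
          proj₁ (D′.clique b∈ u∈ w∈ (u≢w ∘ Sum.inj₁-injective))
        clique (rep-index (m , _)) (star-vertex p) (star-vertex q) u≢w = case (star-clique m p q)
          where
          case : N[ _ ] _ → _
          case (inj₁ eq) = ⊥-elim (u≢w eq)
          case (inj₂ a)  = a
        -- Pairs within a rest clique are edges of the rest graph, which are not forced.
        mixed : ∀ {b r u w} → b ∈ J′ → inj₁ u ∈ K′ b → inj₁ w ∈ K′ b → Rep r → N[ r ] u → N[ r ] w →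
                u ≢ w → ⊥
        mixed b∈ u∈ w∈ (m , _) p q u≢w =
          proj₂ (D′.clique b∈ u∈ w∈ (u≢w ∘ Sum.inj₁-injective)) (_ , m , p , q)
        -- The centres see each other by `Clash-free`, so each is at most the other.
        rep-unique : ∀ {r r′ u w} → Rep r → Rep r′ → N[ r ] u → N[ r ] w → N[ r′ ] u → N[ r′ ] w →
                     u ≢ w → r ≡ r′
        rep-unique {r} {r′} {u} {w} (m , least) (m′ , least′) p q p′ q′ u≢w =
          case (clash-free r r′ u w (m , p , q) (m′ , p′ , q′))
          where
          case : u ≡ w ⊎ Adj G u w × N[ r ] r′ → r ≡ r′
          case (inj₁ eq)      = ⊥-elim (u≢w eq)
          case (inj₂ (_ , a)) = Fin.≤-antisym (least r′ m′ a) (least′ r m (N-sym a))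
        same : ∀ {c c′ u w} → ∈J c → ∈J c′ → ∈K c u → ∈K c w → ∈K c′ u → ∈K c′ w → u ≢ w → c ≡ c′
        same (rest-index b∈ _) (rest-index b′∈ _) (rest-vertex p) (rest-vertex q)
             (rest-vertex p′) (rest-vertex q′) u≢w =
          cong inj₁ (D′.same b∈ b′∈ p q p′ q′ (u≢w ∘ Sum.inj₁-injective))
        same (rest-index b∈ _) (rep-index r) (rest-vertex p) (rest-vertex q)
             (star-vertex p′) (star-vertex q′) u≢w = ⊥-elim (mixed b∈ p q r p′ q′ u≢w)
        same (rep-index r) (rest-index b∈ _) (star-vertex p) (star-vertex q)
             (rest-vertex p′) (rest-vertex q′) u≢w = ⊥-elim (mixed b∈ p′ q′ r p q u≢w)
        same (rep-index r) (rep-index r′) (star-vertex p) (star-vertex q)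
             (star-vertex p′) (star-vertex q′) u≢w = cong inj₂ (rep-unique r r′ p q p′ q′ u≢w)

      solution : UCEVS I
      -- Dividing the edge count by `d` yields the cost, whatever cliques the kernel solution uses
      -- on the rest.
      solution = Decomp⇒UCEVS I decomp (*-cancelʳ-≤ (length J * suc d) (n + k I) d {{≢-nonZero d≢0}} (begin
        length J * suc d * d   ≤⟨ Flags.≤edges decomp ⟩
        length edges           ≤⟨ few-edges ⟩
        d * (n + k I)          ≡⟨ *-comm d (n + k I) ⟩
        (n + k I) * d          ∎))
        where open ≤-Reasoning

-- Programs with polynomial bounds

∥∥>0 : ∀ x → 1 ≤ ∥ x ∥
∥∥>0 nil     = ≤-refl
∥∥>0 (_ ∙ _) = s≤s z≤n

*-^ : ∀ m n e → (m * n) ^ e ≡ m ^ e * n ^ e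
*-^ m n zero    = refl
*-^ m n (suc e) = trans (cong (m * n *_) (*-^ m n e)) ([m*n]*[o*p]≡[m*o]*[n*p] m n (m ^ e) (n ^ e))

-- The base is at least 2, so coefficients and lower terms are absorbed into the exponent and a
-- bound is a single number.
Bounded : (Tree → ℕ) → Set
Bounded h = ∃[ e ] ∀ x → h x ≤ suc ∥ x ∥ ^ e

n≤2^n : ∀ n → n ≤ 2 ^ n
n≤2^n zero    = z≤n
n≤2^n (suc n) = begin
  1 + n           ≤⟨ +-mono-≤ (m^n>0 2 n) (n≤2^n n) ⟩
  2 ^ n + 2 ^ n   ≡⟨ cong (2 ^ n +_) (+-identityʳ (2 ^ n)) ⟨
  2 ^ suc n       ∎
  where open ≤-Reasoning

bounded-≤ : ∀ {h h′} → (∀ x → h x ≤ h′ x) → Bounded h′ → Bounded h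
bounded-≤ h≤h′ (e , p) = e , λ x → ≤-trans (h≤h′ x) (p x)

bounded-const : ∀ c → Bounded (const c)
bounded-const c = c , λ x → ≤-trans (n≤2^n c) (^-monoˡ-≤ c (s≤s (∥∥>0 x)))

bounded-size : Bounded (λ x → suc ∥ x ∥)
bounded-size = 1 , λ x → ≤-reflexive (sym (^-identityʳ (suc ∥ x ∥)))

bounded-+ : ∀ {h h′} → Bounded h → Bounded h′ → Bounded (λ x → h x + h′ x)
bounded-+ {h} {h′} (a , p) (b , q) = suc (a + b) , λ x →
  let N = suc ∥ x ∥ in begin
  h x + h′ x                   ≤⟨ +-mono-≤ (≤-trans (p x) (^-monoʳ-≤ N (m≤m+n a b)))
                                           (≤-trans (q x) (^-monoʳ-≤ N (m≤n+m b a))) ⟩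
  N ^ (a + b) + N ^ (a + b)    ≡⟨ cong (N ^ (a + b) +_) (+-identityʳ _) ⟨
  2 * N ^ (a + b)              ≤⟨ *-monoˡ-≤ (N ^ (a + b)) (s≤s (∥∥>0 x)) ⟩
  N ^ suc (a + b)              ∎
  where open ≤-Reasoning

bounded-* : ∀ {h h′} → Bounded h → Bounded h′ → Bounded (λ x → h x * h′ x)
bounded-* {h} {h′} (a , p) (b , q) = a + b , λ x →
  ≤-trans (*-mono-≤ (p x) (q x)) (≤-reflexive (sym (^-distribˡ-+-* (suc ∥ x ∥) a b)))

bounded-^ : ∀ {h} e → Bounded h → Bounded (λ x → h x ^ e)
bounded-^ e (a , p) = a * e , λ x →
  ≤-trans (^-monoˡ-≤ e (p x)) (≤-reflexive (^-*-assoc (suc ∥ x ∥) a e))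

bounded-∘ : ∀ {f h} → Bounded (λ x → suc ∥ f x ∥) → Bounded h → Bounded (h ∘ f)
bounded-∘ {f} p (e , q) = bounded-≤ (q ∘ f) (bounded-^ e p)

-- Linking of programs

ren : ∀ {F F′ n} → (Fin F → Fin F′) → Expr F n → Expr F′ n
ren r (var x)      = var x
ren r nil          = nil
ren r (cons e e₁)  = cons (ren r e) (ren r e₁)
ren r (hd e)       = hd (ren r e)
ren r (tl e)       = tl (ren r e)
ren r (if e e₁ e₂) = if (ren r e) (ren r e₁) (ren r e₂)
ren r (let′ e e₁)  = let′ (ren r e) (ren r e₁)
ren r (call f e)   = call (r f) (ren r e)

eval-ren : ∀ {F F′ b} {b′ : Vec (Expr F′ 1) F′} (r : Fin F → Fin F′) →
           (∀ f → Vec.lookup b′ (r f) ≡ ren r (Vec.lookup b f)) →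
           ∀ {n} {ρ : Vec Tree n} {e v t} → Eval b ρ e v t → Eval b′ ρ (ren r e) v t
eval-ren r eq (var x)     = var x
eval-ren r eq nil         = nil
eval-ren r eq (cons p q)  = cons (eval-ren r eq p) (eval-ren r eq q)
eval-ren r eq (hd p)      = hd (eval-ren r eq p)
eval-ren r eq (tl p)      = tl (eval-ren r eq p)
eval-ren r eq (ifYes p q) = ifYes (eval-ren r eq p) (eval-ren r eq q)
eval-ren r eq (ifNo p q)  = ifNo (eval-ren r eq p) (eval-ren r eq q)
eval-ren r eq (let′ p q)  = let′ (eval-ren r eq p) (eval-ren r eq q)
eval-ren r eq (call {f = f} {t₂ = t₂} p q) = call (eval-ren r eq p)
  (subst (λ e → Eval _ _ e _ t₂) (sym (eq f)) (eval-ren r eq q))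

-- The output size is bounded separately: evaluation shares subtrees, so the
-- running time does not bound it.
record Poly (f : Tree → Tree) : Set where
  field
    funs         : ℕ
    body         : Vec (Expr funs 1) funs
    entry        : Fin funs
    time         : Tree → ℕ
    runs         : ∀ x → Eval body (x ∷ []) (Vec.lookup body entry) (f x) (time x)
    time-bounded : Bounded time
    size-bounded : Bounded (λ x → suc ∥ f x ∥)

-- The function names 0, 1 and 2 of e refer to e itself, f and g.
module Link {f g} (p : Poly f) (q : Poly g) (e : Expr 3 1) where
  private
    module P = Poly p
    module Q = Poly q

  funs : ℕ
  funs = suc (P.funs + Q.funs)

  inP : Fin P.funs → Fin funs
  inP i = suc (i ↑ˡ Q.funs)

  inQ : Fin Q.funs → Fin funs
  inQ i = suc (P.funs ↑ʳ i)

  name : Fin 3 → Fin funs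
  name zero             = zero
  name (suc zero)       = inP P.entry
  name (suc (suc zero)) = inQ Q.entry

  body : Vec (Expr funs 1) funs
  body = ren name e ∷ Vec.map (ren inP) P.body Vec.++ Vec.map (ren inQ) Q.body

  callP : ∀ {n} {ρ : Vec Tree n} {e′ x t} → Eval body ρ e′ x t →
          Eval body ρ (call (inP P.entry) e′) (f x) (1 + t + P.time x)
  callP {x = x} d = call d (subst (λ e → Eval body _ e _ (P.time x)) (sym (look P.entry))
                                  (eval-ren inP look (P.runs x)))
    where
    look : ∀ i → Vec.lookup body (inP i) ≡ ren inP (Vec.lookup P.body i)
    look i = trans (lookup-++ˡ (Vec.map (ren inP) P.body) _ i) (lookup-map i (ren inP) P.body)

  callQ : ∀ {n} {ρ : Vec Tree n} {e′ x t} → Eval body ρ e′ x t →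
          Eval body ρ (call (inQ Q.entry) e′) (g x) (1 + t + Q.time x)
  callQ {x = x} d = call d (subst (λ e → Eval body _ e _ (Q.time x)) (sym (look Q.entry))
                                  (eval-ren inQ look (Q.runs x)))
    where
    look : ∀ i → Vec.lookup body (inQ i) ≡ ren inQ (Vec.lookup Q.body i)
    look i = trans (lookup-++ʳ (Vec.map (ren inP) P.body) _ i) (lookup-map i (ren inQ) Q.body)

poly-≗ : ∀ {f g} → (∀ x → f x ≡ g x) → Poly f → Poly g
poly-≗ eq p = record
  { Poly p hiding (runs; size-bounded)
  ; runs         = λ x → subst (λ v → Eval _ _ _ v (Poly.time p x)) (eq x) (Poly.runs p x)
  ; size-bounded = bounded-≤ (λ x → ≤-reflexive (cong (suc ∘ ∥_∥) (sym (eq x))))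
                             (Poly.size-bounded p)
  }

poly-∘ : ∀ {f g} → Poly f → Poly g → Poly (g ∘ f)
poly-∘ {f} {g} p q = record
  { funs         = funs
  ; body         = body
  ; entry        = zero
  ; time         = λ x → 1 + (1 + 1 + P.time x) + Q.time (f x)
  ; runs         = λ x → callQ (callP (var zero))
  ; time-bounded = bounded-+ (bounded-+ (bounded-const 3) P.time-bounded)
                             (bounded-∘ P.size-bounded Q.time-bounded)
  ; size-bounded = bounded-∘ {f} {λ x → suc ∥ g x ∥} P.size-bounded Q.size-bounded
  }
  where
  module P = Poly p
  module Q = Poly q
  open Link p q (call (suc (suc zero)) (call (suc zero) (var zero)))

poly-pair : ∀ {f g} → Poly f → Poly g → Poly (λ x → f x ∙ g x)
poly-pair p q = record
  { funs         = funs
  ; body         = body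
  ; entry        = zero
  ; time         = λ x → 1 + (1 + 1 + P.time x) + (1 + 1 + Q.time x)
  ; runs         = λ x → cons (callP (var zero)) (callQ (var zero))
  ; time-bounded = bounded-+ (bounded-+ (bounded-const 3) P.time-bounded)
                             (bounded-+ (bounded-const 2) Q.time-bounded)
  ; size-bounded = bounded-≤ (λ x → s≤s (≤-reflexive (sym (+-suc _ _))))
                             (bounded-+ P.size-bounded Q.size-bounded)
  }
  where
  module P = Poly p
  module Q = Poly q
  open Link p q (cons (call (suc zero) (var zero)) (call (suc (suc zero)) (var zero)))

poly-id : Poly id
poly-id = record
  { funs = 1 ; body = var zero ∷ [] ; entry = zero ; time = const 1
  ; runs = λ x → var zero ; time-bounded = bounded-const 1 ; size-bounded = bounded-size }

poly-nil : Poly (const nil)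
poly-nil = record
  { funs = 1 ; body = nil ∷ [] ; entry = zero ; time = const 1
  ; runs = λ x → nil ; time-bounded = bounded-const 1 ; size-bounded = bounded-const 2 }

∥head′∥≤ : ∀ x → ∥ head′ x ∥ ≤ ∥ x ∥
∥head′∥≤ nil     = ≤-refl
∥head′∥≤ (s ∙ t) = m≤n⇒m≤1+n (m≤m+n _ _)

∥tail′∥≤ : ∀ x → ∥ tail′ x ∥ ≤ ∥ x ∥
∥tail′∥≤ nil     = ≤-refl
∥tail′∥≤ (s ∙ t) = m≤n⇒m≤1+n (m≤n+m (∥ t ∥) (∥ s ∥))

poly-hd : Poly head′
poly-hd = record
  { funs = 1 ; body = hd (var zero) ∷ [] ; entry = zero ; time = const 2
  ; runs = λ x → hd (var zero) ; time-bounded = bounded-const 2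
  ; size-bounded = bounded-≤ (s≤s ∘ ∥head′∥≤) bounded-size }

poly-tl : Poly tail′
poly-tl = record
  { funs = 1 ; body = tl (var zero) ∷ [] ; entry = zero ; time = const 2
  ; runs = λ x → tl (var zero) ; time-bounded = bounded-const 2
  ; size-bounded = bounded-≤ (s≤s ∘ ∥tail′∥≤) bounded-size }

cond : Tree → Tree → Tree → Tree
cond nil     a b = b
cond (_ ∙ _) a b = a

select : Tree → Tree
select z = cond (head′ z) (head′ (tail′ z)) (tail′ (tail′ z))

poly-select : Poly select
poly-select = record
  { funs = 1
  ; body = if (hd (var zero)) (hd (tl (var zero))) (tl (tl (var zero))) ∷ []
  ; entry = zero ; time = const 6 ; runs = run ; time-bounded = bounded-const 6
  ; size-bounded = bounded-≤ (s≤s ∘ size) bounded-size }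
  where
  run : ∀ x → Eval _ (x ∷ []) _ (select x) 6
  run nil             = ifNo (hd (var zero)) (tl (tl (var zero)))
  run (nil ∙ _)       = ifNo (hd (var zero)) (tl (tl (var zero)))
  run ((_ ∙ _) ∙ _)   = ifYes (hd (var zero)) (hd (tl (var zero)))
  size : ∀ x → ∥ select x ∥ ≤ ∥ x ∥
  size x with head′ x
  ... | nil   = ≤-trans (∥tail′∥≤ (tail′ x)) (∥tail′∥≤ x)
  ... | _ ∙ _ = ≤-trans (∥head′∥≤ (tail′ x)) (∥tail′∥≤ x)

poly-cond : ∀ {f g h} → Poly f → Poly g → Poly h → Poly (λ x → cond (f x) (g x) (h x))
poly-cond p q r = poly-∘ (poly-pair p (poly-pair q r)) poly-select

-- Folds

module _ (b g : Tree → Tree) where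
  fold : Tree → Tree → Tree
  fold nil      e = b e
  fold (x ∙ xs) e = g (x ∙ (fold xs e ∙ e))

-- A polynomial step can double the accumulator in every round, so a bound on the size of the result
-- has to be supplied. It bounds the argument of each step, and with it the running time.
module _ {b g} (p : Poly b) (q : Poly g)
         (size : Bounded (λ z → suc ∥ fold b g (head′ z) (tail′ z) ∥)) where
  private
    module P = Poly p
    module Q = Poly q

    z : ∀ {n} → Expr 3 (suc n)
    z = var zero

    open Link p q
      (if (hd z)
          (call (suc (suc zero))
                (cons (hd (hd z)) (cons (call zero (cons (tl (hd z)) (tl z))) (tl z))))
          (call (suc zero) (tl z)))

    time : Tree → Tree → ℕ
    time nil      e = 6 + P.time e
    time (x ∙ xs) e =
      3 + (1 + (4 + (1 + (7 + time xs e) + 2)) + Q.time (x ∙ (fold b g xs e ∙ e)))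

    runs : ∀ xs e → Eval body ((xs ∙ e) ∷ []) (Vec.lookup body zero) (fold b g xs e) (time xs e)
    runs nil      e = ifNo (hd (var zero)) (callP (tl (var zero)))
    runs (x ∙ xs) e = ifYes (hd (var zero))
      (callQ (cons (hd (hd (var zero)))
                   (cons (call (cons (tl (hd (var zero))) (tl (var zero))) (runs xs e))
                         (tl (var zero)))))

    eP = proj₁ P.time-bounded
    eQ = proj₁ Q.time-bounded
    eS = proj₁ size

    M : ℕ → ℕ
    -- 18 counts the evaluation steps of one round outside `b`, `g` and the recursion. `N ^ eP` pays
    -- for `b`, and `N + N ^ eS` bounds the argument of `g`, which contains an intermediate result.
    M N = 18 + (N ^ eP + (N + N ^ eS) ^ eQ)

    time-nil : ∀ e N → suc ∥ e ∥ ≤ N → time nil e ≤ M N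
    time-nil e N e≤N = +-mono-≤ {6} {18} (s≤s (s≤s (s≤s (s≤s (s≤s (s≤s z≤n))))))
      (≤-trans (proj₂ P.time-bounded e) (≤-trans (^-monoˡ-≤ eP e≤N) (m≤m+n _ _)))

    time-≤ : ∀ xs e N → suc ∥ xs ∙ e ∥ ≤ N → time xs e ≤ ∥ xs ∥ * M N
    time-≤ nil e N le = ≤-trans (time-nil e N (≤-trans (s≤s (m≤n+m ∥ e ∥ 2)) le))
                                (≤-reflexive (sym (+-identityʳ (M N))))
    time-≤ (x ∙ xs) e N le = begin
      3 + (1 + (4 + (1 + (7 + time xs e) + 2)) + Q.time y)
        ≡⟨ rearrange (time xs e) (Q.time y) ⟩
      (18 + Q.time y) + time xs e
        ≤⟨ +-mono-≤ (+-monoʳ-≤ 18 (≤-trans Q≤ (m≤n+m _ (N ^ eP)))) (time-≤ xs e N le′) ⟩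
      M N + ∥ xs ∥ * M N
        ≤⟨ *-monoˡ-≤ (M N) (s≤s (m≤n+m (∥ xs ∥) (∥ x ∥))) ⟩
      ∥ x ∙ xs ∥ * M N ∎
      where
      open ≤-Reasoning
      rec = fold b g xs e
      y   = x ∙ (rec ∙ e)
      rearrange : ∀ a c → 3 + (1 + (4 + (1 + (7 + a) + 2)) + c) ≡ (18 + c) + a
      rearrange = solve-∀
      le′ : suc ∥ xs ∙ e ∥ ≤ N
      le′ = ≤-trans (s≤s (s≤s (+-monoˡ-≤ ∥ e ∥ (m≤n⇒m≤1+n (m≤n+m (∥ xs ∥) (∥ x ∥)))))) le
      rec≤ : suc ∥ rec ∥ ≤ N ^ eS
      rec≤ = ≤-trans (proj₂ size (xs ∙ e)) (^-monoˡ-≤ eS le′)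
      split : ∀ a c d → suc (suc (a + suc (c + d))) ≡ 2 + a + d + suc c
      split = solve-∀
      rest≤ : 2 + ∥ x ∥ + ∥ e ∥ ≤ N
      rest≤ = ≤-trans (s≤s (s≤s (+-monoˡ-≤ ∥ e ∥ (m≤n⇒m≤1+n (m≤m+n (∥ x ∥) (∥ xs ∥)))))) le
      Q≤ : Q.time y ≤ (N + N ^ eS) ^ eQ
      Q≤ = ≤-trans (proj₂ Q.time-bounded y) (^-monoˡ-≤ eQ
        (≤-trans (≤-reflexive (split (∥ x ∥) (∥ rec ∥) (∥ e ∥))) (+-mono-≤ rest≤ rec≤)))

  poly-fold : Poly (λ z → fold b g (head′ z) (tail′ z))
  poly-fold = record
    { funs         = funs
    ; body         = body
    ; entry        = zero
    ; time         = λ z → time (head′ z) (tail′ z)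
    ; runs         = λ { nil → ifNo (hd (var zero)) (callP (tl (var zero)))
                       ; (xs ∙ e) → runs xs e }
    ; time-bounded = bounded-≤ total (bounded-* bounded-size (bounded-+ (bounded-const 18)
        (bounded-+ (bounded-^ eP bounded-size)
                   (bounded-^ eQ (bounded-+ bounded-size (bounded-^ eS bounded-size))))))
    ; size-bounded = size
    }
    where
    total : ∀ z → time (head′ z) (tail′ z) ≤ suc ∥ z ∥ * M (suc ∥ z ∥)
    total nil      = ≤-trans (time-nil nil 2 ≤-refl) (m≤m+n (M 2) _)
    total (xs ∙ e) = ≤-trans (time-≤ xs e _ ≤-refl)
      (*-monoˡ-≤ (M _) (m≤n⇒m≤1+n (m≤n⇒m≤1+n (m≤m+n (∥ xs ∥) (∥ e ∥)))))

-- List operations on trees and their sizes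

appendᵗ : Tree → Tree → Tree
appendᵗ nil      ys = ys
appendᵗ (x ∙ xs) ys = x ∙ appendᵗ xs ys

-- Serves for access to the entries of a list and, on unary numbers, as truncated subtraction, from
-- which comparison is obtained.
dropᵗ : Tree → Tree → Tree
dropᵗ nil      ys = ys
dropᵗ (_ ∙ xs) ys = tail′ (dropᵗ xs ys)

flatMapᵗ : (Tree → Tree) → Tree → Tree
flatMapᵗ f nil      = nil
flatMapᵗ f (x ∙ xs) = appendᵗ (f x) (flatMapᵗ f xs)

sucsᵗ : Tree → Tree
sucsᵗ nil      = nil
sucsᵗ (x ∙ xs) = (nil ∙ x) ∙ sucsᵗ xs

indicesᵗ : Tree → Tree
indicesᵗ nil      = nil
indicesᵗ (_ ∙ xs) = nil ∙ sucsᵗ (indicesᵗ xs)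

-- Read as a number, a tree stands for the length of its right spine; thus a list serves as the
-- number of its elements.
spine : Tree → ℕ
spine nil      = 0
spine (_ ∙ xs) = suc (spine xs)

-- In a fold, the step gets x ∙ (acc ∙ e).
private
  poly-x : Poly head′
  poly-x = poly-hd
  poly-acc : Poly (λ z → head′ (tail′ z))
  poly-acc = poly-∘ poly-tl poly-hd
  poly-e : Poly (λ z → tail′ (tail′ z))
  poly-e = poly-∘ poly-tl poly-tl

-- Two equations identify a directly recursive `h` with a fold, so the operations on trees keep
-- their plain recursive definitions.
poly-fold-≗ : ∀ {b g} (h : Tree → Tree → Tree) → Poly b → Poly g →
              (∀ e → b e ≡ h nil e) →
              (∀ x xs e → g (x ∙ (h xs e ∙ e)) ≡ h (x ∙ xs) e) →
              Bounded (λ z → suc ∥ h (head′ z) (tail′ z) ∥) →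
              Poly (λ z → h (head′ z) (tail′ z))
poly-fold-≗ {b} {g} h p q on-nil on-cons size =
  poly-≗ (λ z → fold≡h (head′ z) (tail′ z))
    (poly-fold p q (bounded-≤ (λ z → ≤-reflexive (cong (suc ∘ ∥_∥) (fold≡h (head′ z) (tail′ z)))) size))
  where
  fold≡h : ∀ xs e → fold b g xs e ≡ h xs e
  fold≡h nil      e = on-nil e
  fold≡h (x ∙ xs) e rewrite fold≡h xs e = on-cons x xs e

∥append∥ : ∀ xs ys → suc ∥ appendᵗ xs ys ∥ ≤ ∥ xs ∥ + ∥ ys ∥
∥append∥ nil      ys = ≤-refl
∥append∥ (x ∙ xs) ys = s≤s (begin
  suc (∥ x ∥ + ∥ appendᵗ xs ys ∥) ≡⟨ +-suc ∥ x ∥ _ ⟨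
  ∥ x ∥ + suc ∥ appendᵗ xs ys ∥   ≤⟨ +-monoʳ-≤ ∥ x ∥ (∥append∥ xs ys) ⟩
  ∥ x ∥ + (∥ xs ∥ + ∥ ys ∥)       ≡⟨ +-assoc ∥ x ∥ _ _ ⟨
  ∥ x ∥ + ∥ xs ∥ + ∥ ys ∥         ∎)
  where open ≤-Reasoning

poly-append : Poly (λ z → appendᵗ (head′ z) (tail′ z))
poly-append = poly-fold-≗ appendᵗ poly-id (poly-pair poly-x poly-acc)
  (λ _ → refl) (λ _ _ _ → refl)
  (bounded-≤ (λ z → ≤-trans (∥append∥ (head′ z) (tail′ z))
                       (+-mono-≤ (m≤n⇒m≤1+n (∥head′∥≤ z)) (m≤n⇒m≤1+n (∥tail′∥≤ z))))
             (bounded-+ bounded-size bounded-size))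

∥drop∥ : ∀ xs ys → ∥ dropᵗ xs ys ∥ ≤ ∥ ys ∥
∥drop∥ nil      ys = ≤-refl
∥drop∥ (x ∙ xs) ys = ≤-trans (∥tail′∥≤ (dropᵗ xs ys)) (∥drop∥ xs ys)

poly-drop : Poly (λ z → dropᵗ (head′ z) (tail′ z))
poly-drop = poly-fold-≗ dropᵗ poly-id (poly-∘ poly-acc poly-tl) (λ _ → refl) (λ _ _ _ → refl)
  (bounded-≤ (λ z → s≤s (≤-trans (∥drop∥ (head′ z) (tail′ z)) (∥tail′∥≤ z))) bounded-size)

poly-flatMap : ∀ {g} → Poly g → Poly (λ z → flatMapᵗ (λ x → g (x ∙ tail′ z)) (head′ z))
poly-flatMap {g} q = poly-fold-≗ (λ xs e → flatMapᵗ (λ x → g (x ∙ e)) xs) poly-nil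
  (poly-∘ (poly-pair (poly-∘ (poly-pair poly-x poly-e) q) poly-acc) poly-append)
  (λ _ → refl) (λ _ _ _ → refl)
  (bounded-≤ total (bounded-+ (bounded-const 1)
                             (bounded-* bounded-size (bounded-+ (bounded-const 1) (bounded-^ a bounded-size)))))
  where
  open ≤-Reasoning
  a = proj₁ (Poly.size-bounded q)
  size : ∀ xs e N → suc ∥ xs ∙ e ∥ ≤ N → ∥ flatMapᵗ (λ x → g (x ∙ e)) xs ∥ ≤ ∥ xs ∥ * suc (N ^ a)
  size nil      e N le = s≤s z≤n
  size (x ∙ xs) e N le = begin
    ∥ appendᵗ (g (x ∙ e)) ys ∥              ≤⟨ n≤1+n _ ⟩
    suc ∥ appendᵗ (g (x ∙ e)) ys ∥          ≤⟨ ∥append∥ (g (x ∙ e)) ys ⟩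
    ∥ g (x ∙ e) ∥ + ∥ ys ∥                  ≤⟨ +-mono-≤ g≤ (size xs e N
                                                 (≤-trans (s≤s (s≤s (+-monoˡ-≤ ∥ e ∥ (m≤n⇒m≤1+n (m≤n+m (∥ xs ∥) (∥ x ∥)))))) le)) ⟩
    suc (N ^ a) + ∥ xs ∥ * suc (N ^ a)      ≤⟨ *-monoˡ-≤ (suc (N ^ a)) (s≤s (m≤n+m (∥ xs ∥) (∥ x ∥))) ⟩
    ∥ x ∙ xs ∥ * suc (N ^ a)                ∎
    where
    ys = flatMapᵗ (λ x → g (x ∙ e)) xs
    g≤ : ∥ g (x ∙ e) ∥ ≤ suc (N ^ a)
    g≤ = m≤n⇒m≤1+n (≤-trans (n≤1+n _) (≤-trans (proj₂ (Poly.size-bounded q) (x ∙ e)) (^-monoˡ-≤ a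
          (≤-trans (s≤s (s≤s (+-monoˡ-≤ ∥ e ∥ (m≤n⇒m≤1+n (m≤m+n (∥ x ∥) (∥ xs ∥)))))) le))))
  total : ∀ z → suc ∥ flatMapᵗ (λ x → g (x ∙ tail′ z)) (head′ z) ∥ ≤
                1 + suc ∥ z ∥ * (1 + suc ∥ z ∥ ^ a)
  total nil      = s≤s (s≤s z≤n)
  total (xs ∙ e) = s≤s (≤-trans (size xs e _ ≤-refl)
    (*-monoˡ-≤ _ (m≤n⇒m≤1+n (m≤n⇒m≤1+n (m≤m+n (∥ xs ∥) (∥ e ∥))))))

∥sucs∥ : ∀ xs → ∥ sucsᵗ xs ∥ ≡ ∥ xs ∥ + 2 * spine xs
∥sucs∥ nil      = refl
∥sucs∥ (x ∙ xs) rewrite ∥sucs∥ xs = arith (∥ x ∥) (∥ xs ∥) (spine xs)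
  where
  arith : ∀ a b c → suc (suc (suc a) + (b + 2 * c)) ≡ suc (a + b) + 2 * suc c
  arith = solve-∀

spine-sucs : ∀ xs → spine (sucsᵗ xs) ≡ spine xs
spine-sucs nil      = refl
spine-sucs (x ∙ xs) = cong suc (spine-sucs xs)

spine-indices : ∀ xs → spine (indicesᵗ xs) ≡ spine xs
spine-indices nil      = refl
spine-indices (x ∙ xs) = cong suc (trans (spine-sucs (indicesᵗ xs)) (spine-indices xs))

2*spine< : ∀ xs → 2 * spine xs < ∥ xs ∥
2*spine< nil      = s≤s z≤n
2*spine< (x ∙ xs) = begin-strict
  2 * suc (spine xs)   ≡⟨ *-suc 2 (spine xs) ⟩
  2 + 2 * spine xs     <⟨ +-monoʳ-< 2 (2*spine< xs) ⟩
  2 + ∥ xs ∥           ≤⟨ s≤s (+-monoˡ-≤ ∥ xs ∥ (∥∥>0 x)) ⟩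
  ∥ x ∙ xs ∥           ∎
  where open ≤-Reasoning

∥indices∥ : ∀ xs → ∥ indicesᵗ xs ∥ ≤ ∥ xs ∥ * ∥ xs ∥
∥indices∥ nil      = ≤-refl
∥indices∥ (x ∙ xs) = begin
  2 + ∥ sucsᵗ (indicesᵗ xs) ∥                    ≡⟨ cong (2 +_) (∥sucs∥ (indicesᵗ xs)) ⟩
  2 + (∥ indicesᵗ xs ∥ + 2 * spine (indicesᵗ xs))
    ≡⟨ cong (λ l → 2 + (∥ indicesᵗ xs ∥ + 2 * l)) (spine-indices xs) ⟩
  2 + (∥ indicesᵗ xs ∥ + 2 * spine xs)           ≤⟨ +-monoʳ-≤ 2 (+-mono-≤ (∥indices∥ xs) (<⇒≤ (2*spine< xs))) ⟩
  -- `2 + 3 * n` completes the square of `2 + n`.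
  2 + (n * n + n)                                ≤⟨ m≤m+n _ (2 + 3 * n) ⟩
  2 + (n * n + n) + (2 + 3 * n)                  ≡⟨ square n ⟩
  (2 + n) * (2 + n)                              ≤⟨ *-mono-≤ 2+n≤ 2+n≤ ⟩
  ∥ x ∙ xs ∥ * ∥ x ∙ xs ∥                        ∎
  where
  open ≤-Reasoning
  n = ∥ xs ∥
  square : ∀ n → 2 + (n * n + n) + (2 + 3 * n) ≡ (2 + n) * (2 + n)
  square = solve-∀
  2+n≤ : 2 + n ≤ ∥ x ∙ xs ∥
  2+n≤ = s≤s (+-monoˡ-≤ n (∥∥>0 x))

poly-sucs : Poly (sucsᵗ ∘ head′)
poly-sucs = poly-fold-≗ (λ xs _ → sucsᵗ xs) poly-nil
  (poly-pair (poly-pair poly-nil poly-x) poly-acc) (λ _ → refl) (λ _ _ _ → refl)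
  (bounded-≤ (λ z → total z (head′ z) (∥head′∥≤ z)) (bounded-+ bounded-size bounded-size))
  where
  total : ∀ z xs → ∥ xs ∥ ≤ ∥ z ∥ → suc ∥ sucsᵗ xs ∥ ≤ suc ∥ z ∥ + suc ∥ z ∥
  total z xs le rewrite ∥sucs∥ xs =
    s≤s (+-mono-≤ le (m≤n⇒m≤1+n (≤-trans (<⇒≤ (2*spine< xs)) le)))

poly-indices : Poly (indicesᵗ ∘ head′)
poly-indices = poly-fold-≗ (λ xs _ → indicesᵗ xs) poly-nil
  (poly-pair poly-nil (poly-∘ (poly-pair poly-acc poly-nil) poly-sucs))
  (λ _ → refl) (λ _ _ _ → refl)
  (bounded-≤ total (bounded-+ (bounded-const 1) (bounded-* bounded-size bounded-size)))
  where
  total : ∀ z → suc ∥ indicesᵗ (head′ z) ∥ ≤ 1 + suc ∥ z ∥ * suc ∥ z ∥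
  total z = s≤s (≤-trans (∥indices∥ (head′ z)) (*-mono-≤ (m≤n⇒m≤1+n (∥head′∥≤ z)) (m≤n⇒m≤1+n (∥head′∥≤ z))))

-- A term language for polynomial time

data Tm (n : ℕ) : Set where
  var     : Fin n → Tm n
  nil     : Tm n
  cons    : Tm n → Tm n → Tm n
  hd      : Tm n → Tm n
  tl      : Tm n → Tm n
  if      : Tm n → Tm n → Tm n → Tm n
  let′    : Tm n → Tm (suc n) → Tm n
  flatMap : Tm n → Tm (suc n) → Tm n
  drop    : Tm n → Tm n → Tm n
  indices : Tm n → Tm n

⟦_⟧ : ∀ {n} → Tm n → Vec Tree n → Tree
⟦ var x ⟧       ρ = Vec.lookup ρ x
⟦ nil ⟧         ρ = nil
⟦ cons t u ⟧    ρ = ⟦ t ⟧ ρ ∙ ⟦ u ⟧ ρ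
⟦ hd t ⟧        ρ = head′ (⟦ t ⟧ ρ)
⟦ tl t ⟧        ρ = tail′ (⟦ t ⟧ ρ)
⟦ if t u v ⟧    ρ = cond (⟦ t ⟧ ρ) (⟦ u ⟧ ρ) (⟦ v ⟧ ρ)
⟦ let′ t u ⟧    ρ = ⟦ u ⟧ (⟦ t ⟧ ρ ∷ ρ)
⟦ flatMap t u ⟧ ρ = flatMapᵗ (λ x → ⟦ u ⟧ (x ∷ ρ)) (⟦ t ⟧ ρ)
⟦ drop t u ⟧    ρ = dropᵗ (⟦ t ⟧ ρ) (⟦ u ⟧ ρ)
⟦ indices t ⟧   ρ = indicesᵗ (⟦ t ⟧ ρ)

-- The functions of a program are unary, so an environment travels as one tree.
unpack : ∀ n → Tree → Vec Tree n
unpack zero    z = []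
unpack (suc n) z = head′ z ∷ unpack n (tail′ z)

poly-lookup : ∀ {n} (x : Fin n) → Poly (λ z → Vec.lookup (unpack n z) x)
poly-lookup zero    = poly-hd
poly-lookup (suc x) = poly-∘ poly-tl (poly-lookup x)

-- The only loop with a body is `flatMap`, whose rounds do not see each other's results: outputs are
-- concatenated, never fed back. Hence sizes stay polynomial under nesting.
poly-Tm : ∀ {n} (t : Tm n) → Poly (λ z → ⟦ t ⟧ (unpack n z))
poly-Tm (var x)       = poly-lookup x
poly-Tm nil           = poly-nil
poly-Tm (cons t u)    = poly-pair (poly-Tm t) (poly-Tm u)
poly-Tm (hd t)        = poly-∘ (poly-Tm t) poly-hd
poly-Tm (tl t)        = poly-∘ (poly-Tm t) poly-tl
poly-Tm (if t u v)    = poly-cond (poly-Tm t) (poly-Tm u) (poly-Tm v)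
poly-Tm (let′ t u)    = poly-∘ (poly-pair (poly-Tm t) poly-id) (poly-Tm u)
poly-Tm (flatMap t u) = poly-∘ (poly-pair (poly-Tm t) poly-id) (poly-flatMap (poly-Tm u))
poly-Tm (drop t u)    = poly-∘ (poly-pair (poly-Tm t) (poly-Tm u)) poly-drop
poly-Tm (indices t)   = poly-∘ (poly-pair (poly-Tm t) poly-nil) poly-indices

polyTime-Tm : {A B : Set} (codeA : A → Tree) (codeB : B → Tree) (f : A → B) (t : Tm 1) →
              (∀ x → ⟦ t ⟧ (codeA x ∷ []) ≡ codeB (f x)) → PolyTime codeA codeB f
polyTime-Tm codeA codeB f t correct =
  record { funs = funs ; body = body ; main = Vec.lookup body entry } ,
  -- `suc ∥ x ∥ ≤ 2 * ∥ x ∥` turns the base `suc ∥ x ∥` into `∥ x ∥` at the price of the factor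
  -- `2 ^ e`.
  2 ^ e , e , λ x →
    time (codeA x) ,
    subst (λ v → Eval body _ _ v (time (codeA x))) (correct x) (runs (codeA x)) ,
    ≤-trans (proj₂ time-bounded (codeA x)) (size≤ (codeA x))
  where
  open Poly (poly-∘ (poly-pair poly-id poly-nil) (poly-Tm t))
  e = proj₁ time-bounded
  open ≤-Reasoning
  size≤ : ∀ x → suc ∥ x ∥ ^ e ≤ 2 ^ e * ∥ x ∥ ^ e
  size≤ x = begin
    suc ∥ x ∥ ^ e         ≤⟨ ^-monoˡ-≤ e (+-monoˡ-≤ ∥ x ∥ (∥∥>0 x)) ⟩
    (∥ x ∥ + ∥ x ∥) ^ e   ≡⟨ cong (λ m → (∥ x ∥ + m) ^ e) (+-identityʳ ∥ x ∥) ⟨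
    (2 * ∥ x ∥) ^ e       ≡⟨ *-^ 2 (∥ x ∥) e ⟩
    2 ^ e * ∥ x ∥ ^ e     ∎

-- The reduction as a program

isCons : Tree → Bool
isCons nil     = false
isCons (_ ∙ _) = true

appendᵗ-nil : ∀ x → appendᵗ x nil ≡ x
appendᵗ-nil nil      = refl
appendᵗ-nil (x ∙ xs) = cong (x ∙_) (appendᵗ-nil xs)

spine-append : ∀ x y → spine (appendᵗ x y) ≡ spine x + spine y
spine-append nil      y = refl
spine-append (_ ∙ xs) y = cong suc (spine-append xs y)

spine-tail : ∀ x → spine (tail′ x) ≡ spine x ∸ 1
spine-tail nil     = refl
spine-tail (_ ∙ _) = refl

spine-drop : ∀ x y → spine (dropᵗ x y) ≡ spine y ∸ spine x
spine-drop nil      y = refl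
spine-drop (_ ∙ xs) y = begin
  spine (tail′ (dropᵗ xs y))   ≡⟨ spine-tail (dropᵗ xs y) ⟩
  spine (dropᵗ xs y) ∸ 1       ≡⟨ cong (_∸ 1) (spine-drop xs y) ⟩
  spine y ∸ spine xs ∸ 1       ≡⟨ ∸-+-assoc (spine y) (spine xs) 1 ⟩
  spine y ∸ (spine xs + 1)     ≡⟨ cong (spine y ∸_) (+-comm (spine xs) 1) ⟩
  spine y ∸ suc (spine xs)     ∎
  where open ≡-Reasoning

spine-flatMap : ∀ {f l} → (∀ x → spine (f x) ≡ l) → ∀ x → spine (flatMapᵗ f x) ≡ spine x * l
spine-flatMap eq nil      = refl
spine-flatMap {f} eq (x ∙ xs) =
  trans (spine-append (f x) (flatMapᵗ f xs)) (cong₂ _+_ (eq x) (spine-flatMap eq xs))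

spine-codeℕ : ∀ n → spine (codeℕ n) ≡ n
spine-codeℕ zero    = refl
spine-codeℕ (suc n) = cong suc (spine-codeℕ n)

drop-tail : ∀ x y → tail′ (dropᵗ x y) ≡ dropᵗ x (tail′ y)
drop-tail nil      y = refl
drop-tail (_ ∙ xs) y = cong tail′ (drop-tail xs y)

module _ {A : Set} (c : A → Tree) where
  spine-codeList : ∀ xs → spine (codeList c xs) ≡ length xs
  spine-codeList []       = refl
  spine-codeList (x ∷ xs) = cong suc (spine-codeList xs)

  codeList-++ : ∀ xs ys → appendᵗ (codeList c xs) (codeList c ys) ≡ codeList c (xs ++ ys)
  codeList-++ []       ys = refl
  codeList-++ (x ∷ xs) ys = cong (c x ∙_) (codeList-++ xs ys)

  codeList-map : ∀ {B : Set} (f : B → A) xs → codeList (c ∘ f) xs ≡ codeList c (map f xs)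
  codeList-map f []       = refl
  codeList-map f (x ∷ xs) = cong (c (f x) ∙_) (codeList-map f xs)

  codeList-flatMap : ∀ {B : Set} (c′ : B → Tree) (f : A → List B) (g : Tree → Tree) →
    (∀ x → g (c x) ≡ codeList c′ (f x)) →
    ∀ xs → flatMapᵗ g (codeList c xs) ≡ codeList c′ (concatMap f xs)
  codeList-flatMap c′ f g eq []       = refl
  codeList-flatMap c′ f g eq (x ∷ xs) rewrite eq x | codeList-flatMap c′ f g eq xs = go (f x)
    where
    go : ∀ ys → appendᵗ (codeList c′ ys) (codeList c′ (concatMap f xs)) ≡
                codeList c′ (ys ++ concatMap f xs)
    go []       = refl
    go (y ∷ ys) = cong (c′ y ∙_) (go ys)

  drop-lookup : ∀ {n} (f : Fin n → A) i → head′ (dropᵗ (codeℕ (toℕ i)) (codeList c (tabulate f))) ≡ c (f i)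
  drop-lookup f zero    = refl
  drop-lookup f (suc i) = trans (cong head′ (drop-tail (codeℕ (toℕ i)) (codeList c (tabulate f))))
                                (drop-lookup (f ∘ suc) i)

sucs-code : ∀ xs → sucsᵗ (codeList codeℕ xs) ≡ codeList codeℕ (map suc xs)
sucs-code []       = refl
sucs-code (x ∷ xs) = cong (codeℕ (suc x) ∙_) (sucs-code xs)

indices-code : ∀ x → indicesᵗ x ≡ codeList codeℕ (upTo (spine x))
indices-code nil      = refl
indices-code (_ ∙ xs) = cong (nil ∙_) (begin
  sucsᵗ (indicesᵗ xs)                          ≡⟨ cong sucsᵗ (indices-code xs) ⟩
  sucsᵗ (codeList codeℕ (upTo (spine xs)))     ≡⟨ sucs-code (upTo (spine xs)) ⟩
  codeList codeℕ (map suc (upTo (spine xs)))   ≡⟨ cong (codeList codeℕ) (map-upTo suc (spine xs)) ⟩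
  codeList codeℕ (applyUpTo suc (spine xs))    ∎)
  where open ≡-Reasoning

tabulate-toℕ : ∀ n {A : Set} (f : ℕ → A) → tabulate {n = n} (f ∘ toℕ) ≡ applyUpTo f n
tabulate-toℕ zero    f = refl
tabulate-toℕ (suc n) f = cong (f 0 ∷_) (tabulate-toℕ n (f ∘ suc))

codeFin : ∀ {n} → Fin n → Tree
codeFin = codeℕ ∘ toℕ

indices-allFin : ∀ {n} x → spine x ≡ n → indicesᵗ x ≡ codeList codeFin (allFin n)
indices-allFin x refl = trans (indices-code x) (sym (trans (codeList-map codeℕ toℕ (allFin (spine x)))
  (cong (codeList codeℕ) (trans (map-tabulate id toℕ) (tabulate-toℕ (spine x) id)))))

codePair : {A B : Set} → (A → Tree) → (B → Tree) → A × B → Tree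
codePair c c′ (a , b) = c a ∙ c′ b

quoteT : ∀ {m} → Tree → Tm m
quoteT nil     = nil
quoteT (s ∙ t) = cons (quoteT s) (quoteT t)

⟦quoteT⟧ : ∀ {m} (ρ : Vec Tree m) x → ⟦ quoteT x ⟧ ρ ≡ x
⟦quoteT⟧ ρ nil     = refl
⟦quoteT⟧ ρ (s ∙ t) = cong₂ _∙_ (⟦quoteT⟧ ρ s) (⟦quoteT⟧ ρ t)

-- Derived terms and what they compute

private variable
  m : ℕ

pattern v0 = var zero
pattern v1 = var (suc zero)

notT : Tm m → Tm m
notT t = if t nil (cons nil nil)

andT orT impT : Tm m → Tm m → Tm m
andT t u = if t u nil
orT  t u = if t (cons nil nil) u
impT t u = if t u (cons nil nil)

filterT mapT : Tm m → Tm (suc m) → Tm m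
filterT t u = flatMap t (if u (cons v0 nil) nil)
mapT    t u = flatMap t (cons u nil)

pairsT : Tm m → Tm (suc m) → Tm m
pairsT t u = flatMap t (mapT u (cons v1 v0))

appendT : Tm m → Tm m → Tm m
appendT t u = flatMap (cons t (cons u nil)) v0

-- Numbers are lengths: a `flatMap` whose rounds all yield `b` elements multiplies the length by
-- `b`.
mulT : Tm m → Tm (suc m) → Tm m
mulT = flatMap

leT eqT : Tm m → Tm m → Tm m
leT t u = notT (drop u t)
eqT t u = andT (leT t u) (leT u t)

-- A value has three readings: nonempty or not here, its length in `Size`, the exact list in
-- `Lists`. The records keep `ρ` and `t` visible to unification, where the bare statements would
-- reduce.
record Truth {m} (ρ : Vec Tree m) (t : Tm m) (P : Set) : Set where
  constructor ⟪_⟫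
  field reflects : Reflects P (isCons (⟦ t ⟧ ρ))
open Truth

record Size {m} (ρ : Vec Tree m) (t : Tm m) (n : ℕ) : Set where
  constructor ⟪_⟫
  field spine≡ : spine (⟦ t ⟧ ρ) ≡ n
open Size

record Lists {m} (ρ : Vec Tree m) (t : Tm m) {A : Set} (c : A → Tree) (xs : List A) : Set where
  constructor ⟪_⟫
  field value : ⟦ t ⟧ ρ ≡ codeList c xs
open Lists

module _ {m} {ρ : Vec Tree m} where

  truth-⇔ : ∀ {P Q t} → (P ⇔ Q) → Truth ρ t P → Truth ρ t Q
  truth-⇔ {t = t} e ⟪ r ⟫ with isCons (⟦ t ⟧ ρ) in eq | r
  ... | false | ofⁿ ¬p = ⟪ subst (Reflects _) (sym eq) (ofⁿ (¬p ∘ from e)) ⟫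
  ... | true  | ofʸ p  = ⟪ subst (Reflects _) (sym eq) (ofʸ (to e p)) ⟫

  truth-not : ∀ {P t} → Truth ρ t P → Truth ρ (notT t) (¬ P)
  truth-not {P} {t} ⟪ r ⟫ = ⟪ go (⟦ t ⟧ ρ) r ⟫
    where
    go : ∀ x → Reflects P (isCons x) → Reflects (¬ P) (isCons (cond x nil (nil ∙ nil)))
    go nil     (ofⁿ ¬p) = ofʸ ¬p
    go (_ ∙ _) (ofʸ p)  = ofⁿ (λ ¬p → ¬p p)

  truth-and : ∀ {P Q t u} → Truth ρ t P → Truth ρ u Q → Truth ρ (andT t u) (P × Q)
  truth-and {P} {Q} {t} {u} ⟪ r ⟫ ⟪ r′ ⟫ = ⟪ go (⟦ t ⟧ ρ) (⟦ u ⟧ ρ) r r′ ⟫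
    where
    go : ∀ x y → Reflects P (isCons x) → Reflects Q (isCons y) → Reflects (P × Q) (isCons (cond x y nil))
    go nil     _       (ofⁿ ¬p) _        = ofⁿ (¬p ∘ proj₁)
    go (_ ∙ _) nil     (ofʸ p)  (ofⁿ ¬q) = ofⁿ (¬q ∘ proj₂)
    go (_ ∙ _) (_ ∙ _) (ofʸ p)  (ofʸ q)  = ofʸ (p , q)

  truth-or : ∀ {P Q t u} → Truth ρ t P → Truth ρ u Q → Truth ρ (orT t u) (P ⊎ Q)
  truth-or {P} {Q} {t} {u} ⟪ r ⟫ ⟪ r′ ⟫ = ⟪ go (⟦ t ⟧ ρ) (⟦ u ⟧ ρ) r r′ ⟫
    where
    go : ∀ x y → Reflects P (isCons x) → Reflects Q (isCons y) →
         Reflects (P ⊎ Q) (isCons (cond x (nil ∙ nil) y))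
    go (_ ∙ _) _       (ofʸ p)  _        = ofʸ (inj₁ p)
    go nil     (_ ∙ _) (ofⁿ ¬p) (ofʸ q)  = ofʸ (inj₂ q)
    go nil     nil     (ofⁿ ¬p) (ofⁿ ¬q) = ofⁿ λ { (inj₁ p) → ¬p p ; (inj₂ q) → ¬q q }

  truth-imp : ∀ {P Q t u} → Truth ρ t P → Truth ρ u Q → Truth ρ (impT t u) (P → Q)
  truth-imp {P} {Q} {t} {u} ⟪ r ⟫ ⟪ r′ ⟫ = ⟪ go (⟦ t ⟧ ρ) (⟦ u ⟧ ρ) r r′ ⟫
    where
    go : ∀ x y → Reflects P (isCons x) → Reflects Q (isCons y) →
         Reflects (P → Q) (isCons (cond x y (nil ∙ nil)))
    go nil     _       (ofⁿ ¬p) _        = ofʸ (λ p → ⊥-elim (¬p p))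
    go (_ ∙ _) (_ ∙ _) (ofʸ p)  (ofʸ q)  = ofʸ (λ _ → q)
    go (_ ∙ _) nil     (ofʸ p)  (ofⁿ ¬q) = ofⁿ (λ f → ¬q (f p))

  truth-let : ∀ {P t u} → Truth (⟦ t ⟧ ρ ∷ ρ) u P → Truth ρ (let′ t u) P
  truth-let ⟪ r ⟫ = ⟪ r ⟫

  truth-then : ∀ {P t u v x y} → ⟦ t ⟧ ρ ≡ x ∙ y → Truth ρ u P → Truth ρ (if t u v) P
  truth-then {P} {u = u} {v} eq ⟪ r ⟫ =
    ⟪ subst (λ x → Reflects P (isCons (cond x (⟦ u ⟧ ρ) (⟦ v ⟧ ρ)))) (sym eq) r ⟫

  truth-else : ∀ {P t u v} → ⟦ t ⟧ ρ ≡ nil → Truth ρ v P → Truth ρ (if t u v) P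
  truth-else {P} {u = u} {v} eq ⟪ r ⟫ =
    ⟪ subst (λ x → Reflects P (isCons (cond x (⟦ u ⟧ ρ) (⟦ v ⟧ ρ)))) (sym eq) r ⟫

  truth-nil : Truth ρ nil ⊥
  truth-nil = ⟪ ofⁿ (λ ()) ⟫

  ⟦if⟧ : ∀ {P t u v} {A : Set} → Truth ρ t P → (P? : Dec P) → (code : A → Tree) → ∀ {a b} →
         ⟦ u ⟧ ρ ≡ code a → ⟦ v ⟧ ρ ≡ code b → ⟦ if t u v ⟧ ρ ≡ code (if does P? then a else b)
  ⟦if⟧ {P} {t} {u} {v} ⟪ r ⟫ P? code {a} {b} p q = go (⟦ t ⟧ ρ) r P?
    where
    go : ∀ x → Reflects P (isCons x) → (P? : Dec P) →
         cond x (⟦ u ⟧ ρ) (⟦ v ⟧ ρ) ≡ code (if does P? then a else b)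
    go nil     (ofⁿ ¬p) (yes p) = ⊥-elim (¬p p)
    go nil     (ofⁿ ¬p) (no _)  = q
    go (_ ∙ _) (ofʸ _)  (yes _) = p
    go (_ ∙ _) (ofʸ p)  (no ¬p) = ⊥-elim (¬p p)

  list-map : ∀ {A B : Set} {c : A → Tree} (c′ : B → Tree) {t u xs} (f : A → B) → Lists ρ t c xs →
             (∀ x → ⟦ u ⟧ (c x ∷ ρ) ≡ c′ (f x)) → Lists ρ (mapT t u) c′ (map f xs)
  list-map {c = c} c′ {t} {u} {xs} f ⟪ eq ⟫ h = ⟪ trans (cong (flatMapᵗ _) eq) (go xs) ⟫
    where
    go : ∀ xs → flatMapᵗ (λ x → ⟦ u ⟧ (x ∷ ρ) ∙ nil) (codeList c xs) ≡ codeList c′ (map f xs)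
    go []       = refl
    go (x ∷ xs) = cong₂ _∙_ (h x) (go xs)

  list-filter : ∀ {A : Set} {c : A → Tree} {P : A → Set} {t u xs} (P? : Decidable P) → Lists ρ t c xs →
                (∀ x → Truth (c x ∷ ρ) u (P x)) → Lists ρ (filterT t u) c (filter P? xs)
  list-filter {c = c} {t = t} {u} {xs} P? ⟪ eq ⟫ h = ⟪ trans (cong (flatMapᵗ _) eq) (go xs) ⟫
    where
    go : ∀ xs → flatMapᵗ (λ x → cond (⟦ u ⟧ (x ∷ ρ)) (x ∙ nil) nil) (codeList c xs) ≡ codeList c (filter P? xs)
    go []       = refl
    go (x ∷ xs) with ⟦ u ⟧ (c x ∷ ρ) | reflects (h x) | P? x
    ... | nil   | _      | no _  = go xs
    ... | _ ∙ _ | _      | yes _ = cong (c x ∙_) (go xs)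
    ... | nil   | ofⁿ ¬p | yes p = ⊥-elim (¬p p)
    ... | _ ∙ _ | ofʸ p  | no ¬p = ⊥-elim (¬p p)

  list-pairs : ∀ {A B : Set} {c : A → Tree} {c′ : B → Tree} {t u xs} (f : A → List B) → Lists ρ t c xs →
               (∀ x → Lists (c x ∷ ρ) u c′ (f x)) → Lists ρ (pairsT t u) (codePair c c′) (pairs xs f)
  list-pairs {c = c} {c′} {t} {u} {xs} f ⟪ eq ⟫ h = ⟪ trans (cong (flatMapᵗ _) eq)
    (codeList-flatMap c (codePair c c′) (λ x → map (x ,_) (f x)) _ inner xs) ⟫
    where
    inner : ∀ x → flatMapᵗ (λ y → (c x ∙ y) ∙ nil) (⟦ u ⟧ (c x ∷ ρ)) ≡
                  codeList (codePair c c′) (map (x ,_) (f x))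
    inner x = trans (cong (flatMapᵗ _) (value (h x))) (go (f x))
      where
      go : ∀ ys → flatMapᵗ (λ y → (c x ∙ y) ∙ nil) (codeList c′ ys) ≡ codeList (codePair c c′) (map (x ,_) ys)
      go []       = refl
      go (y ∷ ys) = cong (_ ∙_) (go ys)

  ⟦appendT⟧ : ∀ t u → ⟦ appendT t u ⟧ ρ ≡ appendᵗ (⟦ t ⟧ ρ) (⟦ u ⟧ ρ)
  ⟦appendT⟧ t u = cong (appendᵗ (⟦ t ⟧ ρ)) (appendᵗ-nil (⟦ u ⟧ ρ))

  list-append : ∀ {A : Set} {c : A → Tree} {t u xs ys} → Lists ρ t c xs → Lists ρ u c ys →
                Lists ρ (appendT t u) c (xs ++ ys)
  list-append {c = c} {t} {u} {xs} {ys} ⟪ p ⟫ ⟪ q ⟫ =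
    ⟪ trans (⟦appendT⟧ t u) (trans (cong₂ appendᵗ p q) (codeList-++ c xs ys)) ⟫

  list-indices : ∀ {t n} → Size ρ t n → Lists ρ (indices t) codeℕ (upTo n)
  list-indices {t} ⟪ refl ⟫ = ⟪ indices-code (⟦ t ⟧ ρ) ⟫

  size-list : ∀ {A : Set} {c : A → Tree} {t xs} → Lists ρ t c xs → Size ρ t (length xs)
  size-list {c = c} {xs = xs} ⟪ eq ⟫ = ⟪ trans (cong spine eq) (spine-codeList c xs) ⟫

  size-append : ∀ {t u a b} → Size ρ t a → Size ρ u b → Size ρ (appendT t u) (a + b)
  size-append {t} {u} ⟪ p ⟫ ⟪ q ⟫ = ⟪ trans (cong spine (⟦appendT⟧ t u))
    (trans (spine-append (⟦ t ⟧ ρ) (⟦ u ⟧ ρ)) (cong₂ _+_ p q)) ⟫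

  size-mul : ∀ {t u a b} → Size ρ t a → (∀ x → Size (x ∷ ρ) u b) → Size ρ (mulT t u) (a * b)
  size-mul {t} ⟪ refl ⟫ h = ⟪ spine-flatMap (λ x → spine≡ (h x)) (⟦ t ⟧ ρ) ⟫

  size-quote : ∀ n → Size ρ (quoteT (codeℕ n)) n
  size-quote n = ⟪ trans (cong spine (⟦quoteT⟧ ρ (codeℕ n))) (spine-codeℕ n) ⟫

  truth-le : ∀ {t u a b} → Size ρ t a → Size ρ u b → Truth ρ (leT t u) (a ≤ b)
  truth-le {t} {u} ⟪ refl ⟫ ⟪ refl ⟫ = ⟪ go (dropᵗ (⟦ u ⟧ ρ) (⟦ t ⟧ ρ)) (spine-drop (⟦ u ⟧ ρ) (⟦ t ⟧ ρ)) ⟫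
    where
    go : ∀ {a b} x → spine x ≡ a ∸ b → Reflects (a ≤ b) (isCons (cond x nil (nil ∙ nil)))
    go nil     eq = ofʸ (m∸n≡0⇒m≤n (sym eq))
    go (_ ∙ _) eq = ofⁿ λ le → 0≢1+n (trans (sym (m≤n⇒m∸n≡0 le)) (sym eq))

  truth-eq : ∀ {t u a b} → Size ρ t a → Size ρ u b → Truth ρ (eqT t u) (a ≡ b)
  truth-eq p q = truth-⇔ (mk⇔ (λ (le , ge) → ≤-antisym le ge) λ { refl → ≤-refl , ≤-refl })
    (truth-and (truth-le p q) (truth-le q p))

-- The terms of the reduction

inputT graphT kT vertsT : Tm (suc m)
-- The input is the outermost variable, so the term is valid under any number of binders.
inputT = var (fromℕ _)
graphT = hd inputT
kT     = tl inputT
vertsT = indices graphT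

-- A filtered list is nonempty exactly if some vertex passes, so it is its own truth value.
anyT allT : Tm (suc (suc m)) → Tm (suc m)
anyT t = filterT vertsT t
allT t = notT (filterT vertsT (notT t))

adjT nT restT sameT : Fin (suc m) → Fin (suc m) → Tm (suc m)
-- `degT` yields the list of neighbours, which serves both as that list and, by its length, as the
-- degree.
degT minT restVertexT : Fin (suc m) → Tm (suc m)

adjT i j = hd (drop (var j) (hd (drop (var i) graphT)))

sameT i j = eqT (var i) (var j)

nT i j = orT (sameT i j) (adjT i j)

degT i = filterT vertsT (adjT (suc i) zero)

minT i = allT (leT (degT (suc i)) (degT zero))

restT i j = andT (adjT i j)
  (notT (anyT (andT (minT zero) (andT (nT zero (suc i)) (nT zero (suc j))))))

restVertexT i = anyT (restT (suc i) zero)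

restVerticesT dT edgesT clash-freeT goodT 2kT sizeT blocksT paddingT labelsT : Tm (suc m)
restVerticesT = filterT vertsT (restVertexT zero)

dT = hd (mapT (filterT vertsT (minT zero)) (degT zero))

edgesT = pairsT vertsT (degT zero)

clash-freeT = allT (allT (allT (allT
  (impT (inStars u) (impT (inStars u′) (orT (sameT x y) (andT (adjT x y) (nT u u′))))))))
  where
  u u′ x y : Fin (4 + suc m)
  u  = suc (suc (suc zero))
  u′ = suc (suc zero)
  x  = suc zero
  y  = zero
  inStars : Fin (4 + suc m) → Tm (4 + suc m)
  inStars w = andT (minT w) (andT (nT w x) (nT w y))

goodT = andT clash-freeT (andT (leT edgesT (mulT dT (appendT graphT kT)))
  (orT (leT restVerticesT nil) (andT (leT restVerticesT kT) (leT sizeT kT))))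

sizeT = cons nil dT

2kT = mulT (quoteT (codeℕ 2)) kT

blocksT = filterT (indices 2kT) (leT (mulT (cons nil v0) sizeT) 2kT)

paddingT = pairsT blocksT (indices sizeT)

labelsT = appendT (mapT restVerticesT (cons nil v0)) (mapT paddingT (cons (cons nil (hd v0)) (tl v0)))

-- The heads of the two codes tell rest from padding. The tails are bound by `let′` because `restT`
-- takes variables.
edgeT : Fin (suc m) → Fin (suc m) → Tm (suc m)
edgeT i j = let′ (tl (var i)) (let′ (tl (var (suc j)))
  (if (hd (var (suc (suc i))))
      (if (hd (var (suc (suc j))))
          (andT (eqT (hd (var (suc (suc i)))) (hd (var (suc (suc j))))) (notT (sameT (suc zero) zero)))
          nil)
      (if (hd (var (suc (suc j)))) nil (restT (suc zero) zero))))

entryT : Tm (suc (suc m))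
entryT = if (edgeT (suc zero) zero) (cons nil nil) nil

rowT kernelT : Tm (suc m)
rowT = mapT labelsT entryT

kernelT = mapT labelsT rowT

codeLabel : ∀ {n} → Label n → Tree
codeLabel (inj₁ x)       = nil ∙ codeFin x
-- The shift by one reserves `nil` as the mark of rest vertices.
codeLabel (inj₂ (i , j)) = codeℕ (suc i) ∙ codeℕ j

-- Correctness of the terms

module Specification (I : Instance) where
  private
    n = order I
    G = graph I
  open Reduction G (k I)

  record Input {m} (ρ : Vec Tree (suc m)) : Set where
    constructor ⟪_⟫
    field input≡ : Vec.lookup ρ (fromℕ m) ≡ codeInstance I

  record Vertex {m} (ρ : Vec Tree (suc m)) (i : Fin (suc m)) (x : Fin n) : Set where
    constructor ⟪_⟫
    field vertex≡ : Vec.lookup ρ i ≡ codeFin x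

  private variable
    ρ : Vec Tree (suc m)
    i j : Fin (suc m)
    x y : Fin n
    z : Tree

  ↑_ : Input ρ → Input (z ∷ ρ)
  ↑ ⟪ eq ⟫ = ⟪ eq ⟫

  top : Vertex (codeFin x ∷ ρ) zero x
  top = ⟪ refl ⟫

  pop : Vertex ρ i x → Vertex (z ∷ ρ) (suc i) x
  pop ⟪ eq ⟫ = ⟪ eq ⟫

  size-graph : Input ρ → Size ρ graphT n
  size-graph ⟪ eq ⟫ = ⟪ trans (cong (spine ∘ head′) eq)
    (trans (spine-codeList (codeList codeBool) _) (length-tabulate {n = n} _)) ⟫

  size-k : Input ρ → Size ρ kT (k I)
  size-k ⟪ eq ⟫ = ⟪ trans (cong (spine ∘ tail′) eq) (spine-codeℕ (k I)) ⟫

  list-verts : Input ρ → Lists ρ vertsT codeFin vs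
  list-verts {ρ = ρ} inp = ⟪ indices-allFin (⟦ graphT ⟧ ρ) (spine≡ (size-graph inp)) ⟫

  truth-any : ∀ {P : Fin n → Set} {t} → Input ρ → (∀ x → Truth (codeFin x ∷ ρ) t (P x)) →
              Truth ρ (anyT t) (∃[ x ] P x)
  truth-any {ρ = ρ} {P} {t} inp h = ⟪ subst (λ v → Reflects (∃[ x ] P x) (isCons v))
    (sym (value (list-filter {u = t} P? (list-verts inp) h))) (go (filter P? vs) refl) ⟫
    where
    P? : Decidable P
    -- The term `t` itself decides `P`.
    P? x = _ because reflects (h x)
    go : ∀ xs → filter P? vs ≡ xs → Reflects (∃[ x ] P x) (isCons (codeList codeFin xs))
    go []      eq = ofⁿ λ (x , p) → case (subst (x ∈_) eq (∈-filter⁺ P? (∈-allFin x) p))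
      where
      case : ∀ {x : Fin n} → x ∈ [] → ⊥
      case ()
    go (x ∷ _) eq = ofʸ (x , proj₂ (∈-filter⁻ P? {xs = vs} (subst (x ∈_) (sym eq) (here refl))))

  truth-all : ∀ {P : Fin n → Set} {t} → Input ρ → (∀ x → Truth (codeFin x ∷ ρ) t (P x)) →
              Truth ρ (allT t) (∀ x → P x)
  truth-all {P = P} inp h = truth-⇔
    (mk⇔ (λ ¬∃ x → stable x (λ ¬p → ¬∃ (x , ¬p))) (λ ∀P (x , ¬p) → ¬p (∀P x)))
    (truth-not (truth-any inp (λ x → truth-not (h x))))
    where
    stable : ∀ x → ¬ ¬ P x → P x
    stable x = decidable-stable (_ because reflects (h x))

  size-vertex : Vertex ρ i x → Size ρ (var i) (toℕ x)
  size-vertex {x = x} ⟪ eq ⟫ = ⟪ trans (cong spine eq) (spine-codeℕ (toℕ x)) ⟫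

  truth-adj : Input ρ → Vertex ρ i x → Vertex ρ j y → Truth ρ (adjT i j) (Adj G x y)
  truth-adj {ρ = ρ} {i} {x} {j} {y} ⟪ inp ⟫ ⟪ ix ⟫ ⟪ jy ⟫ =
    ⟪ subst (λ v → Reflects (Adj G x y) (isCons v)) (sym entry) (isCons-codeBool (Graph.adj G x y)) ⟫
    where
    entry : ⟦ adjT i j ⟧ ρ ≡ codeBool (Graph.adj G x y)
    entry = begin
      head′ (dropᵗ (Vec.lookup ρ j) (head′ (dropᵗ (Vec.lookup ρ i) (⟦ graphT ⟧ ρ))))
        ≡⟨ cong₂ (λ a b → head′ (dropᵗ a b)) jy (cong head′ (cong₂ dropᵗ ix (cong head′ inp))) ⟩
      head′ (dropᵗ (codeFin y) (head′ (dropᵗ (codeFin x) (codeGraph G))))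
        ≡⟨ cong (λ r → head′ (dropᵗ (codeFin y) r)) (drop-lookup (codeList codeBool) _ x) ⟩
      head′ (dropᵗ (codeFin y) (codeList codeBool (tabulate (Graph.adj G x))))
        ≡⟨ drop-lookup codeBool (Graph.adj G x) y ⟩
      codeBool (Graph.adj G x y) ∎
      where open ≡-Reasoning
    isCons-codeBool : ∀ b → Reflects (T b) (isCons (codeBool b))
    isCons-codeBool false = ofⁿ λ ()
    isCons-codeBool true  = ofʸ _

  truth-same : Vertex ρ i x → Vertex ρ j y → Truth ρ (sameT i j) (x ≡ y)
  truth-same ix jy = truth-⇔ (mk⇔ Fin.toℕ-injective (cong toℕ)) (truth-eq (size-vertex ix) (size-vertex jy))

  truth-n : Input ρ → Vertex ρ i x → Vertex ρ j y → Truth ρ (nT i j) (N[ x ] y)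
  truth-n inp ix jy = truth-or (truth-same ix jy) (truth-adj inp ix jy)

  list-nbrs : Input ρ → Vertex ρ i x → Lists ρ (degT i) codeFin (nbrs x)
  list-nbrs {x = x} inp ix = list-filter (adj? x) (list-verts inp) λ y → truth-adj (↑ inp) (pop ix) top

  truth-min : Input ρ → Vertex ρ i x → Truth ρ (minT i) (Min x)
  truth-min inp ix = truth-all inp λ y →
    truth-le (size-list (list-nbrs (↑ inp) (pop ix))) (size-list (list-nbrs (↑ inp) top))

  truth-rest : Input ρ → Vertex ρ i x → Vertex ρ j y → Truth ρ (restT i j) (Rest x y)
  truth-rest inp ix jy = truth-and (truth-adj inp ix jy) (truth-not (truth-any inp λ u →
    truth-and (truth-min (↑ inp) top)
      (truth-and (truth-n (↑ inp) top (pop ix)) (truth-n (↑ inp) top (pop jy)))))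

  truth-restVertex : Input ρ → Vertex ρ i x → Truth ρ (restVertexT i) (RestVertex x)
  truth-restVertex inp ix = truth-any inp λ y → truth-rest (↑ inp) (pop ix) top

  list-rest : Input ρ → Lists ρ restVerticesT codeFin rest
  list-rest inp = list-filter RestVertex? (list-verts inp) λ x → truth-restVertex (↑ inp) top

  size-d : Input ρ → Size ρ dT d
  size-d inp = ⟪ trans (cong (spine ∘ head′) (value
      (list-map (codeList codeFin) {u = degT zero} nbrs
        (list-filter Min? (list-verts inp) (λ x → truth-min (↑ inp) top))
        (λ x → value (list-nbrs (↑ inp) top)))))
    (go (filter Min? vs)) ⟫
    where
    go : ∀ us → spine (head′ (codeList (codeList codeFin) (map nbrs us))) ≡ firstDeg us
    go []      = refl
    go (u ∷ _) = spine-codeList codeFin (nbrs u)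

  size-size : Input ρ → Size ρ sizeT (suc d)
  size-size inp = ⟪ cong suc (spine≡ (size-d inp)) ⟫

  size-edges : Input ρ → Size ρ edgesT (length edges)
  size-edges inp = size-list (list-pairs nbrs (list-verts inp) (λ x → list-nbrs (↑ inp) top))

  size-2k : Input ρ → Size ρ 2kT (2 * k I)
  size-2k inp = size-mul (size-quote 2) (λ _ → size-k (↑ inp))

  truth-clash-free : Input ρ → Truth ρ clash-freeT Clash-free
  truth-clash-free inp =
    truth-all inp λ u → truth-all (↑ inp) λ u′ → truth-all (↑ ↑ inp) λ x → truth-all (↑ ↑ ↑ inp) λ y →
      let inp′ = ↑ ↑ ↑ ↑ inp
          inStars = λ {i} {w} (iw : Vertex _ i w) →
            truth-and (truth-min inp′ iw) (truth-and (truth-n inp′ iw (pop top)) (truth-n inp′ iw top))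
      in truth-imp (inStars (pop (pop (pop top)))) (truth-imp (inStars (pop (pop top)))
           (truth-or (truth-same (pop top) top)
             (truth-and (truth-adj inp′ (pop top) top) (truth-n inp′ (pop (pop (pop top))) (pop (pop top))))))

  truth-good : Input ρ → Truth ρ goodT Good
  truth-good inp = truth-and (truth-clash-free inp)
    (truth-and
      (truth-le (size-edges inp)
        (size-mul (size-d inp) (λ _ → size-append (size-graph (↑ inp)) (size-k (↑ inp)))))
      (truth-or (truth-le (size-list (list-rest inp)) ⟪ refl ⟫)
        (truth-and (truth-le (size-list (list-rest inp)) (size-k inp))
                   (truth-le (size-size inp) (size-k inp)))))

  size-codeℕ : ∀ {t : Tm m} {ρ a} → ⟦ t ⟧ ρ ≡ codeℕ a → Size ρ t a
  size-codeℕ {a = a} eq = ⟪ trans (cong spine eq) (spine-codeℕ a) ⟫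

  list-blocks : Input ρ → Lists ρ blocksT codeℕ blocks
  list-blocks inp = list-filter fits? (list-indices (size-2k inp)) λ i →
    truth-le (size-mul {t = cons nil v0} (size-codeℕ {a = suc i} refl) (λ _ → size-size (↑ ↑ inp)))
             (size-2k (↑ inp))

  list-labels : Input ρ → Lists ρ labelsT codeLabel labels
  list-labels inp = list-append
    (list-map codeLabel inj₁ (list-rest inp) (λ _ → refl))
    (list-map codeLabel inj₂
      (list-pairs (λ _ → upTo (suc d)) (list-blocks inp) (λ _ → list-indices (size-size (↑ inp))))
      (λ _ → refl))

  record LabelAt {m} (ρ : Vec Tree (suc m)) (i : Fin (suc m)) (a : Label n) : Set where
    constructor ⟪_⟫
    field label≡ : Vec.lookup ρ i ≡ codeLabel a

  private variable
    a b : Label n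

  truth-edge : Input ρ → LabelAt ρ i a → LabelAt ρ j b → Truth ρ (edgeT i j) (Edge a b)
  truth-edge {i = i} {inj₁ x} {j} {inj₁ y} inp ⟪ p ⟫ ⟪ q ⟫ =
    truth-let {t = tl (var i)} (truth-let {t = tl (var (suc j))}
      (truth-else (cong head′ p) (truth-else (cong head′ q)
        (truth-rest (↑ ↑ inp) (pop ⟪ cong tail′ p ⟫) ⟪ cong tail′ q ⟫))))
  truth-edge {i = i} {inj₁ x} {j} {inj₂ _} inp ⟪ p ⟫ ⟪ q ⟫ =
    truth-let {t = tl (var i)} (truth-let {t = tl (var (suc j))}
      (truth-else (cong head′ p) (truth-then (cong head′ q) truth-nil)))
  truth-edge {i = i} {inj₂ _} {j} {inj₁ y} inp ⟪ p ⟫ ⟪ q ⟫ =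
    truth-let {t = tl (var i)} (truth-let {t = tl (var (suc j))}
      (truth-then (cong head′ p) (truth-else (cong head′ q) truth-nil)))
  truth-edge {i = i} {inj₂ (b , x)} {j} {inj₂ (c , y)} inp ⟪ p ⟫ ⟪ q ⟫ =
    truth-let {t = tl (var i)} (truth-let {t = tl (var (suc j))}
      (truth-then (cong head′ p) (truth-then (cong head′ q)
        (truth-⇔ (mk⇔ (λ (eq , x≢y) → suc-injective eq , x≢y) (λ (eq , x≢y) → cong suc eq , x≢y))
          (truth-and (truth-eq (size-codeℕ {a = suc b} (cong head′ p)) (size-codeℕ {a = suc c} (cong head′ q)))
                     (truth-not (truth-eq (size-codeℕ {a = x} (cong tail′ p))
                                          (size-codeℕ {a = y} (cong tail′ q)))))))))

  -- The program runs over the labels, `kernel` over their positions; `map-lookup` relates the two.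
  ⟦kernelT⟧ : Input ρ → ⟦ kernelT ⟧ ρ ≡ codeGraph kernel
  ⟦kernelT⟧ {ρ = ρ} inp = begin
    ⟦ kernelT ⟧ ρ
      ≡⟨ value (list-map (codeList codeBool) {u = rowT} row (list-labels inp) λ a → value
           (list-map codeBool {u = entryT} (entry a) (list-labels (↑_ {z = codeLabel a} inp)) λ b →
             ⟦if⟧ {u = cons nil nil} {nil} (truth-edge {i = suc zero} {a} {zero} {b} (↑ ↑ inp) ⟪ refl ⟫ ⟪ refl ⟫)
                  (Edge? a b) codeBool {true} {false} refl refl)) ⟩
    codeList (codeList codeBool) (map row labels)
      ≡⟨ cong (codeList (codeList codeBool)) (trans (map-lookup row)
           (tabulate-cong λ u → map-lookup (entry (lookup labels u)))) ⟩
    codeList (codeList codeBool) (tabulate λ u → tabulate λ w → entry (lookup labels u) (lookup labels w))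
      ≡⟨ cong (codeList (codeList codeBool)) (tabulate-cong λ u → tabulate-cong λ w →
           if-true (does (Edge? (lookup labels u) (lookup labels w)))) ⟩
    codeGraph kernel ∎
    where
    open ≡-Reasoning
    entry : Label n → Label n → Bool
    entry a b = if does (Edge? a b) then true else false
    row : Label n → List Bool
    row a = map (entry a) labels
    map-lookup : ∀ {A : Set} (f : Label n → A) → map f labels ≡ tabulate (f ∘ lookup labels)
    map-lookup f = trans (cong (map f) (sym (tabulate-lookup labels))) (map-tabulate (lookup labels) f)
    if-true : ∀ b → (if b then true else false) ≡ b
    if-true false = refl
    if-true true  = refl

-- An edge forces cliques of order at least 2, which leave no vertex isolated.
noGraph : Graph 3
noGraph = record
  { adj    = adj
  ; sym    = from-yes (Fin.all? λ u → Fin.all? λ w → adj u w Bool.≟ adj w u)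
  ; irrefl = from-yes (Fin.all? λ u → adj u u Bool.≟ false)
  }
  where
  adj : Fin 3 → Fin 3 → Bool
  adj zero       (suc zero) = true
  adj (suc zero) zero       = true
  adj _          _          = false

no-decomp : ∀ {B : Set} {J : List B} {K s} → ¬ Decomp (allFin 3) (Adj noGraph) J K s
no-decomp {K = K} {s} D = <⇒≱ 1<s s≤1
  where
  open Decomp D
  isolated : Fin 3
  isolated = suc (suc zero)
  1<s : 1 < s
  1<s = let b , b∈ , 0∈ , 1∈ = cover {zero} {suc zero} (∈-allFin _) (∈-allFin _) _ in
    subst (2 ≤_) (K-length b∈) (⊆⇒length≤ {xs = zero ∷ suc zero ∷ []} (((λ ()) ∷ []) ∷ [] ∷ [])
      λ { (here refl) → 0∈ ; (there (here refl)) → 1∈ })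
  s≤1 : s ≤ 1
  s≤1 = let b , b∈ , 2∈ = onto (∈-allFin isolated) in
    subst (_≤ 1) (K-length b∈) (⊆⇒length≤ {ys = isolated ∷ []} (K-unique b∈) λ {w} w∈ → only b∈ 2∈ w w∈)
    where
    only : ∀ {b} → b ∈ _ → isolated ∈ K b → ∀ w → w ∈ K b → w ∈ isolated ∷ []
    only b∈ 2∈ w w∈ with isolated Fin.≟ w
    ... | yes eq = here (sym eq)
    ... | no neq = ⊥-elim (clique b∈ 2∈ w∈ neq)

-- The kernelization

module _ (I : Instance) where
  open Reduction (graph I) (k I)

  kernelInstance noInstance : Instance
  kernelInstance = record { order = length labels ; graph = kernel ; k = k I ; positive = Instance.positive I }
  noInstance     = record { order = 3 ; graph = noGraph ; k = k I ; positive = Instance.positive I }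

  ¬UCEVS-noInstance : ¬ UCEVS noInstance
  ¬UCEVS-noInstance U = let _ , _ , _ , D , _ = UCEVS⇒Decomp noInstance U in no-decomp D

  module _ (large : 4 * k I < order I) where
    private
      k<n : k I < order I
      k<n = ≤-<-trans (m≤n*m (k I) 4) large

      ∈-labels : ∀ {a} → a ∈ labels → ∃[ i ] i ∈ allFin (length labels) × a ≡ lookup labels i
      ∈-labels a∈ = index a∈ , ∈-allFin _ , lookup-index a∈

    UCEVS⇒Good : UCEVS I → Good
    UCEVS⇒Good U = let _ , _ , _ , D , cost = UCEVS⇒Decomp I U in Forward.good D cost k<n

    UCEVS⇒kernel : UCEVS I → UCEVS kernelInstance
    UCEVS⇒kernel U =
      let _ , _ , _ , D , cost = UCEVS⇒Decomp I U
          open Forward D cost k<n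
      in Decomp⇒UCEVS kernelInstance
           (pullback (lookup labels) (lookup-injective labels-unique) (λ {i} _ → ∈-lookup i) ∈-labels
                     (λ {i} {j} → T-does (Edge? (lookup labels i) (lookup labels j)))
                     _≟ᴸ_ (Unique.allFin⁺ _) kernel-decomp)
           kernel-cost

    kernel⇒UCEVS : Good → UCEVS kernelInstance → UCEVS I
    kernel⇒UCEVS good U = case (d ≟ 0)
      where
      case : Dec (d ≡ 0) → UCEVS I
      case (yes d≡0) = Backward.Edgeless.solution I good d≡0
      case (no d≢0)  =
        let _ , _ , _ , D , cost = UCEVS⇒Decomp kernelInstance U in
        Backward.solution I good
          (pushforward (lookup labels) (lookup-injective labels-unique) (λ {i} _ → ∈-lookup i) ∈-labels
                       (λ {i} {j} → T-does (Edge? (lookup labels i) (lookup labels j))) D)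
          cost d≢0

  small? : Dec (order I ≤ 4 * k I)
  small? = order I ≤? 4 * k I

  reduce : Instance
  -- Branching on `does` is the form in which `⟦if⟧` relates a decision to a conditional of the
  -- program.
  reduce = if does small? then I else (if does Good? then kernelInstance else noInstance)

  reduce-equivalent : UCEVS I ⇔ UCEVS reduce
  reduce-equivalent = go small? Good?
    where
    go : (s : Dec (order I ≤ 4 * k I)) (g : Dec Good) →
         UCEVS I ⇔ UCEVS (if does s then I else (if does g then kernelInstance else noInstance))
    go (yes _) _        = mk⇔ id id
    go (no ¬s) (yes g)  = mk⇔ (UCEVS⇒kernel (≰⇒> ¬s)) (kernel⇒UCEVS (≰⇒> ¬s) g)
    go (no ¬s) (no ¬g)  = mk⇔ (λ U → ⊥-elim (¬g (UCEVS⇒Good (≰⇒> ¬s) U))) (⊥-elim ∘ ¬UCEVS-noInstance)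

  reduce-order : order reduce ≤ 4 * k I
  reduce-order = go small? Good?
    where
    go : (s : Dec (order I ≤ 4 * k I)) (g : Dec Good) →
         order (if does s then I else (if does g then kernelInstance else noInstance)) ≤ 4 * k I
    go (yes s) _       = s
    go (no _)  (yes g) = Good⇒labels≤ g
    -- Positivity of `k` makes room for the three vertices of `noGraph`.
    go (no _)  (no _)  = ≤-trans (n≤1+n 3) (*-monoʳ-≤ 4 (Instance.positive I))

  reduce-k : k reduce ≡ k I
  reduce-k = go small? Good?
    where
    go : (s : Dec (order I ≤ 4 * k I)) (g : Dec Good) →
         k (if does s then I else (if does g then kernelInstance else noInstance)) ≡ k I
    go (yes _) _       = refl
    go (no _)  (yes _) = refl
    go (no _)  (no _)  = refl

reduceT : Tm 1
reduceT = if (leT graphT (mulT (quoteT (codeℕ 4)) kT)) inputT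
             (if goodT (cons kernelT kT) (cons (quoteT (codeGraph noGraph)) kT))

⟦reduceT⟧ : ∀ I → ⟦ reduceT ⟧ (codeInstance I ∷ []) ≡ codeInstance (reduce I)
⟦reduceT⟧ I =
  ⟦if⟧ {t = leT graphT (mulT (quoteT (codeℕ 4)) kT)} {inputT} {if goodT yesT noT}
    (truth-le (size-graph inp) (size-mul (size-quote 4) (λ _ → size-k (↑ inp)))) (small? I) codeInstance refl
    (⟦if⟧ {t = goodT} {yesT} {noT} (truth-good inp) Good? codeInstance {kernelInstance I} {noInstance I}
      (cong (_∙ codeℕ (k I)) (⟦kernelT⟧ inp))
      (cong (_∙ codeℕ (k I)) (⟦quoteT⟧ (codeInstance I ∷ []) (codeGraph noGraph))))
  where
  open Reduction (graph I) (k I) using (Good?)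
  open Specification I
  yesT noT : Tm 1
  yesT = cons kernelT kT
  noT  = cons (quoteT (codeGraph noGraph)) kT
  inp : Input (codeInstance I ∷ [])
  inp = ⟪ refl ⟫

theorem27 : Kernel UCEVS (λ k → 4 * k)
theorem27 = record
  { reduce     = reduce
  ; polyTime   = polyTime-Tm codeInstance codeInstance reduce reduceT ⟦reduceT⟧
  ; equivalent = reduce-equivalent
  ; vertices   = reduce-order
  ; bound      = id
  ; computable = record { funs = 0 ; body = [] ; main = var zero } , λ n → 1 , var zero
  ; parameter  = λ I → ≤-reflexive (reduce-k I)
  }
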